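{- Let $F$ be a graph with $\chi(F)\ge 3$ and $r$ a positive integer. Suppose $\mathrm{biex}(n,F)=O(1)$, and suppose that for all sufficiently large $n$ every $n$-vertex $F$-free graph with $\mathrm{ex}(n,F)$ edges is obtained by taking the Turán graph $T(n,\chi(F)-1)$ and adding, inside one of its parts, a $\mathcal{D}(F)$-free graph with $\mathrm{biex}(n,F)$ edges. Then for all sufficiently large $n$, every $n$-vertex $F$-free graph $G$ with $\mathcal{N}(S_r,G)=\mathrm{ex}(n,S_r,F)$, and every $n$-vertex $F$-free graph $G$ with $e_r(G)=\mathrm{ex}_r(n,F)$, is obtained by taking a complete $(\chi(F)-1)$-partite graph on $n$ vertices and adding, inside one of its parts, a $\mathcal{D}(F)$-free graph with $\mathrm{biex}(n,F)$ edges.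
   Context: $\mathrm{ex}(n,F)$ is the maximum number of edges of an $n$-vertex $F$-free graph. $T(n,k)$ is the complete $k$-partite $n$-vertex graph with parts of order $\lfloor n/k\rfloor$ or $\lceil n/k\rceil$. $S_r$ is the star with $r$ leaves; $\mathcal{N}(S_r,G)$ is the number of copies of $S_r$ in $G$, and $\mathrm{ex}(n,S_r,F)$ is its maximum over $n$-vertex $F$-free graphs. For $G$ with degree sequence $d_1,\dots,d_n$, $e_r(G)=\sum_i d_i^r$, and $\mathrm{ex}_r(n,F)$ is its maximum over $n$-vertex $F$-free graphs. For $F$ with $\chi(F)=k+1$, the decomposition family $\mathcal{D}(F)$ is the family of bipartite graphs induced in $F$ by the union of two color classes of some proper $(k+1)$-coloring of $F$; a graph is $\mathcal{D}(F)$-free if it contains no member of $\mathcal{D}(F)$; $\mathrm{biex}(n,F)=\mathrm{ex}(n,\mathcal{D}(F))$. -}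

module Defs where

open import Data.Nat using (ℕ; zero; suc; _+_; _^_; _≤_; _<ᵇ_)
open import Data.Nat.Combinatorics using (_C_)
open import Data.Bool using (Bool; true; false; if_then_else_; _∧_)
open import Data.Fin using (Fin; toℕ; _≟_)
open import Data.List using (map; allFin)
open import Data.Nat.ListAction using (sum)
open import Data.Product using (Σ; Σ-syntax; _×_; ∃; ∃-syntax; _,_)
open import Data.Sum using (_⊎_)
open import Relation.Binary.PropositionalEquality using (_≡_; _≢_)
open import Relation.Nullary using (¬_)
open import Relation.Nullary.Decidable using (⌊_⌋)

record Graph (n : ℕ) : Set where
  field
    adj        : Fin n → Fin n → Bool
    adj-sym    : ∀ i j → adj i j ≡ adj j i
    adj-irrefl : ∀ i → adj i i ≡ false
open Graph public

VSet : ℕ → Set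
VSet n = Fin n → Bool

full : ∀ {n} → VSet n
full _ = true

Σᵛ : ∀ {n} → (Fin n → ℕ) → ℕ
Σᵛ {n} f = sum (map f (allFin n))

ind : Bool → ℕ
ind true  = 1
ind false = 0

degree : ∀ {n} → Graph n → Fin n → ℕ
degree G i = Σᵛ (λ j → ind (adj G i j))

edgesIn : ∀ {n} → Graph n → VSet n → ℕ
edgesIn G S = Σᵛ (λ i → Σᵛ (λ j → ind (S i ∧ S j ∧ (toℕ i <ᵇ toℕ j) ∧ adj G i j)))

edges : ∀ {n} → Graph n → ℕ
edges G = edgesIn G full

_⊆ᴳ_ : ∀ {m n} → Graph m → Graph n → Set
_⊆ᴳ_ {m} {n} F G = Σ[ f ∈ (Fin m → Fin n) ]
  ((∀ x y → f x ≡ f y → x ≡ y) × (∀ x y → adj F x y ≡ true → adj G (f x) (f y) ≡ true))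

Free : ∀ {m n} → Graph m → Graph n → Set
Free F G = ¬ (F ⊆ᴳ G)

IsProperColoring : ∀ {v c} → Graph v → (Fin v → Fin c) → Set
IsProperColoring F col = ∀ x y → adj F x y ≡ true → col x ≢ col y

Colorable : ∀ {v} → Graph v → ℕ → Set
Colorable {v} F c = Σ[ col ∈ (Fin v → Fin c) ] IsProperColoring F col

IsChromaticNumber : ∀ {v} → Graph v → ℕ → Set
IsChromaticNumber F c = Colorable F c × (∀ c' → Colorable F c' → c ≤ c')

-- For F with χ(F) = suc k: the induced subgraph G[S] contains a member of D(F),
-- i.e. for some proper (suc k)-colouring of F and two distinct colours a ≢ b,
-- the subgraph of F induced by the union U of the two colour classes has a copy in G[S].
ContainsDecomp : ∀ {v n} → Graph v → ℕ → Graph n → VSet n → Set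
ContainsDecomp {v} {n} F k G S =
  Σ[ col ∈ (Fin v → Fin (suc k)) ] (IsProperColoring F col ×
  Σ[ a ∈ Fin (suc k) ] Σ[ b ∈ Fin (suc k) ] (a ≢ b ×
  Σ[ f ∈ (Fin v → Fin n) ]
    ((∀ x → (col x ≡ a ⊎ col x ≡ b) → S (f x) ≡ true) ×
     (∀ x y → (col x ≡ a ⊎ col x ≡ b) → (col y ≡ a ⊎ col y ≡ b) → f x ≡ f y → x ≡ y) ×
     (∀ x y → (col x ≡ a ⊎ col x ≡ b) → (col y ≡ a ⊎ col y ≡ b) →
        adj F x y ≡ true → adj G (f x) (f y) ≡ true))))

IsMax : (ℕ → Set) → ℕ → Set
IsMax P m = P m × (∀ m' → P m' → m' ≤ m)

IsBiex : ∀ {v} → Graph v → ℕ → ℕ → ℕ → Set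
IsBiex F k n m = IsMax (λ e → Σ[ H ∈ Graph n ] (¬ ContainsDecomp F k H full × edges H ≡ e)) m

MaximizesAmongFree : ∀ {v n} → Graph v → (∀ {m} → Graph m → ℕ) → Graph n → Set
MaximizesAmongFree {v} {n} F φ G = Free F G × (∀ (H : Graph n) → Free F H → φ H ≤ φ G)

Nstar : ℕ → ∀ {n} → Graph n → ℕ
Nstar (suc zero) G = edges G
Nstar zero G = Σᵛ (λ i → degree G i C 0)
Nstar (suc (suc r)) G = Σᵛ (λ i → degree G i C suc (suc r))

eR : ℕ → ∀ {n} → Graph n → ℕ
eR r G = Σᵛ (λ i → degree G i ^ r)

inPart : ∀ {n k} → (Fin n → Fin k) → Fin k → VSet n
inPart p a i = ⌊ p i ≟ a ⌋

partSize : ∀ {n k} → (Fin n → Fin k) → Fin k → ℕ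
partSize p a = Σᵛ (λ i → ind (inPart p a i))

PartitePlusD : ∀ {v n} → Graph v → (k : ℕ) → Graph n → (Fin n → Fin k) → Fin k → Set
PartitePlusD {v} {n} F k G p a =
  (∀ i j → p i ≢ p j → adj G i j ≡ true) ×
  (∀ i j → p i ≡ p j → p i ≢ a → adj G i j ≡ false) ×
  ¬ ContainsDecomp F k G (inPart p a) ×
  IsBiex F k n (edgesIn G (inPart p a))

CompletePartitePlusD : ∀ {v n} → Graph v → ℕ → Graph n → Set
CompletePartitePlusD {v} {n} F k G =
  Σ[ p ∈ (Fin n → Fin k) ] ((∀ a → ∃[ i ] p i ≡ a) × Σ[ a ∈ Fin k ] PartitePlusD F k G p a)

TuranPlusD : ∀ {v n} → Graph v → ℕ → Graph n → Set
TuranPlusD {v} {n} F k G =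
  Σ[ p ∈ (Fin n → Fin k) ] ((∀ a b → partSize p a ≤ suc (partSize p b)) × Σ[ a ∈ Fin k ] PartitePlusD F k G p a)

{-# OPTIONS --safe #-}
-- Let Φ(G) be the sum of φ over the degrees, with φ = x ^ r or x C r.  Choosing v₁, v₂, … greedily
-- among the vertices of almost largest degree in the common neighbourhood of the earlier ones, and
-- sorting every vertex by the first vᵢ it is not adjacent to, majorizes the degrees of G by those of
-- a complete k-partite graph, so in an extremal graph the chain is a k-clique of degree sum
-- close to (k - 1) n.  There are Ω(n ^ k) such chains, hence a complete k-partite block all of whose
-- diagonals are heavy.  As biex is bounded, a star belongs to the decomposition family, so F minus
-- some vertex is k-colourable; hence every vertex nearly misses one class of the block, and this
-- sorts the vertices into k parts.  Rewiring a vertex like a twin of a class cannot increase Φ, so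
-- every vertex is adjacent to almost everything outside its own part.
--
-- Then boundedly many edges lie inside parts, and all missing pairs across parts join their
-- endpoints.  For a set J of parts let m(J) and q(J) count the edges inside the parts of J and the
-- missing pairs between them.  Placing this configuration on a Turán partition, the hypothesis on
-- ex(n,F) gives m(J) ≤ biex + q(J), with equality for the set of all parts only in the wanted
-- structure.  The change of Φ against the complete k-partite graph weighs a part of size s by
-- about φ′(n - s); summing the inequality over the level sets of this weight shows that without
-- equality Φ(G) is smaller than for biex edges inside a smallest part.
module Submission where

open import Defs
open import Data.Bool using (Bool; true; false; if_then_else_; _∧_; _∨_; not)
open import Data.Bool.Properties using () renaming (_≟_ to _≟ᵇ_)
open import Data.Empty using (⊥; ⊥-elim)
open import Data.Fin using (Fin; zero; suc; toℕ; _≟_; punchOut)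
open import Data.Fin.Properties using (any?; all?; injective⇒≤; punchOut-injective; punchOut-cong; toℕ-injective)
open import Data.List using (List; []; _∷_; allFin)
open import Data.List.Membership.Propositional using (_∈_)
open import Data.List.Membership.Propositional.Properties using (∈-allFin)
open import Data.List.Properties using (map-tabulate)
open import Data.List.Relation.Unary.Any using (here; there)
open import Data.Nat using (ℕ; zero; suc; _+_; _*_; _∸_; _^_; _≤_; _<_; z≤n; s≤s; _≤?_; _<?_; _<ᵇ_; _/_; NonZero; nonZero; >-nonZero)
open import Data.Nat.Combinatorics using (_C_; nCk+nC[k+1]≡[n+1]C[k+1]; nCn≡1; k>n⇒nCk≡0)
open import Data.Nat.DivMod using (m/n*n≤m; m*n/n≡m; /-monoˡ-≤)
open import Data.Nat.ListAction using (sum)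
open import Data.Nat.Properties hiding (_≟_)
open import Data.Nat.Tactic.RingSolver using (solve)
open import Data.Product using (Σ; _×_; ∃; ∃-syntax; _,_; proj₁; proj₂)
open import Data.Sum using (_⊎_; inj₁; inj₂)
open import Data.Vec using (Vec; lookup) renaming ([] to ⟨⟩; _∷_ to _◂_)
open import Function using (_∘_; id)
open import Relation.Binary using (tri<; tri≈; tri>)
open import Relation.Binary.PropositionalEquality using (_≡_; _≢_; refl; sym; trans; cong; cong₂; subst; subst₂; module ≡-Reasoning)
open import Relation.Nullary using (¬_; Dec; yes; no)
open import Relation.Nullary.Decidable using (⌊_⌋; _×-dec_; _→-dec_; _⊎-dec_; ¬?; map′)

-- Two obstacles shape the proof. The optimal part sizes for Φ need not be balanced, while the
-- hypothesis on ex(n,F) speaks of Turán partitions only. It can still be used: once all parts are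
-- large and almost nothing is missing across them, an embedding of F is controlled by the
-- adjacencies among boundedly many core vertices, so a core can be moved to a partition with other
-- part sizes (`transfer`). Moreover, the maximum of Φ is not known, so every estimate compares G
-- with a competitor: a complete k-partite graph, a graph with one rewired vertex, or a transplanted
-- core. The early comparisons lose constant factors, and polynomial growth (`scaling`) turns them
-- into contradictions. The last one is exact up to second differences of the objective, which are
-- smaller than its first differences by a factor of order n.

-- Arithmetic, Boolean and decidability helpers

infixl 6 _+≤_
infixr 6.5 _·≤_
infix 1 _of_

_+≤_ : ∀ {a b c d} → a ≤ b → c ≤ d → a + c ≤ b + d
_+≤_ = +-mono-≤

_·≤_ : ∀ {a b} c → a ≤ b → c * a ≤ c * b
_·≤_ c = *-monoʳ-≤ c

-- Linear arithmetic by certificate: A ≤ B is a combination of the hypotheses, s the slack.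
lin : ∀ {A B L R} s → A ≤ B → L + B + s ≡ R + A → L ≤ R
lin {A} {B} {L} {R} s p e =
  +-cancelʳ-≤ B L R (≤-trans (m≤m+n (L + B) s) (≤-trans (≤-reflexive e) (+-monoʳ-≤ R p)))

+-≤-split : ∀ a {b n} → a + b ≤ n → a ≤ n × b ≤ n
+-≤-split a p = m+n≤o⇒m≤o a p , m+n≤o⇒n≤o a p

_of_ : ∀ {P : Set} (d : Dec P) → ⌊ d ⌋ ≡ true → P
yes p of _ = p

yes⇒ : ∀ {P : Set} (d : Dec P) → P → ⌊ d ⌋ ≡ true
yes⇒ (yes _) _ = refl
yes⇒ (no ¬p) p = ⊥-elim (¬p p)

no⇒ : ∀ {P : Set} (d : Dec P) → ¬ P → ⌊ d ⌋ ≡ false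
no⇒ (yes p) ¬p = ⊥-elim (¬p p)
no⇒ (no _) _ = refl

false⇒ : ∀ {P : Set} (d : Dec P) → ⌊ d ⌋ ≡ false → ¬ P
false⇒ (no ¬p) _ = ¬p

∧-split : ∀ {a b} → a ∧ b ≡ true → a ≡ true × b ≡ true
∧-split {true} {true} _ = refl , refl

∧-intro : ∀ {a b} → a ≡ true → b ≡ true → a ∧ b ≡ true
∧-intro refl refl = refl

∨-split : ∀ {a b} → a ∨ b ≡ true → a ≡ true ⊎ b ≡ true
∨-split {true} _ = inj₁ refl
∨-split {false} e = inj₂ e

true≢false : ∀ {b} → b ≡ true → b ≡ false → ⊥
true≢false refl ()

¬true : ∀ {b} → ¬ (b ≡ true) → b ≡ false
¬true {true} h = ⊥-elim (h refl)
¬true {false} _ = refl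

not-true : ∀ {b} → b ≡ false → not b ≡ true
not-true refl = refl

not-false : ∀ {b} → not b ≡ true → b ≡ false
not-false {false} _ = refl

bool-case : ∀ b → b ≡ true ⊎ b ≡ false
bool-case true = inj₁ refl
bool-case false = inj₂ refl

iff-≡ : ∀ {a b} → (a ≡ true → b ≡ true) → (b ≡ true → a ≡ true) → a ≡ b
iff-≡ {true} {b} f g = sym (f refl)
iff-≡ {false} {true} f g = g refl
iff-≡ {false} {false} f g = refl

ind-mono : ∀ {a b} → (a ≡ true → b ≡ true) → ind a ≤ ind b
ind-mono {true} h rewrite h refl = ≤-refl
ind-mono {false} h = z≤n

ind≤1 : ∀ b → ind b ≤ 1
ind≤1 true = ≤-refl
ind≤1 false = z≤n

ind-pos : ∀ {b} → 1 ≤ ind b → b ≡ true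
ind-pos {true} _ = refl

ind-split : ∀ a b → ind (a ∧ b) + ind (a ∧ not b) ≡ ind a
ind-split true true = refl
ind-split true false = refl
ind-split false b = refl

ind-∨ : ∀ a b → ind (a ∨ b) ≤ ind a + ind b
ind-∨ true b = s≤s z≤n
ind-∨ false b = ≤-refl

≤-quotient : ∀ m {{_ : NonZero m}} {z n} → m * z ≤ n → z ≤ n / m
≤-quotient m {z} p = ≤-trans (≤-reflexive (sym (m*n/n≡m z m))) (/-monoˡ-≤ m (≤-trans (≤-reflexive (*-comm z m)) p))

-- Sums over Fin

Σ-suc : ∀ {n} (f : Fin (suc n) → ℕ) → Σᵛ f ≡ f zero + Σᵛ (f ∘ suc)
Σ-suc f = cong (λ l → f zero + sum l) (trans (map-tabulate suc f) (sym (map-tabulate id (f ∘ suc))))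

Σ-cong : ∀ {n} {f g : Fin n → ℕ} → (∀ i → f i ≡ g i) → Σᵛ f ≡ Σᵛ g
Σ-cong {zero} h = refl
Σ-cong {suc n} {f} {g} h =
  trans (Σ-suc f) (trans (cong₂ _+_ (h zero) (Σ-cong (h ∘ suc))) (sym (Σ-suc g)))

Σ-mono : ∀ {n} {f g : Fin n → ℕ} → (∀ i → f i ≤ g i) → Σᵛ f ≤ Σᵛ g
Σ-mono {zero} h = z≤n
Σ-mono {suc n} {f} {g} h = subst₂ _≤_ (sym (Σ-suc f)) (sym (Σ-suc g)) (h zero +≤ Σ-mono (h ∘ suc))

Σ-+ : ∀ {n} (f g : Fin n → ℕ) → Σᵛ (λ i → f i + g i) ≡ Σᵛ f + Σᵛ g
Σ-+ {zero} f g = refl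
Σ-+ {suc n} f g rewrite Σ-suc (λ i → f i + g i) | Σ-suc f | Σ-suc g | Σ-+ (f ∘ suc) (g ∘ suc) =
  interchange (f zero) (g zero) (Σᵛ (f ∘ suc)) (Σᵛ (g ∘ suc))
  where
  interchange : ∀ a b c d → a + b + (c + d) ≡ a + c + (b + d)
  interchange a b c d = solve (a ∷ b ∷ c ∷ d ∷ [])

Σ-const : ∀ {n} c → Σᵛ {n} (λ _ → c) ≡ n * c
Σ-const {zero} c = refl
Σ-const {suc n} c = trans (Σ-suc {n} (λ _ → c)) (cong (c +_) (Σ-const {n} c))

Σ-* : ∀ {n} c (f : Fin n → ℕ) → Σᵛ (λ i → c * f i) ≡ c * Σᵛ f
Σ-* {zero} c f = sym (*-zeroʳ c)
Σ-* {suc n} c f rewrite Σ-suc (λ i → c * f i) | Σ-suc f | Σ-* c (f ∘ suc) =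
  sym (*-distribˡ-+ c (f zero) (Σᵛ (f ∘ suc)))

Σ-*ʳ : ∀ {n} c (f : Fin n → ℕ) → Σᵛ (λ i → f i * c) ≡ Σᵛ f * c
Σ-*ʳ c f = trans (Σ-cong (λ i → *-comm (f i) c)) (trans (Σ-* c f) (*-comm c _))

Σ-0 : ∀ {n} {f : Fin n → ℕ} → (∀ i → f i ≡ 0) → Σᵛ f ≡ 0
Σ-0 {n} h = trans (Σ-cong h) (trans (Σ-const {n} 0) (*-zeroʳ n))

Σ-swap : ∀ {m n} (f : Fin m → Fin n → ℕ) → Σᵛ (λ i → Σᵛ (f i)) ≡ Σᵛ (λ j → Σᵛ (λ i → f i j))
Σ-swap {zero} {n} f = sym (Σ-0 {n} (λ _ → refl))
Σ-swap {suc m} f =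
  trans (Σ-suc (λ i → Σᵛ (f i)))
    (trans (cong (Σᵛ (f zero) +_) (Σ-swap (f ∘ suc)))
      (trans (sym (Σ-+ (f zero) (λ j → Σᵛ (λ i → f (suc i) j))))
        (Σ-cong (λ j → sym (Σ-suc (λ i → f i j))))))

term≤Σ : ∀ {n} (f : Fin n → ℕ) i → f i ≤ Σᵛ f
term≤Σ f zero = subst (f zero ≤_) (sym (Σ-suc f)) (m≤m+n _ _)
term≤Σ f (suc i) = subst (f (suc i) ≤_) (sym (Σ-suc f)) (≤-trans (term≤Σ (f ∘ suc) i) (m≤n+m _ _))

Σ-<-witness : ∀ {n} (g f : Fin n → ℕ) → Σᵛ g < Σᵛ f → ∃ λ i → g i < f i
Σ-<-witness g f lt with any? (λ i → g i <? f i)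
... | yes w = w
... | no ¬w = ⊥-elim (<⇒≱ lt (Σ-mono (λ i → ≮⇒≥ (λ l → ¬w (i , l)))))

Σ-mono-< : ∀ {n} {f g : Fin n → ℕ} → (∀ i → f i ≤ g i) → ∀ j → f j < g j → Σᵛ f < Σᵛ g
Σ-mono-< {f = f} {g} h zero lt =
  subst₂ _<_ (sym (Σ-suc f)) (sym (Σ-suc g)) (+-mono-<-≤ lt (Σ-mono (h ∘ suc)))
Σ-mono-< {f = f} {g} h (suc j) lt =
  subst₂ _<_ (sym (Σ-suc f)) (sym (Σ-suc g)) (+-mono-≤-< (h zero) (Σ-mono-< (h ∘ suc) j lt))

δ : ∀ {n} → Fin n → Fin n → ℕ
δ i j = ind ⌊ i ≟ j ⌋

δ-refl : ∀ {n} (i : Fin n) → δ i i ≡ 1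
δ-refl i = cong ind (yes⇒ (i ≟ i) refl)

δ-≢ : ∀ {n} {i j : Fin n} → i ≢ j → δ i j ≡ 0
δ-≢ {i = i} {j} h = cong ind (no⇒ (i ≟ j) h)

δ-suc : ∀ {n} (i j : Fin n) → δ (suc i) (suc j) ≡ δ i j
δ-suc i j with i ≟ j
... | yes _ = refl
... | no _ = refl

Σ-δ : ∀ {n} (f : Fin n → ℕ) j → Σᵛ (λ i → δ i j * f i) ≡ f j
Σ-δ {suc n} f zero = trans (Σ-suc (λ i → δ i zero * f i))
  (trans (cong₂ _+_ (+-identityʳ (f zero)) (Σ-0 {n} (λ _ → refl))) (+-identityʳ (f zero)))
Σ-δ f (suc j) = trans (Σ-suc (λ i → δ i (suc j) * f i))
  (trans (Σ-cong (λ i → cong (_* f (suc i)) (δ-suc i j))) (Σ-δ (f ∘ suc) j))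

δ-sym : ∀ {n} (i j : Fin n) → δ i j ≡ δ j i
δ-sym i j = cong ind (iff-≡ (λ e → yes⇒ (j ≟ i) (sym (i ≟ j of e))) (λ e → yes⇒ (i ≟ j) (sym (j ≟ i of e))))

Σ-δ₁ : ∀ {n} (j : Fin n) → Σᵛ (λ i → δ i j) ≡ 1
Σ-δ₁ j = trans (Σ-cong (λ i → sym (*-identityʳ (δ i j)))) (Σ-δ (λ _ → 1) j)

# : ∀ {n} → VSet n → ℕ
# P = Σᵛ (ind ∘ P)

#-mono : ∀ {n} {P Q : VSet n} → (∀ i → P i ≡ true → Q i ≡ true) → # P ≤ # Q
#-mono h = Σ-mono (λ i → ind-mono (h i))

#-≤ : ∀ {n} (P : VSet n) → # P ≤ n
#-≤ {n} P = ≤-trans (Σ-mono (λ i → ind≤1 (P i))) (≤-reflexive (trans (Σ-const {n} 1) (*-identityʳ n)))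

#-full : ∀ {n} → # (full {n}) ≡ n
#-full {n} = trans (Σ-const {n} 1) (*-identityʳ n)

#-split : ∀ {n} (P Q : VSet n) → # (λ i → P i ∧ Q i) + # (λ i → P i ∧ not (Q i)) ≡ # P
#-split P Q = trans (sym (Σ-+ (λ i → ind (P i ∧ Q i)) (λ i → ind (P i ∧ not (Q i)))))
  (Σ-cong (λ i → ind-split (P i) (Q i)))

#-not : ∀ {n} (Q : VSet n) → # Q + # (not ∘ Q) ≡ n
#-not Q = trans (#-split full Q) #-full

#-∨ : ∀ {n} (P Q : VSet n) → # (λ i → P i ∨ Q i) ≤ # P + # Q
#-∨ P Q = ≤-trans (Σ-mono (λ i → ind-∨ (P i) (Q i))) (≤-reflexive (Σ-+ (ind ∘ P) (ind ∘ Q)))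

#-witness : ∀ {n} (P : VSet n) → 1 ≤ # P → ∃ λ i → P i ≡ true
#-witness {n} P h =
  let i , lt = Σ-<-witness {n} (λ _ → 0) (ind ∘ P) (≤-trans (s≤s (≤-reflexive (Σ-0 {n} (λ _ → refl)))) h)
  in i , ind-pos lt

Σ-inj≤1 : ∀ {m n} (f : Fin m → Fin n) → (∀ i j → f i ≡ f j → i ≡ j) → ∀ y → Σᵛ (λ i → δ (f i) y) ≤ 1
Σ-inj≤1 {m} f inj y with any? (λ i → f i ≟ y)
... | no ¬e = ≤-trans (≤-reflexive (Σ-0 (λ i → δ-≢ (λ e → ¬e (i , e))))) z≤n
... | yes (i₀ , refl) = ≤-trans (Σ-mono bound) (≤-reflexive (Σ-δ₁ i₀))
  where
  bound : ∀ i → δ (f i) (f i₀) ≤ δ i i₀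
  bound i with f i ≟ f i₀
  ... | no _ = z≤n
  ... | yes e rewrite inj i i₀ e = ≤-reflexive (sym (δ-refl i₀))

Σ-fibres : ∀ {n k} (p : Fin n → Fin k) (f : Fin k → ℕ) → Σᵛ (λ x → f (p x)) ≡ Σᵛ (λ a → partSize p a * f a)
Σ-fibres p f =
  trans (Σ-cong (λ x → trans (sym (Σ-δ f (p x))) (Σ-cong (λ a → cong (_* f a) (δ-sym a (p x))))))
    (trans (Σ-swap (λ x a → δ (p x) a * f a)) (Σ-cong (λ a → Σ-*ʳ (f a) (λ x → δ (p x) a))))

Σ-partSize : ∀ {n k} (p : Fin n → Fin k) → Σᵛ (partSize p) ≡ n
Σ-partSize {n} {k} p =
  trans (Σ-cong (λ a → sym (*-identityʳ (partSize p a))))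
    (trans (sym (Σ-fibres p (λ _ → 1))) (trans (Σ-const {n} 1) (*-identityʳ n)))

-- Convex objectives of polynomial growth

-- `g` and `h` are the first and second differences of the objective. Polynomial growth enters as
-- `scaling`: arguments within a constant factor give values within a constant factor.
record Growth : Set where
  field
    φ g h : ℕ → ℕ
    φ-suc : ∀ x → φ (suc x) ≡ φ x + g x
    g-suc : ∀ x → g (suc x) ≡ g x + h x
    h-suc : ∀ x → h x ≤ h (suc x)
    φ-zero : φ 0 ≡ 0
    scaling : ∀ K → ∃[ L ] ∃[ n₁ ] (∀ n m → n₁ ≤ n → n ≤ K * m → φ n ≤ L * φ m)
    positive : ∃[ n₁ ] (∀ n → n₁ ≤ n → 1 ≤ φ n)

suc-mono⇒mono : (f : ℕ → ℕ) → (∀ x → f x ≤ f (suc x)) → ∀ {a b} → a ≤ b → f a ≤ f b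
suc-mono⇒mono f s {a} {b} p = subst (λ z → f a ≤ f z) (m+[n∸m]≡n p) (go (b ∸ a))
  where
  go : ∀ w → f a ≤ f (a + w)
  go zero = ≤-reflexive (cong f (sym (+-identityʳ a)))
  go (suc w) = ≤-trans (go w) (≤-trans (s (a + w)) (≤-reflexive (cong f (sym (+-suc a w)))))

-- Discrete tangent bounds for a convex function, used for `φ` with slope `g` and again for `g` with
-- slope `h`.
module Increments (f d : ℕ → ℕ) (f-suc : ∀ x → f (suc x) ≡ f x + d x) (d-mono : ∀ {a b} → a ≤ b → d a ≤ d b) where

  mono : ∀ {a b} → a ≤ b → f a ≤ f b
  mono = suc-mono⇒mono f (λ x → ≤-trans (m≤m+n _ _) (≤-reflexive (sym (f-suc x))))

  gain : ∀ a w → f a + w * d a ≤ f (a + w)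
  gain a zero = ≤-reflexive (trans (+-identityʳ (f a)) (cong f (sym (+-identityʳ a))))
  gain a (suc w) = begin
    f a + (d a + w * d a) ≡⟨ eq (f a) (d a) (w * d a) ⟩
    f a + w * d a + d a ≤⟨ gain a w +≤ d-mono (m≤m+n a w) ⟩
    f (a + w) + d (a + w) ≡⟨ f-suc (a + w) ⟨
    f (suc (a + w)) ≡⟨ cong f (+-suc a w) ⟨
    f (a + suc w) ∎
    where
    open ≤-Reasoning
    eq : ∀ x y z → x + (y + z) ≡ x + z + y
    eq x y z = solve (x ∷ y ∷ z ∷ [])

  loss : ∀ a w → f (a + w) ≤ f a + w * d (a + w)
  loss a zero = ≤-reflexive (trans (cong f (+-identityʳ a)) (sym (+-identityʳ (f a))))
  loss a (suc w) = begin
    f (a + suc w) ≡⟨ cong f (+-suc a w) ⟩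
    f (suc (a + w)) ≡⟨ f-suc (a + w) ⟩
    f (a + w) + d (a + w) ≤⟨ loss a w +≤ ≤-refl ⟩
    f a + w * d (a + w) + d (a + w) ≡⟨ eq (f a) w (d (a + w)) ⟩
    f a + suc w * d (a + w) ≤⟨ ≤-refl {f a} +≤ suc w ·≤ d-mono (+-monoʳ-≤ a (n≤1+n w)) ⟩
    f a + suc w * d (a + suc w) ∎
    where
    open ≤-Reasoning
    eq : ∀ x w y → x + w * y + y ≡ x + suc w * y
    eq x w y = solve (x ∷ w ∷ y ∷ [])

module GrowthFacts (Gr : Growth) where
  open Growth Gr public

  h-mono : ∀ {a b} → a ≤ b → h a ≤ h b
  h-mono = suc-mono⇒mono h h-suc

  module G′ = Increments g h g-suc h-mono
  g-mono : ∀ {a b} → a ≤ b → g a ≤ g b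
  g-mono = G′.mono

  open Increments φ g φ-suc g-mono public renaming (mono to φ-mono; gain to φ-gain; loss to φ-loss)

  φ-super : ∀ a b → φ a + φ b ≤ φ (a + b)
  φ-super zero b = ≤-reflexive (cong (_+ φ b) φ-zero)
  φ-super (suc a) b = begin
    φ (suc a) + φ b ≡⟨ cong (_+ φ b) (φ-suc a) ⟩
    φ a + g a + φ b ≡⟨ eq (φ a) (g a) (φ b) ⟩
    φ a + φ b + g a ≤⟨ φ-super a b +≤ g-mono (m≤m+n a b) ⟩
    φ (a + b) + g (a + b) ≡⟨ φ-suc (a + b) ⟨
    φ (suc (a + b)) ∎
    where
    open ≤-Reasoning
    eq : ∀ x y z → x + y + z ≡ x + z + y
    eq x y z = solve (x ∷ y ∷ z ∷ [])

  n*g≤φ2n : ∀ n → n * g n ≤ φ (n + n)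
  n*g≤φ2n n = ≤-trans (m≤n+m _ (φ n)) (φ-gain n n)

  φ≤n*g : ∀ n → φ n ≤ n * g n
  φ≤n*g n = ≤-trans (φ-loss 0 n) (≤-reflexive (cong (_+ n * g n) φ-zero))

  g-positive : ∃[ n₁ ] (∀ n → n₁ ≤ n → 1 ≤ g n)
  g-positive = proj₁ positive , λ n q → pos n (g n) (≤-trans (proj₂ positive n q) (φ≤n*g n))
    where
    pos : ∀ n y → 1 ≤ n * y → 1 ≤ y
    pos n zero q rewrite *-zeroʳ n = q
    pos n (suc y) q = s≤s z≤n

  n*g-scaling : ∀ K → ∃[ L ] ∃[ n₁ ] (∀ n m → n₁ ≤ n → n ≤ K * m → n * g n ≤ L * φ m)
  n*g-scaling K = L , n₁ , λ n m p q → ≤-trans (n*g≤φ2n n)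
    (sc (n + n) m (≤-trans p (m≤m+n n n)) (lin 0 (2 ·≤ q) (solve (n ∷ m ∷ K ∷ []))))
    where
    L = proj₁ (scaling (2 * K))
    n₁ = proj₁ (proj₂ (scaling (2 * K)))
    sc = proj₂ (proj₂ (scaling (2 * K)))

  -- The slope inherits scaling because `n * g n` lies between `φ n` and `φ (n + n)`; for n ≤ m
  -- monotonicity is enough.
  g-scaling : ∀ K → ∃[ L ] ∃[ n₁ ] (∀ n m → n₁ ≤ n → n ≤ K * m → g n ≤ L * g m)
  g-scaling K with n*g-scaling K
  ... | L , n₁ , sc = suc L , suc n₁ , bound
    where
    bound : ∀ n m → suc n₁ ≤ n → n ≤ K * m → g n ≤ suc L * g m
    bound n m p q with ≤-total n m
    ... | inj₁ n≤m = ≤-trans (g-mono n≤m) (m≤m+n _ _)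
    bound (suc n′) m p q | inj₂ m≤n = ≤-trans (*-cancelˡ-≤ {g (suc n′)} {L * g m} (suc n′) main) (m≤n+m _ (g m))
      where
      eq : ∀ a b c → a * (b * c) ≡ b * (a * c)
      eq a b c = solve (a ∷ b ∷ c ∷ [])
      main : suc n′ * g (suc n′) ≤ suc n′ * (L * g m)
      main = begin
        suc n′ * g (suc n′) ≤⟨ sc (suc n′) m (≤-trans (n≤1+n n₁) p) q ⟩
        L * φ m ≤⟨ L ·≤ φ≤n*g m ⟩
        L * (m * g m) ≤⟨ L ·≤ *-monoˡ-≤ (g m) m≤n ⟩
        L * (suc n′ * g m) ≡⟨ eq L (suc n′) (g m) ⟩
        suc n′ * (L * g m) ∎
        where open ≤-Reasoning

  -- As `h` is nondecreasing, `n * h n ≤ g (n + n)`, and scaling compares this with `g` at any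
  -- argument linear in n. Hence curvature is smaller than slope by a factor of order n, which
  -- absorbs every constant.
  curvature-negligible : ∀ Γ c K → ∃[ n₀ ] (∀ n D → n₀ ≤ n → n ≤ Γ * D →
    1 ≤ g (D ∸ c) × K * (2 * c * h (n + c)) < g (D ∸ c))
  curvature-negligible Γ c K with g-scaling (8 * Γ) | g-positive
  ... | L , n₁ , sc | n₂ , pos = n₁ + (suc (2 * Γ * n₂) + (suc (K * (2 * c) * L) + (c + 2 * Γ * c))) , bound
    where
    bound : ∀ n D → n₁ + (suc (2 * Γ * n₂) + (suc (K * (2 * c) * L) + (c + 2 * Γ * c))) ≤ n → n ≤ Γ * D →
            1 ≤ g (D ∸ c) × K * (2 * c * h (n + c)) < g (D ∸ c)
    bound n D p q = gm , *-cancelˡ-< n _ _ main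
      where
      m = D ∸ c
      s₁ = +-≤-split n₁ p
      s₂ = +-≤-split (suc (2 * Γ * n₂)) (proj₂ s₁)
      s₃ = +-≤-split (suc (K * (2 * c) * L)) (proj₂ s₂)
      s₄ = +-≤-split c (proj₂ s₃)
      n≤2Γm : n ≤ 2 * Γ * m
      n≤2Γm = half n (2 * Γ * m) (Γ * D) (Γ * (c + m)) (2 * Γ * c) q (Γ ·≤ m≤n+m∸n D c)
        (proj₂ s₄) (eq Γ c m)
        where
        eq : ∀ Γ c m → 2 * (Γ * (c + m)) ≡ 2 * Γ * m + 2 * Γ * c
        eq Γ c m = solve (Γ ∷ c ∷ m ∷ [])
        half : ∀ n A X Y B → n ≤ X → X ≤ Y → B ≤ n → 2 * Y ≡ A + B → n ≤ A
        half n A X Y B a b c e = +-cancelʳ-≤ n n A (≤-trans doubled (≤-trans (≤-reflexive e) (≤-refl {A} +≤ c)))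
          where
          doubled : n + n ≤ 2 * Y
          doubled = lin 0 (2 ·≤ a +≤ 2 ·≤ b) (solve (n ∷ X ∷ Y ∷ []))
      n₂≤m : n₂ ≤ m
      n₂≤m with n₂ ≤? m
      ... | yes r = r
      ... | no ¬r = ⊥-elim (n≮n n (≤-trans (s≤s n≤2Γm) (≤-trans (s≤s (2 * Γ ·≤ <⇒≤ (≰⇒> ¬r))) (proj₁ s₂))))
      gm : 1 ≤ g m
      gm = pos m n₂≤m
      hbound : n * h (n + c) ≤ L * g m
      hbound = begin
        n * h (n + c) ≤⟨ n ·≤ h-mono (+-monoʳ-≤ n (proj₁ s₄)) ⟩
        n * h (n + n) ≤⟨ *-monoˡ-≤ (h (n + n)) (m≤m+n n n) ⟩
        (n + n) * h (n + n) ≤⟨ ≤-trans (m≤n+m _ (g (n + n))) (G′.gain (n + n) (n + n)) ⟩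
        g (n + n + (n + n)) ≡⟨ cong g (eq n) ⟩
        g (4 * n) ≤⟨ sc (4 * n) m (≤-trans (proj₁ s₁) (m≤m+n n _)) (quadruple Γ m n≤2Γm) ⟩
        L * g m ∎
        where
        open ≤-Reasoning
        quadruple : ∀ {n} Γ m → n ≤ 2 * Γ * m → 4 * n ≤ 8 * Γ * m
        quadruple {n} Γ m q = lin 0 (4 ·≤ q) (solve (n ∷ Γ ∷ m ∷ []))
        eq : ∀ n → n + n + (n + n) ≡ 4 * n
        eq n = solve (n ∷ [])
      main : n * (K * (2 * c * h (n + c))) < n * g m
      main = begin-strict
        n * (K * (2 * c * h (n + c))) ≡⟨ eq n K c (h (n + c)) ⟩
        K * (2 * c) * (n * h (n + c)) ≤⟨ K * (2 * c) ·≤ hbound ⟩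
        K * (2 * c) * (L * g m) ≡⟨ *-assoc (K * (2 * c)) L (g m) ⟨
        K * (2 * c) * L * g m <⟨ *-monoˡ-< (g m) {{>-nonZero gm}} (proj₁ s₃) ⟩
        n * g m ∎
        where
        open ≤-Reasoning
        eq : ∀ n K c h → n * (K * (2 * c * h)) ≡ K * (2 * c) * (n * h)
        eq n K c h = solve (n ∷ K ∷ c ∷ h ∷ [])

-- The part of `Growth` that survives multiplication by x. It already holds for x ^ 0, where the
-- recursion starts and where `φ-zero` fails.
record Convex (φ : ℕ → ℕ) : Set where
  field
    g h : ℕ → ℕ
    φ-suc : ∀ x → φ (suc x) ≡ φ x + g x
    g-suc : ∀ x → g (suc x) ≡ g x + h x
    h-suc : ∀ x → h x ≤ h (suc x)

power-convex : ∀ r → Convex (_^ r)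
power-convex zero = record
  { g = λ _ → 0 ; h = λ _ → 0 ; φ-suc = λ _ → refl ; g-suc = λ _ → refl ; h-suc = λ _ → z≤n }
power-convex (suc r) = record
  -- The discrete product rule for multiplication by x, applied once for `g` and twice for `h`.
  { g = λ x → x ^ r + suc x * g x
  ; h = λ x → 2 * g x + (2 + x) * h x
  ; φ-suc = λ x → trans (cong (suc x *_) (φ-suc x)) (eq₁ x (x ^ r) (g x))
  ; g-suc = λ x → trans (cong₂ (λ a b → a + (2 + x) * b) (φ-suc x) (g-suc x)) (eq₂ x (x ^ r) (g x) (h x))
  ; h-suc = λ x → (2 ·≤ ≤-trans (m≤m+n (g x) (h x)) (≤-reflexive (sym (g-suc x)))) +≤ *-mono-≤ (n≤1+n (2 + x)) (h-suc x)
  }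
  where
  open Convex (power-convex r)
  eq₁ : ∀ x f g → suc x * (f + g) ≡ x * f + (f + suc x * g)
  eq₁ x f g = solve (x ∷ f ∷ g ∷ [])
  eq₂ : ∀ x f g h → f + g + (2 + x) * (g + h) ≡ f + suc x * g + (2 * g + (2 + x) * h)
  eq₂ x f g h = solve (x ∷ f ∷ g ∷ h ∷ [])

power-growth : ∀ r → 1 ≤ r → Growth
power-growth (suc r) _ = record
  { φ = _^ suc r ; g = g ; h = h ; φ-suc = φ-suc ; g-suc = g-suc ; h-suc = h-suc
  ; φ-zero = refl
  ; scaling = λ K → K ^ suc r , 0 , λ n m _ q → ≤-trans (^-monoˡ-≤ (suc r) q) (≤-reflexive (^-distrib-* (suc r) K m))
  ; positive = 1 , λ { (suc n) _ → m^n>0 (suc n) (suc r) }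
  }
  where
  open Convex (power-convex (suc r))
  ^-distrib-* : ∀ r a b → (a * b) ^ r ≡ a ^ r * b ^ r
  ^-distrib-* zero a b = refl
  ^-distrib-* (suc r) a b rewrite ^-distrib-* r a b = eq a b (a ^ r) (b ^ r)
    where
    eq : ∀ a b x y → a * b * (x * y) ≡ a * x * (b * y)
    eq a b x y = solve (a ∷ b ∷ x ∷ y ∷ [])

nC0≡1 : ∀ n → n C 0 ≡ 1
nC0≡1 zero = refl
nC0≡1 (suc n) = refl

C-mono : ∀ x r → x C r ≤ suc x C r
C-mono x zero = ≤-reflexive (trans (nC0≡1 x) (sym (nC0≡1 (suc x))))
C-mono x (suc r) = ≤-trans (m≤n+m _ (x C r)) (≤-reflexive (nCk+nC[k+1]≡[n+1]C[k+1] x r))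

-- Truncated subtraction is harmless because the binomial on the right vanishes for x < r. The
-- identity lets `C-scaling` proceed by one linear factor at a time.
absorption : ∀ x r → suc r * (x C suc r) ≡ (x ∸ r) * (x C r)
absorption zero r = trans (*-zeroʳ (suc r)) (sym (cong (_* (0 C r)) (0∸n≡0 r)))
absorption (suc x) r = trans (cong (suc r *_) (sym (nCk+nC[k+1]≡[n+1]C[k+1] x r)))
  (trans (*-distribˡ-+ (suc r) (x C r) (x C suc r)) (trans (cong (suc r * (x C r) +_) (absorption x r)) (step r)))
  where
  step : ∀ r → suc r * (x C r) + (x ∸ r) * (x C r) ≡ (suc x ∸ r) * (suc x C r)
  step zero rewrite nC0≡1 x | nC0≡1 (suc x) = refl
  step (suc s) = begin
    suc (suc s) * c + (x ∸ suc s) * c ≡⟨ shift ⟩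
    suc s * c + (x ∸ s) * c ≡⟨ cong (_+ (x ∸ s) * c) (absorption x s) ⟩
    (x ∸ s) * (x C s) + (x ∸ s) * c ≡⟨ *-distribˡ-+ (x ∸ s) (x C s) c ⟨
    (x ∸ s) * ((x C s) + c) ≡⟨ cong ((x ∸ s) *_) (nCk+nC[k+1]≡[n+1]C[k+1] x s) ⟩
    (x ∸ s) * (suc x C suc s) ∎
    where
    open ≡-Reasoning
    c = x C suc s
    eq : ∀ s c d → suc (suc s) * c + d * c ≡ suc s * c + suc d * c
    eq s c d = solve (s ∷ c ∷ d ∷ [])
    shift : suc (suc s) * c + (x ∸ suc s) * c ≡ suc s * c + (x ∸ s) * c
    shift with suc s ≤? x
    ... | yes s<x = trans (eq s c (x ∸ suc s)) (cong (λ z → suc s * c + z * c) (sym (+-∸-assoc 1 s<x)))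
    ... | no s≮x rewrite k>n⇒nCk≡0 (≰⇒> s≮x) =
      trans (cong₂ _+_ (*-zeroʳ s) (*-zeroʳ (x ∸ suc s))) (sym (cong₂ _+_ (*-zeroʳ s) (*-zeroʳ (x ∸ s))))

C-scaling : ∀ r K → ∃[ L ] ∃[ n₁ ] (∀ n m → n₁ ≤ n → n ≤ K * m → n C r ≤ L * (m C r))
C-scaling zero K = 1 , 0 , λ n m _ _ →
  ≤-reflexive (trans (nC0≡1 n) (sym (trans (+-identityʳ (m C 0)) (nC0≡1 m))))
C-scaling (suc r) K with C-scaling r K
... | L , n₁ , sc = 2 * K * L , 2 * K * r + n₁ , bound
  where
  bound : ∀ n m → 2 * K * r + n₁ ≤ n → n ≤ K * m → n C suc r ≤ 2 * K * L * (m C suc r)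
  bound n m p q = *-cancelˡ-≤ (suc r) (begin
    suc r * (n C suc r) ≡⟨ absorption n r ⟩
    (n ∸ r) * (n C r) ≤⟨ *-mono-≤ (≤-trans (m∸n≤m n r) n≤) (sc n m (m+n≤o⇒n≤o (2 * K * r) p) q) ⟩
    2 * K * (m ∸ r) * (L * (m C r)) ≡⟨ eq K (m ∸ r) L (m C r) ⟩
    2 * K * L * ((m ∸ r) * (m C r)) ≡⟨ cong (2 * K * L *_) (absorption m r) ⟨
    2 * K * L * (suc r * (m C suc r)) ≡⟨ eq′ (2 * K * L) (suc r) (m C suc r) ⟩
    suc r * (2 * K * L * (m C suc r)) ∎)
    where
    open ≤-Reasoning
    eq : ∀ K d L c → 2 * K * d * (L * c) ≡ 2 * K * L * (d * c)
    eq K d L c = solve (K ∷ d ∷ L ∷ c ∷ [])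
    eq′ : ∀ a b c → a * (b * c) ≡ b * (a * c)
    eq′ a b c = solve (a ∷ b ∷ c ∷ [])
    arith : ∀ K d r n m → n ≤ K * m → K * m ≤ K * (r + d) → 2 * K * r ≤ n → n ≤ 2 * K * d
    arith K d r n m a b c = lin 0 (2 ·≤ a +≤ 2 ·≤ b +≤ c) (solve (K ∷ d ∷ r ∷ n ∷ m ∷ []))
    n≤ : n ≤ 2 * K * (m ∸ r)
    n≤ = arith K (m ∸ r) r n m q (K ·≤ m≤n+m∸n m r) (m+n≤o⇒m≤o (2 * K * r) p)

C-positive : ∀ r n → r ≤ n → 1 ≤ n C r
C-positive r n r≤n = ≤-trans (≤-reflexive (sym (nCn≡1 r))) (suc-mono⇒mono (_C r) (λ x → C-mono x r) r≤n)

-- By Pascal's rule the differences of a binomial are the lower binomials; the index starts at 2 so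
-- that two of them exist.
binomial-growth : ℕ → Growth
binomial-growth r = record
  { φ = _C suc (suc r) ; g = _C suc r ; h = _C r
  ; φ-suc = λ x → trans (sym (nCk+nC[k+1]≡[n+1]C[k+1] x (suc r))) (+-comm (x C suc r) _)
  ; g-suc = λ x → trans (sym (nCk+nC[k+1]≡[n+1]C[k+1] x r)) (+-comm (x C r) _)
  ; h-suc = λ x → C-mono x r
  ; φ-zero = refl
  ; scaling = C-scaling (suc (suc r))
  ; positive = suc (suc r) , C-positive (suc (suc r))
  }

-- Density quantifiers and complete multipartite blocks

opaque
  -- A density quantifier, to be read as "for at least n / c vertices". Iterating it replaces the
  -- counting of tuples, so that statements about tuples are proved one coordinate at a time.
  many : ∀ {n} → ℕ → VSet n → Bool
  many {n} c P = ⌊ n ≤? c * # P ⌋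

  many⁺ : ∀ {n} c {P : VSet n} → n ≤ c * # P → many c P ≡ true
  many⁺ c = yes⇒ (_ ≤? c * _)

  many⁻ : ∀ {n} c {P : VSet n} → many c P ≡ true → n ≤ c * # P
  many⁻ c e = (_ ≤? c * _) of e

many-mono : ∀ {n c c′} {P Q : VSet n} → c ≤ c′ → (∀ i → P i ≡ true → Q i ≡ true) →
            many c P ≡ true → many c′ Q ≡ true
many-mono {c = c} {c′} {P} {Q} c≤c′ h e = many⁺ c′ {Q} (≤-trans (many⁻ c {P} e) (*-mono-≤ c≤c′ (#-mono {P = P} {Q} h)))

many* : ∀ {n} → ℕ → (l : ℕ) → (Vec (Fin n) l → Bool) → Bool
many* c zero W = W ⟨⟩
many* c (suc l) W = many c (λ x → many* c l (λ xs → W (x ◂ xs)))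

many*-mono : ∀ {n c c′} l {P Q : Vec (Fin n) l → Bool} → c ≤ c′ → (∀ xs → P xs ≡ true → Q xs ≡ true) →
             many* c l P ≡ true → many* c′ l Q ≡ true
many*-mono zero c≤c′ h = h ⟨⟩
many*-mono (suc l) c≤c′ h = many-mono c≤c′ (λ x → many*-mono l c≤c′ (λ xs → h (x ◂ xs)))

-- There are at least n² / c² pairs, and columns with fewer than n / (2c²) of them hold at most
-- half: this gives `2 * (c * c)`. The summand c makes it evident that the constant does not
-- decrease.
swapᶜ : ℕ → ℕ
swapᶜ c = c + 2 * (c * c)

-- Both sides count the pairs satisfying W.
many-swap : ∀ {n} c (W : Fin n → Fin n → Bool) → many c (λ x → many c (W x)) ≡ true →
            many (swapᶜ c) (λ y → many (swapᶜ c) (λ x → W x y)) ≡ true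
many-swap {zero} c W e = many⁺ (swapᶜ c) {λ y → many (swapᶜ c) (λ x → W x y)} z≤n
many-swap {n@(suc _)} c W e =
  many-mono {c = κ} (m≤n+m κ c) (λ y → many-mono {c = κ} (m≤n+m κ c) (λ _ → id)) (many⁺ κ (*-cancelˡ-≤ n main))
  where
  κ = 2 * (c * c)
  pairs = Σᵛ (λ x → # (W x))
  dense : Fin n → Bool
  dense y = many κ (λ x → W x y)
  row : ∀ x → ind (many c (W x)) * n ≤ c * # (W x)
  row x with bool-case (many c (W x))
  ... | inj₁ t rewrite t = ≤-trans (≤-reflexive (+-identityʳ n)) (many⁻ c t)
  ... | inj₂ f rewrite f = z≤n
  lower : n * n ≤ c * c * pairs
  lower = begin
    n * n ≤⟨ *-monoˡ-≤ n (many⁻ c e) ⟩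
    c * # (λ x → many c (W x)) * n ≡⟨ *-assoc c _ n ⟩
    c * (# (λ x → many c (W x)) * n) ≡⟨ cong (c *_) (Σ-*ʳ n (λ x → ind (many c (W x)))) ⟨
    c * Σᵛ (λ x → ind (many c (W x)) * n) ≤⟨ c ·≤ Σ-mono row ⟩
    c * Σᵛ (λ x → c * # (W x)) ≡⟨ cong (c *_) (Σ-* c (λ x → # (W x))) ⟩
    c * (c * pairs) ≡⟨ *-assoc c c pairs ⟨
    c * c * pairs ∎
    where open ≤-Reasoning
  column : ∀ y → κ * # (λ x → W x y) ≤ ind (dense y) * (κ * n) + n
  column y with n ≤? κ * # (λ x → W x y)
  ... | yes d rewrite many⁺ κ d =
    ≤-trans (κ ·≤ #-≤ (λ x → W x y)) (≤-trans (≤-reflexive (sym (+-identityʳ (κ * n)))) (m≤m+n _ n))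
  ... | no ¬d = ≤-trans (<⇒≤ (≰⇒> ¬d)) (m≤n+m n _)
  upper : κ * pairs ≤ # dense * (κ * n) + n * n
  upper = begin
    κ * pairs ≡⟨ cong (κ *_) (Σ-swap (λ x y → ind (W x y))) ⟩
    κ * Σᵛ (λ y → # (λ x → W x y)) ≡⟨ Σ-* κ (λ y → # (λ x → W x y)) ⟨
    Σᵛ (λ y → κ * # (λ x → W x y)) ≤⟨ Σ-mono column ⟩
    Σᵛ (λ y → ind (dense y) * (κ * n) + n) ≡⟨ Σ-+ (λ y → ind (dense y) * (κ * n)) (λ _ → n) ⟩
    Σᵛ (λ y → ind (dense y) * (κ * n)) + Σᵛ {n} (λ _ → n) ≡⟨ cong₂ _+_ (Σ-*ʳ (κ * n) (λ y → ind (dense y))) (Σ-const {n} n) ⟩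
    # dense * (κ * n) + n * n ∎
    where open ≤-Reasoning
  combine : ∀ n c p d → n * n ≤ c * c * p → 2 * (c * c) * p ≤ d * (2 * (c * c) * n) + n * n →
            n * n ≤ n * (2 * (c * c) * d)
  combine n c p d a b = lin 0 (2 ·≤ a +≤ b) (solve (n ∷ c ∷ p ∷ d ∷ []))
  main : n * n ≤ n * (κ * # dense)
  main = combine n c pairs (# dense) lower upper

commᶜ : ℕ → ℕ → ℕ
commᶜ zero c = c
commᶜ (suc l) c = commᶜ l (swapᶜ c)

c≤commᶜ : ∀ l c → c ≤ commᶜ l c
c≤commᶜ zero c = ≤-refl
c≤commᶜ (suc l) c = ≤-trans (m≤m+n c _) (c≤commᶜ l (swapᶜ c))

many-comm : ∀ {n} c l (W : Fin n → Vec (Fin n) l → Bool) → many c (λ x → many* c l (W x)) ≡ true →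
            many* (commᶜ l c) l (λ ys → many (commᶜ l c) (λ x → W x ys)) ≡ true
many-comm c zero W e = e
many-comm c (suc l) W e =
  many-mono (c≤commᶜ l (swapᶜ c))
    (λ y t → many-comm (swapᶜ c) l (λ x ys → W x (y ◂ ys))
      (many-mono {c = swapᶜ c} ≤-refl (λ x → many*-mono l (m≤m+n c (2 * (c * c))) (λ _ → id)) t))
    (many-swap c (λ x y → many* c l (λ ys → W x (y ◂ ys))) e)

many-comm⁻ : ∀ {n} c l (W : Fin n → Vec (Fin n) l → Bool) → many* c l (λ ys → many c (λ x → W x ys)) ≡ true →
             many (commᶜ l c) (λ x → many* (commᶜ l c) l (W x)) ≡ true
many-comm⁻ c zero W e = e
many-comm⁻ c (suc l) W e =
  many-mono (≤-reflexive (sym (comm-swap l c)))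
    (λ x → many-mono (≤-reflexive (sym (comm-swap l c)))
      (λ y → many*-mono l (≤-trans (m≤m+n (commᶜ l c) _) (≤-reflexive (sym (comm-swap l c)))) (λ _ → id)))
    (many-swap (commᶜ l c) (λ y x → many* (commᶜ l c) l (λ ys → W x (y ◂ ys)))
      (many-mono (c≤commᶜ l c) (λ y t → many-comm⁻ c l (λ x ys → W x (y ◂ ys)) t) e))
  where
  comm-swap : ∀ l c → commᶜ l (swapᶜ c) ≡ swapᶜ (commᶜ l c)
  comm-swap zero c = refl
  comm-swap (suc l) c = comm-swap l (swapᶜ c)

many-∨ : ∀ {n} c (P Q : VSet n) → many c (λ x → P x ∨ Q x) ≡ true →
         many (2 * c) P ≡ true ⊎ many (2 * c) Q ≡ true
many-∨ {n} c P Q e with n ≤? 2 * c * # P | n ≤? 2 * c * # Q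
... | yes p | _ = inj₁ (many⁺ (2 * c) p)
... | no _ | yes q = inj₂ (many⁺ (2 * c) q)
... | no ¬p | no ¬q = ⊥-elim (n≮n (n + n) (absurd n c (# (λ x → P x ∨ Q x)) (# P) (# Q) (many⁻ c e) (#-∨ P Q) (≰⇒> ¬p) (≰⇒> ¬q)))
  where
  absurd : ∀ n c o p q → n ≤ c * o → o ≤ p + q → 2 * c * p < n → 2 * c * q < n → n + n < n + n
  absurd n c o p q a b d e = lin 1 (2 ·≤ a +≤ (2 * c) ·≤ b +≤ d +≤ e) (solve (n ∷ c ∷ o ∷ p ∷ q ∷ []))

orᶜ : ℕ → ℕ → ℕ
orᶜ zero c = c
orᶜ (suc l) c = 2 * orᶜ l c

c≤orᶜ : ∀ l c → c ≤ orᶜ l c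
c≤orᶜ zero c = ≤-refl
c≤orᶜ (suc l) c = ≤-trans (c≤orᶜ l c) (m≤m+n _ _)

many*-∨ : ∀ {n} c l (P Q : Vec (Fin n) l → Bool) → many* c l (λ x → P x ∨ Q x) ≡ true →
          many* (orᶜ l c) l P ≡ true ⊎ many* (orᶜ l c) l Q ≡ true
many*-∨ c zero P Q e = ∨-split e
many*-∨ {n} c (suc l) P Q e with many-∨ (orᶜ l c) (part P) (part Q) (many-mono (c≤orᶜ l c) step e)
  where
  part : (Vec (Fin n) (suc l) → Bool) → VSet n
  part R x = many* (orᶜ l c) l (λ xs → R (x ◂ xs))
  step : ∀ x → many* c l (λ xs → P (x ◂ xs) ∨ Q (x ◂ xs)) ≡ true → part P x ∨ part Q x ≡ true
  step x t with many*-∨ c l (λ xs → P (x ◂ xs)) (λ xs → Q (x ◂ xs)) t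
  ... | inj₁ a rewrite a = refl
  ... | inj₂ b rewrite b with part P x
  ... | true = refl
  ... | false = refl
... | inj₁ a = inj₁ (many-mono ≤-refl (λ x → many*-mono l (m≤m+n (orᶜ l c) _) (λ _ → id)) a)
... | inj₂ b = inj₂ (many-mono ≤-refl (λ x → many*-mono l (m≤m+n (orᶜ l c) _) (λ _ → id)) b)

Blocks : ℕ → ℕ → ℕ → Set
Blocks n t k = Vec (Vec (Fin n) t) k

-- Blocks are quantified from the last to the first, unlike the coordinates in `many*`: in `blowup`
-- the first coordinate is the one moved behind the others.
manyB : ∀ {n t} → ℕ → (k : ℕ) → (Blocks n t k → Bool) → Bool
manyB c zero Q = Q ⟨⟩
manyB {t = t} c (suc k) Q = manyB c k (λ zs → many* c t (λ xs → Q (xs ◂ zs)))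

manyB-mono : ∀ {n t c c′} k {P Q : Blocks n t k → Bool} → c ≤ c′ → (∀ zs → P zs ≡ true → Q zs ≡ true) →
             manyB c k P ≡ true → manyB c′ k Q ≡ true
manyB-mono zero c≤c′ h = h ⟨⟩
manyB-mono {t = t} (suc k) c≤c′ h = manyB-mono k c≤c′ (λ zs → many*-mono t c≤c′ (λ xs → h (xs ◂ zs)))

commBᶜ : ℕ → ℕ → ℕ → ℕ
commBᶜ t zero c = c
commBᶜ t (suc k) c = commᶜ t (commBᶜ t k c)

c≤commBᶜ : ∀ t k c → c ≤ commBᶜ t k c
c≤commBᶜ t zero c = ≤-refl
c≤commBᶜ t (suc k) c = ≤-trans (c≤commBᶜ t k c) (c≤commᶜ t _)

manyB-comm : ∀ {n t} c k (W : Fin n → Blocks n t k → Bool) → many c (λ x → manyB c k (W x)) ≡ true →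
             manyB (commBᶜ t k c) k (λ zs → many (commBᶜ t k c) (λ x → W x zs)) ≡ true
manyB-comm c zero W e = e
manyB-comm {t = t} c (suc k) W e =
  manyB-mono k (c≤commᶜ t c′)
    (λ zs u → many-comm c′ t (λ x xs → W x (xs ◂ zs)) (many-mono ≤-refl (λ x → many*-mono t (c≤commBᶜ t k c) (λ _ → id)) u))
    (manyB-comm c k (λ x zs → many* c t (λ xs → W x (xs ◂ zs))) e)
  where c′ = commBᶜ t k c

allV : ∀ {n t} → VSet n → Vec (Fin n) t → Bool
allV P ⟨⟩ = true
allV P (x ◂ xs) = P x ∧ allV P xs

allT : ∀ {n t k} → (Vec (Fin n) k → Bool) → Blocks n t k → Bool
allT W ⟨⟩ = W ⟨⟩
allT W (xs ◂ zs) = allV (λ x → allT (λ ys → W (x ◂ ys)) zs) xs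

many-allV : ∀ {n} c t {P : VSet n} → many c P ≡ true → many* c t (allV P) ≡ true
many-allV c zero e = refl
many-allV c (suc t) {P} e = many-mono ≤-refl (λ x Px → many*-mono t ≤-refl (λ xs a → ∧-intro Px a) (many-allV c t e)) e

blowupᶜ : ℕ → ℕ → ℕ → ℕ
blowupᶜ t zero c = c
blowupᶜ t (suc k) c = commBᶜ t k (blowupᶜ t k c)

c≤blowupᶜ : ∀ t k c → c ≤ blowupᶜ t k c
c≤blowupᶜ t zero c = ≤-refl
c≤blowupᶜ t (suc k) c = ≤-trans (c≤blowupᶜ t k c) (c≤commBᶜ t k _)

-- Erdős' theorem on complete k-partite k-graphs: the first coordinate is moved behind the
-- blocks chosen for the others, where it can be duplicated.
blowup : ∀ {n} t c k (W : Vec (Fin n) k → Bool) → many* c k W ≡ true → manyB {t = t} (blowupᶜ t k c) k (allT W) ≡ true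
blowup t c zero W e = e
blowup t c (suc k) W e =
  manyB-mono k ≤-refl (λ zs → many-allV _ t)
    (manyB-comm c′ k (λ x → allT (λ ys → W (x ◂ ys)))
      (many-mono (c≤blowupᶜ t k c) (λ x → blowup t c k (λ ys → W (x ◂ ys))) e))
  where c′ = blowupᶜ t k c

-- The forbidden set `L` grows by the vertices already picked; at every step n / c candidates
-- outnumber its final size.
many*-distinct : ∀ {n} c t (L : VSet n) (Q : Vec (Fin n) t → Bool) → c * (# L + t) < n → many* c t Q ≡ true →
  ∃[ xs ] (Q xs ≡ true × (∀ a → L (lookup xs a) ≡ false) × (∀ a b → lookup xs a ≡ lookup xs b → a ≡ b))
many*-distinct c zero L Q lt e = ⟨⟩ , e , (λ ()) , λ ()
many*-distinct {n} c (suc t) L Q lt e =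
  let x , x< = Σ-<-witness (ind ∘ L) (ind ∘ rest) (*-cancelˡ-< c _ _ (≤-trans (s≤s (c ·≤ m≤m+n (# L) (suc t))) (≤-trans lt (many⁻ c {rest} e))))
      ¬Lx , rx = new (L x) (rest x) x<
      xs , q , avoid , inj = many*-distinct c t (L′ x) (λ xs → Q (x ◂ xs)) (≤-trans (s≤s (c ·≤ grow x)) lt) rx
  in x ◂ xs , q
   , (λ { zero → ¬Lx ; (suc a) → proj₁ (∨-false {L _} (avoid a)) })
   , (λ { zero zero _ → refl
        ; zero (suc b) eq → ⊥-elim (proj₂ (∨-false {L _} (avoid b)) (sym eq))
        ; (suc a) zero eq → ⊥-elim (proj₂ (∨-false {L _} (avoid a)) eq)
        ; (suc a) (suc b) eq → cong suc (inj a b eq) })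
  where
  rest : VSet n
  rest x = many* c t (λ xs → Q (x ◂ xs))
  L′ : Fin n → VSet n
  L′ x y = L y ∨ ⌊ y ≟ x ⌋
  new : ∀ a b → ind a < ind b → a ≡ false × b ≡ true
  new false true _ = refl , refl
  new true true (s≤s ())
  grow : ∀ x → # (L′ x) + t ≤ # L + suc t
  grow x = ≤-trans (#-∨ L (λ y → ⌊ y ≟ x ⌋) +≤ ≤-refl {t})
    (≤-reflexive (trans (cong (λ z → # L + z + t) (Σ-δ₁ x)) (+-assoc (# L) 1 t)))
  ∨-false : ∀ {a} {x y : Fin n} → a ∨ ⌊ y ≟ x ⌋ ≡ false → a ≡ false × y ≢ x
  ∨-false {false} {x} {y} e = refl , false⇒ (y ≟ x) e

-- Distinctness is only arranged inside a block: vertices of different blocks will be adjacent,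
-- hence distinct.
manyB-distinct : ∀ {n t} c k (Q : Blocks n t k → Bool) → c * t < n → manyB c k Q ≡ true →
  ∃[ zs ] (Q zs ≡ true × (∀ i a b → lookup (lookup zs i) a ≡ lookup (lookup zs i) b → a ≡ b))
manyB-distinct c zero Q lt e = ⟨⟩ , e , λ ()
manyB-distinct {n} {t} c (suc k) Q lt e =
  let zs , m , inj = manyB-distinct c k (λ zs → many* c t (λ xs → Q (xs ◂ zs))) lt e
      xs , q , _ , inj′ = many*-distinct c t (λ _ → false) (λ xs → Q (xs ◂ zs))
        (subst (λ z → c * (z + t) < n) (sym (Σ-0 {n} (λ _ → refl))) lt) m
  in xs ◂ zs , q , λ { zero → inj′ ; (suc i) → inj i }

transversal : ∀ {n t k} → Blocks n t k → (Fin k → Fin t) → Vec (Fin n) k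
transversal ⟨⟩ α = ⟨⟩
transversal (xs ◂ zs) α = lookup xs (α zero) ◂ transversal zs (α ∘ suc)

lookup-transversal : ∀ {n t k} (zs : Blocks n t k) α i → lookup (transversal zs α) i ≡ lookup (lookup zs i) (α i)
lookup-transversal (xs ◂ zs) α zero = refl
lookup-transversal (xs ◂ zs) α (suc i) = lookup-transversal zs (α ∘ suc) i

allV-lookup : ∀ {n t} (P : VSet n) (xs : Vec (Fin n) t) → allV P xs ≡ true → ∀ a → P (lookup xs a) ≡ true
allV-lookup P (x ◂ xs) e zero = proj₁ (∧-split e)
allV-lookup P (x ◂ xs) e (suc a) = allV-lookup P xs (proj₂ (∧-split {P x} e)) a

allT-transversal : ∀ {n t k} (W : Vec (Fin n) k → Bool) (zs : Blocks n t k) → allT W zs ≡ true →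
                   ∀ α → W (transversal zs α) ≡ true
allT-transversal W ⟨⟩ e α = e
allT-transversal W (xs ◂ zs) e α = allT-transversal (λ ys → W (lookup xs (α zero) ◂ ys)) zs
  (allV-lookup (λ x → allT (λ ys → W (x ◂ ys)) zs) xs e (α zero)) (α ∘ suc)

-- Greedy embedding

-- Colour j of F is embedded into the reservoir `ρ j` restricted to `A j`. The indirection through
-- `ρ` admits blocks of chosen vertices as well as, with `ρ j = id`, arbitrary vertex sets of G. The
-- number `m` bounds the non-neighbours of a placed vertex in every reservoir that is still to
-- receive one of its neighbours.
module Greedy {v n k N : ℕ} (F : Graph v) (G : Graph n) (c : Fin v → Fin k)
  (ρ : Fin k → Fin N → Fin n) (A : Fin k → VSet N) (m : ℕ) where

  miss : Fin n → Fin k → ℕ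
  miss y j = # (λ a → A j a ∧ not (adj G y (ρ j a)))

  -- P is the set of vertices of F embedded so far; the values of f outside P are junk.
  record Partial (P : VSet v) (f : Fin v → Fin n) : Set where
    field
      inj : ∀ x y → P x ≡ true → P y ≡ true → f x ≡ f y → x ≡ y
      edge : ∀ x y → P x ≡ true → P y ≡ true → adj F x y ≡ true → adj G (f x) (f y) ≡ true
      bound : ∀ x y → P x ≡ true → P y ≡ false → adj F x y ≡ true → miss (f x) (c y) ≤ m
      cross : ∀ x y → P x ≡ false → P y ≡ false → adj F x y ≡ true → c x ≢ c y

  module _ (ρ-inj : ∀ i a b → ρ i a ≡ ρ i b → a ≡ b)
    (ρ-miss : ∀ i j a → A i a ≡ true → i ≢ j → miss (ρ i a) j ≤ m)
    (large : ∀ i → v * suc m < # (A i)) where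

    place : ∀ {P f} → Partial P f → ∀ y → P y ≡ false →
            ∃ λ a → A (c y) a ≡ true × (∀ x → ρ (c y) a ≢ f x) ×
                    (∀ x → P x ≡ true → adj F x y ≡ true → adj G (f x) (ρ (c y) a) ≡ true)
    place {P} {f} S y ¬Py with Σ-<-witness cost (ind ∘ A (c y)) (≤-trans (s≤s total) (large (c y)))
      where
      open Partial S
      clash : Fin v → Fin N → Bool
      clash x a = (P x ∧ adj F x y) ∧ (A (c y) a ∧ not (adj G (f x) (ρ (c y) a)))
      -- The reasons against `a`: each vertex x of F contributes at most one occupied place, junk
      -- values of `f` included, and at most `m` missing adjacencies. This is the source of the
      -- bound `v * suc m`.
      cost : Fin N → ℕ
      cost a = Σᵛ (λ x → δ (ρ (c y) a) (f x) + ind (clash x a))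
      clash-bound : ∀ x → Σᵛ (λ a → ind (clash x a)) ≤ m
      clash-bound x with bool-case (P x ∧ adj F x y)
      ... | inj₁ t = ≤-trans (Σ-mono (λ a → ind-mono {clash x a} (λ e → proj₂ (∧-split {P x ∧ adj F x y} e))))
                       (bound x y (proj₁ (∧-split t)) ¬Py (proj₂ (∧-split {P x} t)))
      ... | inj₂ e rewrite e = ≤-trans (≤-reflexive (Σ-0 {N} (λ _ → refl))) z≤n
      total : Σᵛ cost ≤ v * suc m
      total = begin
        Σᵛ cost ≡⟨ Σ-swap (λ a x → δ (ρ (c y) a) (f x) + ind (clash x a)) ⟩
        Σᵛ (λ x → Σᵛ (λ a → δ (ρ (c y) a) (f x) + ind (clash x a)))
          ≡⟨ Σ-cong (λ x → Σ-+ (λ a → δ (ρ (c y) a) (f x)) (λ a → ind (clash x a))) ⟩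
        Σᵛ (λ x → Σᵛ (λ a → δ (ρ (c y) a) (f x)) + Σᵛ (λ a → ind (clash x a)))
          ≤⟨ Σ-mono (λ x → Σ-inj≤1 (ρ (c y)) (ρ-inj (c y)) (f x) +≤ clash-bound x) ⟩
        Σᵛ {v} (λ _ → suc m) ≡⟨ Σ-const {v} (suc m) ⟩
        v * suc m ∎
        where open ≤-Reasoning
    ... | a , cost< = a , Aa , new , joined
      where
      Aa : A (c y) a ≡ true
      Aa = ind-pos (≤-trans (s≤s z≤n) cost<)
      term<1 : ∀ x → δ (ρ (c y) a) (f x) + ind ((P x ∧ adj F x y) ∧ (A (c y) a ∧ not (adj G (f x) (ρ (c y) a)))) < 1
      term<1 x = ≤-trans (s≤s (term≤Σ _ x)) (≤-trans cost< (ind≤1 _))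
      new : ∀ x → ρ (c y) a ≢ f x
      new x e = n≮n 1 (≤-trans (s≤s (≤-trans (≤-reflexive (sym (trans (cong (δ (ρ (c y) a)) (sym e)) (δ-refl _)))) (m≤m+n _ _))) (term<1 x))
      joined : ∀ x → P x ≡ true → adj F x y ≡ true → adj G (f x) (ρ (c y) a) ≡ true
      joined x Px Fxy with bool-case (adj G (f x) (ρ (c y) a))
      ... | inj₁ t = t
      ... | inj₂ e = ⊥-elim (n≮n 1 (≤-trans (s≤s (≤-trans
              (≤-reflexive (sym (cong ind (∧-intro (∧-intro Px Fxy) (∧-intro Aa (not-true e)))))) (m≤n+m _ _))) (term<1 x)))

    extend : ∀ {P f} → Partial P f → ∀ y → ∃[ P′ ] ∃[ f′ ] (Partial P′ f′ × (∀ x → P x ≡ true → P′ x ≡ true) × P′ y ≡ true)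
    extend {P} {f} S y with bool-case (P y)
    ... | inj₁ Py = P , f , S , (λ _ → id) , Py
    ... | inj₂ ¬Py with place S y ¬Py
    ...   | a , Aa , new , joined = P′ , f′ , S′ , (λ x Px → old⇒ x Px) , new⇒
      where
      open Partial S
      P′ : VSet v
      P′ x = ⌊ x ≟ y ⌋ ∨ P x
      f′ : Fin v → Fin n
      f′ x = if ⌊ x ≟ y ⌋ then ρ (c y) a else f x
      old⇒ : ∀ x → P x ≡ true → P′ x ≡ true
      old⇒ x Px with x ≟ y
      ... | yes _ = refl
      ... | no _ = Px
      new⇒ : P′ y ≡ true
      new⇒ rewrite yes⇒ (y ≟ y) refl = refl
      data View (x : Fin v) : Set where
        this : x ≡ y → f′ x ≡ ρ (c y) a → View x
        old : x ≢ y → P x ≡ true → f′ x ≡ f x → View x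
      view : ∀ x → P′ x ≡ true → View x
      view x e with x ≟ y in eq
      ... | yes p = this p (cong (λ d → if ⌊ d ⌋ then ρ (c y) a else f x) eq)
      ... | no ¬p = old ¬p e (cong (λ d → if ⌊ d ⌋ then ρ (c y) a else f x) eq)
      unplaced : ∀ x → P′ x ≡ false → P x ≡ false
      unplaced x e = ¬true (λ Px → true≢false (old⇒ x Px) e)
      S′ : Partial P′ f′
      S′ = record { inj = inj′ ; edge = edge′ ; bound = bound′
                  ; cross = λ x z ¬x ¬z → cross x z (unplaced x ¬x) (unplaced z ¬z) }
        where
        inj′ : ∀ x z → P′ x ≡ true → P′ z ≡ true → f′ x ≡ f′ z → x ≡ z
        inj′ x z px pz e with view x px | view z pz
        ... | this p _ | this q _ = trans p (sym q)
        ... | this p a≡ | old _ _ b≡ = ⊥-elim (new z (trans (sym a≡) (trans e b≡)))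
        ... | old _ _ a≡ | this q b≡ = ⊥-elim (new x (trans (sym b≡) (trans (sym e) a≡)))
        ... | old _ Px a≡ | old _ Pz b≡ = inj x z Px Pz (trans (sym a≡) (trans e b≡))
        edge′ : ∀ x z → P′ x ≡ true → P′ z ≡ true → adj F x z ≡ true → adj G (f′ x) (f′ z) ≡ true
        edge′ x z px pz e with view x px | view z pz
        ... | this refl _ | this refl _ = ⊥-elim (true≢false e (adj-irrefl F x))
        ... | this refl a≡ | old _ Pz b≡ rewrite a≡ | b≡ =
          trans (adj-sym G _ _) (joined z Pz (trans (adj-sym F z y) e))
        ... | old _ Px a≡ | this refl b≡ rewrite a≡ | b≡ = joined x Px e
        ... | old _ Px a≡ | old _ Pz b≡ rewrite a≡ | b≡ = edge x z Px Pz e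
        bound′ : ∀ x z → P′ x ≡ true → P′ z ≡ false → adj F x z ≡ true → miss (f′ x) (c z) ≤ m
        bound′ x z px ¬pz e with view x px
        ... | this refl a≡ rewrite a≡ = ρ-miss (c y) (c z) a Aa (cross y z ¬Py (unplaced z ¬pz) e)
        ... | old _ Px a≡ rewrite a≡ = bound x z Px (unplaced z ¬pz) e

    fill : ∀ {P f} → Partial P f → (l : List (Fin v)) →
           ∃[ P′ ] ∃[ f′ ] (Partial P′ f′ × (∀ x → P x ≡ true → P′ x ≡ true) × (∀ x → x ∈ l → P′ x ≡ true))
    fill {P} {f} S [] = P , f , S , (λ _ → id) , λ _ ()
    fill S (y ∷ l) =
      let P₁ , f₁ , S₁ , ⊆₁ , y∈ = extend S y
          P₂ , f₂ , S₂ , ⊆₂ , l∈ = fill S₁ l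
      in P₂ , f₂ , S₂ , (λ x p → ⊆₂ x (⊆₁ x p)) , λ { x (here refl) → ⊆₂ x y∈ ; x (there i) → l∈ x i }

    greedy : ∀ {P f} → Partial P f → F ⊆ᴳ G
    greedy S =
      let P , f , S′ , _ , all = fill S (allFin v)
          open Partial S′
      in f , (λ x y → inj x y (all x (∈-allFin x)) (all y (∈-allFin y)))
           , (λ x y → edge x y (all x (∈-allFin x)) (all y (∈-allFin y)))

-- Colourings, edge counts and the decomposition family

swapF : ∀ {k} → Fin k → Fin k → Fin k → Fin k
swapF i j x = if ⌊ x ≟ i ⌋ then j else (if ⌊ x ≟ j ⌋ then i else x)

swapF-left : ∀ {k} (i j : Fin k) → swapF i j i ≡ j
swapF-left i j rewrite yes⇒ (i ≟ i) refl = refl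

swapF-injective : ∀ {k} (i j : Fin k) {x y} → swapF i j x ≡ swapF i j y → x ≡ y
swapF-injective i j {x} {y} e with x ≟ i | y ≟ i
... | yes p | yes q = trans p (sym q)
swapF-injective i j {x} {y} e | yes p | no ¬q with y ≟ j
... | yes r = trans p (trans (sym e) (sym r))
... | no ¬r = ⊥-elim (¬r (sym e))
swapF-injective i j {x} {y} e | no ¬p | yes q with x ≟ j
... | yes r = trans r (trans (sym e) (sym q))
... | no ¬r = ⊥-elim (¬r e)
swapF-injective i j {x} {y} e | no ¬p | no ¬q with x ≟ j | y ≟ j
... | yes r | yes s = trans r (sym s)
... | yes r | no _ = ⊥-elim (¬q (sym e))
... | no _ | yes s = ⊥-elim (¬p e)
... | no _ | no _ = e

In₂ : ∀ {k} → Fin k → Fin k → Fin k → Set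
In₂ a b x = x ≡ a ⊎ x ≡ b

in₂? : ∀ {k} (a b x : Fin k) → Dec (In₂ a b x)
in₂? a b x = (x ≟ a) ⊎-dec (x ≟ b)

-- Identifying two colours makes F k-partite except for the edges between these two classes. If
-- those edges are found inside part i, the other parts can host the rest; this is how a member of
-- the decomposition family yields a copy of F.
merge : ∀ {k} {a b : Fin (suc k)} → a ≢ b → (i : Fin k) →
  ∃ λ (σ : Fin (suc k) → Fin k) →
    (∀ x → In₂ a b x → σ x ≡ i) × (∀ x y → σ x ≡ σ y → x ≡ y ⊎ (In₂ a b x × In₂ a b y))
merge {k} {a} {b} a≢b i = σ , σ≡ , σ-inj
  where
  a′ : Fin k
  a′ = punchOut {i = b} {j = a} (a≢b ∘ sym)
  σ : Fin (suc k) → Fin k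
  σ x with b ≟ x
  ... | yes _ = i
  ... | no b≢x = swapF a′ i (punchOut b≢x)
  σ≡ : ∀ x → In₂ a b x → σ x ≡ i
  σ≡ x u with b ≟ x
  σ≡ x u | yes _ = refl
  σ≡ x (inj₁ refl) | no b≢x = trans (cong (swapF a′ i) (punchOut-cong b refl)) (swapF-left a′ i)
  σ≡ x (inj₂ refl) | no b≢x = ⊥-elim (b≢x refl)
  ≡i⇒ : ∀ x (b≢x : b ≢ x) → swapF a′ i (punchOut b≢x) ≡ i → x ≡ a
  ≡i⇒ x b≢x e = punchOut-injective b≢x (a≢b ∘ sym) (swapF-injective a′ i (trans e (sym (swapF-left a′ i))))
  σ-inj : ∀ x y → σ x ≡ σ y → x ≡ y ⊎ (In₂ a b x × In₂ a b y)
  σ-inj x y e with b ≟ x | b ≟ y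
  ... | yes p | yes q = inj₁ (trans (sym p) q)
  ... | yes p | no b≢y = inj₂ (inj₂ (sym p) , inj₁ (≡i⇒ y b≢y (sym e)))
  ... | no b≢x | yes q = inj₂ (inj₁ (≡i⇒ x b≢x e) , inj₂ (sym q))
  ... | no b≢x | no b≢y = inj₁ (punchOut-injective b≢x b≢y (swapF-injective a′ i e))

pairs : ∀ {n} → (Fin n → Fin n → Bool) → ℕ
pairs R = Σᵛ (λ i → # (R i))

pairs-mono : ∀ {n} {R S : Fin n → Fin n → Bool} → (∀ i j → R i j ≡ true → S i j ≡ true) → pairs R ≤ pairs S
pairs-mono h = Σ-mono (λ i → #-mono (h i))

pairs-cong : ∀ {n} {R S : Fin n → Fin n → Bool} → (∀ i j → R i j ≡ S i j) → pairs R ≡ pairs S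
pairs-cong h = Σ-cong (λ i → Σ-cong (λ j → cong ind (h i j)))

<ᵇ-true : ∀ {m n} → m < n → (m <ᵇ n) ≡ true
<ᵇ-true {zero} (s≤s _) = refl
<ᵇ-true {suc m} (s≤s p) = <ᵇ-true p

<ᵇ-false : ∀ {m n} → n ≤ m → (m <ᵇ n) ≡ false
<ᵇ-false {m} z≤n = refl
<ᵇ-false (s≤s p) = <ᵇ-false p

2*edgesIn : ∀ {n} (G : Graph n) (S : VSet n) → 2 * edgesIn G S ≡ pairs (λ i j → S i ∧ (S j ∧ adj G i j))
2*edgesIn {n} G S = begin
  2 * edgesIn G S
    ≡⟨ cong (edgesIn G S +_) (+-identityʳ _) ⟩
  edgesIn G S + edgesIn G S
    ≡⟨ cong (edgesIn G S +_) (Σ-swap (λ i j → ind (up i j))) ⟩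
  Σᵛ (λ i → # (up i)) + Σᵛ (λ i → # (λ j → up j i))
    ≡⟨ Σ-+ (λ i → # (up i)) (λ i → # (λ j → up j i)) ⟨
  Σᵛ (λ i → # (up i) + # (λ j → up j i))
    ≡⟨ Σ-cong (λ i → trans (sym (Σ-+ (λ j → ind (up i j)) (λ j → ind (up j i)))) (Σ-cong (both i))) ⟩
  pairs (λ i j → S i ∧ (S j ∧ adj G i j)) ∎
  where
  open ≡-Reasoning
  up : Fin n → Fin n → Bool
  up i j = S i ∧ S j ∧ (toℕ i <ᵇ toℕ j) ∧ adj G i j
  ∧-false : ∀ a b → a ∧ (b ∧ false) ≡ false
  ∧-false true true = refl
  ∧-false true false = refl
  ∧-false false b = refl
  ∧-comm₃ : ∀ a b d → b ∧ (a ∧ d) ≡ a ∧ (b ∧ d)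
  ∧-comm₃ true true d = refl
  ∧-comm₃ true false d = refl
  ∧-comm₃ false true d = refl
  ∧-comm₃ false false d = refl
  both : ∀ i j → ind (up i j) + ind (up j i) ≡ ind (S i ∧ (S j ∧ adj G i j))
  both i j with <-cmp (toℕ i) (toℕ j)
  ... | tri< lt _ _ rewrite <ᵇ-true lt | <ᵇ-false (<⇒≤ lt) | ∧-false (S j) (S i) = +-identityʳ _
  ... | tri> _ _ gt rewrite <ᵇ-true gt | <ᵇ-false (<⇒≤ gt) | ∧-false (S i) (S j) | adj-sym G j i =
    cong ind (∧-comm₃ (S i) (S j) (adj G i j))
  ... | tri≈ _ e _ with toℕ-injective e
  ... | refl rewrite <ᵇ-false {toℕ i} ≤-refl | adj-irrefl G i | ∧-false (S i) (S i) = refl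

2*edges : ∀ {n} (G : Graph n) → 2 * edges G ≡ Σᵛ (degree G)
2*edges G = 2*edgesIn G full

-- The vertex set stays `Fin n`, with the vertices outside S isolated, so that bounds for n-vertex
-- graphs apply.
inside : ∀ {n} → Graph n → VSet n → Graph n
inside G S = record
  { adj = λ x y → S x ∧ (S y ∧ adj G x y)
  ; adj-sym = λ x y → iff-≡ (flip x y) (flip y x)
  ; adj-irrefl = λ x → ¬true (λ e → true≢false (proj₂ (∧-split {S x} (proj₂ (∧-split {S x} e)))) (adj-irrefl G x))
  }
  where
  flip : ∀ x y → S x ∧ (S y ∧ adj G x y) ≡ true → S y ∧ (S x ∧ adj G y x) ≡ true
  flip x y e = let Sx , e′ = ∧-split {S x} e
                   Sy , a = ∧-split {S y} e′
               in ∧-intro Sy (∧-intro Sx (trans (adj-sym G y x) a))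

-- The value of `col` at `apex` is junk.
record NearColoring {v : ℕ} (F : Graph v) (k : ℕ) : Set where
  field
    apex : Fin v
    col : Fin v → Fin k
    proper : ∀ x y → x ≢ apex → y ≢ apex → adj F x y ≡ true → col x ≢ col y

star : ∀ N → Graph (suc N)
star N = record { adj = a ; adj-sym = s ; adj-irrefl = λ { zero → refl ; (suc _) → refl } }
  where
  a : Fin (suc N) → Fin (suc N) → Bool
  a zero zero = false
  a zero (suc _) = true
  a (suc _) zero = true
  a (suc _) (suc _) = false
  s : ∀ i j → a i j ≡ a j i
  s zero zero = refl
  s zero (suc _) = refl
  s (suc _) zero = refl
  s (suc _) (suc _) = refl

star-edges : ∀ N → N ≤ edges (star N)
star-edges N = begin
  N ≡⟨ #-full {N} ⟨
  # (λ (j : Fin N) → row (suc j)) ≤⟨ m≤n+m _ _ ⟩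
  ind (row zero) + # (row ∘ suc) ≡⟨ Σ-suc (ind ∘ row) ⟨
  # row ≤⟨ term≤Σ (λ i → # (λ j → (toℕ i <ᵇ toℕ j) ∧ adj (star N) i j)) zero ⟩
  edges (star N) ∎
  where
  open ≤-Reasoning
  row : VSet (suc N)
  row j = (0 <ᵇ toℕ j) ∧ adj (star N) zero j

-- After merging the two colours, every improper edge lies in the part of F mapped to the star, so
-- it passes through the vertex mapped to the centre. If no vertex is mapped there, the merged
-- colouring is proper, contrary to the chromatic number.
decomp-star⇒near : ∀ {v} (F : Graph v) k N → ¬ Colorable F (suc k) → ContainsDecomp F (suc k) (star N) full →
                   NearColoring F (suc k)
decomp-star⇒near F k N χ (col , proper , a , b , a≢b , f , _ , f-inj , f-edge)
  with any? (λ x → in₂? a b (col x) ×-dec (f x ≟ zero)) | merge a≢b (zero {k})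
... | no none | σ , σ≡ , σ-inj = ⊥-elim (χ (σ ∘ col , good))
  where
  good : IsProperColoring F (σ ∘ col)
  good x y e eq with σ-inj (col x) (col y) eq
  ... | inj₁ same = proper x y e same
  ... | inj₂ (ux , uy) with f x in ex | f y in ey | f-edge x y ux uy e
  ... | zero | _ | _ = none (x , ux , ex)
  ... | suc _ | zero | _ = none (y , uy , ey)
  ... | suc _ | suc _ | ()
... | yes (z , uz , fz) | σ , σ≡ , σ-inj = record { apex = z ; col = σ ∘ col ; proper = good }
  where
  good : ∀ x y → x ≢ z → y ≢ z → adj F x y ≡ true → σ (col x) ≢ σ (col y)
  good x y x≢z y≢z e eq with σ-inj (col x) (col y) eq
  ... | inj₁ same = proper x y e same
  ... | inj₂ (ux , uy) with f x in ex | f y in ey | f-edge x y ux uy e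
  ... | zero | _ | _ = x≢z (f-inj x z ux uz (trans ex (sym fz)))
  ... | suc _ | zero | _ = y≢z (f-inj y z uy uz (trans ey (sym fz)))
  ... | suc _ | suc _ | ()

-- A star with more than B leaves cannot be free of the decomposition family. The double negation
-- remains because containment is not decided here; it is harmless, as the colouring only serves to
-- derive contradictions.
bounded⇒near : ∀ {v} (F : Graph v) k B n₀ → ¬ Colorable F (suc k) →
  (∀ n → n₀ ≤ n → (H : Graph n) → ¬ ContainsDecomp F (suc k) H full → edges H ≤ B) → ¬ ¬ NearColoring F (suc k)
bounded⇒near F k B n₀ χ bd no-near =
  n≮n B (≤-trans (m≤n+m (suc B) n₀) (≤-trans (star-edges (n₀ + suc B))
    (bd (suc (n₀ + suc B)) (≤-trans (m≤m+n n₀ (suc B)) (n≤1+n _)) (star (n₀ + suc B))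
      (λ d → no-near (decomp-star⇒near F k (n₀ + suc B) χ d)))))

module Embeddings {v n k N : ℕ} (F : Graph v) (G : Graph n)
  (ρ : Fin k → Fin N → Fin n) (A : Fin k → VSet N) (m : ℕ)
  (ρ-inj : ∀ i a b → ρ i a ≡ ρ i b → a ≡ b) where

  miss : Fin n → Fin k → ℕ
  miss y j = # (λ a → A j a ∧ not (adj G y (ρ j a)))

  module _ (ρ-miss : ∀ i j a → A i a ≡ true → i ≢ j → miss (ρ i a) j ≤ m)
    (large : ∀ i → v * suc m < # (A i)) where

    apex-embed : NearColoring F k → ∀ x → (∀ j a → A j a ≡ true → adj G x (ρ j a) ≡ true) → F ⊆ᴳ G
    apex-embed near x joined = Greedy.greedy F G col ρ A m ρ-inj ρ-miss large {λ y → ⌊ y ≟ apex ⌋} {λ _ → x} (record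
      { inj = λ y z py pz _ → trans (y ≟ apex of py) (sym (z ≟ apex of pz))
      ; edge = λ y z py pz e → ⊥-elim (true≢false e (subst₂ (λ s t → adj F s t ≡ false)
          (sym (y ≟ apex of py)) (sym (z ≟ apex of pz)) (adj-irrefl F apex)))
      ; bound = λ y z _ _ _ → ≤-trans (≤-reflexive (Σ-0 (λ a → cong ind (none (col z) a)))) z≤n
      ; cross = λ y z py pz → proper y z (false⇒ (y ≟ apex) py) (false⇒ (z ≟ apex) pz)
      })
      where
      open NearColoring near
      none : ∀ j a → A j a ∧ not (adj G x (ρ j a)) ≡ false
      none j a = ¬true (λ e → let Aa , na = ∧-split {A j a} e in true≢false (joined j a Aa) (not-false na))

    decomp-embed : ∀ {k′} → suc k ≡ k′ → ∀ (col : Fin v → Fin k′) → IsProperColoring F col → ∀ a b → a ≢ b →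
      (f : Fin v → Fin n) → (i : Fin k) →
      (∀ x y → In₂ a b (col x) → In₂ a b (col y) → f x ≡ f y → x ≡ y) →
      (∀ x y → In₂ a b (col x) → In₂ a b (col y) → adj F x y ≡ true →
         adj G (f x) (f y) ≡ true × (∀ j → i ≢ j → miss (f x) j ≤ m)) →
      F ⊆ᴳ G
    decomp-embed refl col proper a b a≢b f i f-inj f-edge with merge a≢b i
    ... | σ , σ≡ , σ-inj = Greedy.greedy F G (σ ∘ col) ρ A m ρ-inj ρ-miss large {P} {f} (record
      { inj = λ x y px py → f-inj x y (P⇒U px) (P⇒U py)
      ; edge = λ x y px py e → proj₁ (f-edge x y (P⇒U px) (P⇒U py) e)
      ; bound = bound
      ; cross = λ x y px py e eq → cross x y px e eq
      })
      where
      -- Only vertices with a neighbour inside the two classes keep their image. Nothing ties an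
      -- isolated one to part i: in `inside G S` it may be mapped outside S. Such vertices are
      -- embedded afresh.
      P? : ∀ x → Dec (In₂ a b (col x) × ∃ λ y → In₂ a b (col y) × adj F x y ≡ true)
      P? x = in₂? a b (col x) ×-dec any? (λ y → in₂? a b (col y) ×-dec (adj F x y ≟ᵇ true))
      P : VSet v
      P x = ⌊ P? x ⌋
      P⇒U : ∀ {x} → P x ≡ true → In₂ a b (col x)
      P⇒U {x} px = proj₁ (P? x of px)
      cross : ∀ x y → P x ≡ false → adj F x y ≡ true → σ (col x) ≢ σ (col y)
      cross x y px e eq with σ-inj (col x) (col y) eq
      ... | inj₁ same = proper x y e same
      ... | inj₂ (ux , uy) = false⇒ (P? x) px (ux , y , uy , e)
      bound : ∀ x y → P x ≡ true → P y ≡ false → adj F x y ≡ true → miss (f x) (σ (col y)) ≤ m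
      bound x y px py e with P? x of px
      ... | ux , z , uz , e′ = proj₂ (f-edge x z ux uz e′) (σ (col y))
        (λ eq → cross y x py (trans (adj-sym F y x) e) (trans (sym eq) (sym (σ≡ (col x) ux))))

-- Complete multipartite graphs with prescribed part sizes

-- Vertices are placed one by one. A free vertex goes to a class whose size exceeds the demand of
-- the later prescribed vertices; one exists because these are fewer than all remaining places.
realize : ∀ n {k} (Q : VSet n) (p : Fin n → Fin k) (s : Fin k → ℕ) → Σᵛ s ≡ n →
  (∀ i → # (λ x → Q x ∧ inPart p i x) ≤ s i) →
  ∃ λ (q : Fin n → Fin k) → (∀ x → Q x ≡ true → q x ≡ p x) × (∀ i → partSize q i ≡ s i)
realize zero Q p s Σs _ = (λ ()) , (λ ()) , λ i → sym (n≤0⇒n≡0 (≤-trans (term≤Σ s i) (≤-reflexive Σs)))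
realize (suc n) {k} Q p s Σs room = q , agree , sizes
  where
  Q′ : VSet n
  Q′ = Q ∘ suc
  rest : Fin k → ℕ
  rest i = # (λ x → Q′ x ∧ inPart (p ∘ suc) i x)
  room-suc : ∀ i → ind (Q zero ∧ inPart p i zero) + rest i ≤ s i
  room-suc i = ≤-trans (≤-reflexive (sym (Σ-suc (λ x → ind (Q x ∧ inPart p i x))))) (room i)
  first : ∃ λ i → (Q zero ≡ true → i ≡ p zero) × rest i < s i
  first with bool-case (Q zero)
  ... | inj₁ t = p zero , (λ _ → refl) , ≤-trans (≤-reflexive (cong (_+ rest (p zero))
          (sym (cong ind (∧-intro t (yes⇒ (p zero ≟ p zero) refl)))))) (room-suc (p zero))
  ... | inj₂ f with Σ-<-witness rest s (≤-trans (s≤s (≤-trans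
          (Σ-mono (λ i → #-mono {P = λ x → Q′ x ∧ inPart (p ∘ suc) i x} {Q = inPart (p ∘ suc) i} (λ x e → proj₂ (∧-split {Q′ x} e))))
          (≤-reflexive (Σ-partSize (p ∘ suc))))) (≤-reflexive (sym Σs)))
  ... | i , lt = i , (λ t → ⊥-elim (true≢false t f)) , lt
  i₀ = proj₁ first
  s′ : Fin k → ℕ
  s′ j = s j ∸ δ j i₀
  s′-eq : ∀ j → δ j i₀ + s′ j ≡ s j
  s′-eq j with j ≟ i₀
  ... | yes refl = m+[n∸m]≡n (≤-trans (s≤s z≤n) (proj₂ (proj₂ first)))
  ... | no _ = refl
  Σs′ : Σᵛ s′ ≡ n
  Σs′ = +-cancelˡ-≡ 1 _ _ (trans (cong (_+ Σᵛ s′) (sym (Σ-δ₁ i₀)))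
          (trans (sym (Σ-+ (λ j → δ j i₀) s′)) (trans (Σ-cong s′-eq) Σs)))
  room′ : ∀ j → rest j ≤ s′ j
  room′ j with j ≟ i₀
  ... | yes refl = ∸-monoˡ-≤ 1 (proj₂ (proj₂ first))
  ... | no _ = ≤-trans (m≤n+m (rest j) _) (room-suc j)
  ih = realize n Q′ (p ∘ suc) s′ Σs′ room′
  q : Fin (suc n) → Fin k
  q zero = i₀
  q (suc x) = proj₁ ih x
  agree : ∀ x → Q x ≡ true → q x ≡ p x
  agree zero t = proj₁ (proj₂ first) t
  agree (suc x) t = proj₁ (proj₂ ih) x t
  sizes : ∀ j → partSize q j ≡ s j
  sizes j = trans (Σ-suc (ind ∘ inPart q j)) (trans (cong₂ _+_ (δ-sym i₀ j) (proj₂ (proj₂ ih) j)) (s′-eq j))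

-- Complete multipartite competitors and the rigidity of near-optimal part sizes

degSum : (ℕ → ℕ) → ∀ {n} → Graph n → ℕ
degSum φ G = Σᵛ (λ x → φ (degree G x))

-- Apart from `rewire`, all competitors have this form: the plain complete multipartite graph for
-- empty Q, a transplanted core otherwise.
withCore : ∀ {n k} → (Fin n → Fin k) → VSet n → Graph n → Graph n
withCore q Q G = record
  { adj = λ x y → if Q x ∧ Q y then adj G x y else not ⌊ q x ≟ q y ⌋
  ; adj-sym = s
  ; adj-irrefl = r
  }
  where
  ≟-sym : ∀ x y → ⌊ q x ≟ q y ⌋ ≡ ⌊ q y ≟ q x ⌋
  ≟-sym x y = iff-≡ (λ e → yes⇒ (q y ≟ q x) (sym (q x ≟ q y of e))) (λ e → yes⇒ (q x ≟ q y) (sym (q y ≟ q x of e)))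
  s : ∀ x y → (if Q x ∧ Q y then adj G x y else not ⌊ q x ≟ q y ⌋) ≡ (if Q y ∧ Q x then adj G y x else not ⌊ q y ≟ q x ⌋)
  s x y with Q x | Q y
  ... | true | true = adj-sym G x y
  ... | true | false = cong not (≟-sym x y)
  ... | false | true = cong not (≟-sym x y)
  ... | false | false = cong not (≟-sym x y)
  r : ∀ x → (if Q x ∧ Q x then adj G x x else not ⌊ q x ≟ q x ⌋) ≡ false
  r x rewrite yes⇒ (q x ≟ q x) refl with Q x
  ... | true = adj-irrefl G x
  ... | false = refl

cross-degree : ∀ {n k} (q : Fin n → Fin k) x → # (λ y → not ⌊ q x ≟ q y ⌋) + partSize q (q x) ≡ n
cross-degree q x = trans (+-comm _ (partSize q (q x)))
  (trans (cong (_+ # (λ y → not ⌊ q x ≟ q y ⌋)) (Σ-cong (λ y → δ-sym (q y) (q x)))) (#-not (λ y → ⌊ q x ≟ q y ⌋)))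

-- W plays the role of the maximum of Φ.
module Balance (Gr : Growth) (n k W : ℕ)
  (optimal : ∀ (b : Fin k → ℕ) → Σᵛ b ≡ n → Σᵛ (λ i → b i * GrowthFacts.φ Gr (n ∸ b i)) ≤ W) where
  open GrowthFacts Gr

  module _ (b d : Fin k → ℕ) (l e : ℕ) (Σb : Σᵛ b + l ≡ n) (b+d≤n : ∀ i → b i + d i ≤ n)
    (l≤e : l ≤ e) (nearly : W ≤ Σᵛ (λ i → b i * φ (d i)) + e * φ n) where

    private
      S = Σᵛ (λ i → b i * φ (d i))

    -- The competitor puts the l leftover vertices into part i. The degrees there still exceed `d i`
    -- by at least u, which superadditivity turns into a gain of `φ u` for each of the `b i`
    -- vertices.
    shift-gain : ∀ i u → d i + (b i + l) + u ≤ n → b i * φ u ≤ e * φ n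
    shift-gain i u room = +-cancelˡ-≤ S _ _ (≤-trans main (≤-trans (optimal b′ Σb′) nearly))
      where
      b′ : Fin k → ℕ
      b′ m = b m + δ m i * l
      Σb′ : Σᵛ b′ ≡ n
      Σb′ = trans (Σ-+ b (λ m → δ m i * l)) (trans (cong (Σᵛ b +_) (Σ-δ (λ _ → l) i)) Σb)
      term : ∀ m → b m * φ (d m) + δ m i * (b m * φ u) ≤ b′ m * φ (n ∸ b′ m)
      term m with m ≟ i
      ... | yes refl rewrite +-identityʳ l | +-identityʳ (b i * φ u) = begin
        b i * φ (d i) + b i * φ u ≡⟨ *-distribˡ-+ (b i) (φ (d i)) (φ u) ⟨
        b i * (φ (d i) + φ u) ≤⟨ b i ·≤ φ-super (d i) u ⟩
        b i * φ (d i + u) ≤⟨ b i ·≤ φ-mono (m+n≤o⇒m≤o∸n (d i + u) (≤-trans (≤-reflexive (eq (d i) u (b i + l))) room)) ⟩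
        b i * φ (n ∸ (b i + l)) ≤⟨ *-monoˡ-≤ _ (m≤m+n (b i) l) ⟩
        (b i + l) * φ (n ∸ (b i + l)) ∎
        where
        open ≤-Reasoning
        eq : ∀ x y z → x + y + z ≡ x + z + y
        eq x y z = solve (x ∷ y ∷ z ∷ [])
      ... | no _ rewrite +-identityʳ (b m) | +-identityʳ (b m * φ (d m)) =
        b m ·≤ φ-mono (m+n≤o⇒m≤o∸n (d m) (≤-trans (≤-reflexive (+-comm (d m) (b m))) (b+d≤n m)))
      main : S + b i * φ u ≤ Σᵛ (λ m → b′ m * φ (n ∸ b′ m))
      main = ≤-trans (≤-reflexive (trans (cong (S +_) (sym (Σ-δ (λ m → b m * φ u) i))) (sym (Σ-+ (λ m → b m * φ (d m)) (λ m → δ m i * (b m * φ u))))))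
        (Σ-mono term)

    -- The competitor keeps y vertices of part j and moves the other x, with the l leftovers, into
    -- part i. The y kept vertices gain `φ x` each. The moved ones lose nothing, as the new part i
    -- is no larger than the old part j. The old vertices of part i lose at most `φ n` each.
    split-gain : ∀ i j → i ≢ j → ∀ x y → x + y ≡ b j → b i + l ≤ y → y * φ x ≤ (b i + e) * φ n
    split-gain i j i≢j x y x+y≡ fits = +-cancelˡ-≤ (S + x * φ (d j)) _ _
      (≤-trans (≤-trans (≤-reflexive lhs) (Σ-mono term)) (≤-trans (≤-reflexive rhs)
        (≤-trans (((optimal b′ Σb′ +≤ ≤-refl {b i * φ n}) +≤ ≤-refl {x * φ (d j)}))
          (≤-trans (((nearly +≤ ≤-refl {b i * φ n}) +≤ ≤-refl {x * φ (d j)})) (≤-reflexive (eq₃ S (e) (φ n) (b i) (x * φ (d j))))))))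
      where
      eq₃ : ∀ s e f b z → s + e * f + b * f + z ≡ s + z + (b + e) * f
      eq₃ s e f b z = solve (s ∷ e ∷ f ∷ b ∷ z ∷ [])
      b′ : Fin k → ℕ
      b′ m = if ⌊ m ≟ i ⌋ then b i + l + x else (if ⌊ m ≟ j ⌋ then y else b m)
      moved : ∀ m → b′ m + δ m j * x ≡ b m + δ m i * (l + x)
      moved m with m ≟ i | m ≟ j
      ... | yes p | yes q = ⊥-elim (i≢j (trans (sym p) q))
      ... | yes refl | no _ = eq (b i) l x
        where
        eq : ∀ b l x → b + l + x + 0 ≡ b + (l + x + 0)
        eq b l x = solve (b ∷ l ∷ x ∷ [])
      ... | no _ | yes refl = trans (cong (y +_) (+-identityʳ x)) (trans (+-comm y x) (trans x+y≡ (sym (+-identityʳ _))))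
      ... | no _ | no _ = refl
      Σb′ : Σᵛ b′ ≡ n
      Σb′ = +-cancelʳ-≡ x _ _ (begin
        Σᵛ b′ + x ≡⟨ cong (Σᵛ b′ +_) (Σ-δ (λ _ → x) j) ⟨
        Σᵛ b′ + Σᵛ (λ m → δ m j * x) ≡⟨ Σ-+ b′ (λ m → δ m j * x) ⟨
        Σᵛ (λ m → b′ m + δ m j * x) ≡⟨ Σ-cong moved ⟩
        Σᵛ (λ m → b m + δ m i * (l + x)) ≡⟨ Σ-+ b (λ m → δ m i * (l + x)) ⟩
        Σᵛ b + Σᵛ (λ m → δ m i * (l + x)) ≡⟨ cong (Σᵛ b +_) (Σ-δ (λ _ → l + x) i) ⟩
        Σᵛ b + (l + x) ≡⟨ +-assoc (Σᵛ b) l x ⟨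
        Σᵛ b + l + x ≡⟨ cong (_+ x) Σb ⟩
        n + x ∎)
        where open ≡-Reasoning
      u = x * φ (d j)
      term : ∀ m → b m * φ (d m) + δ m i * u + δ m j * (y * φ x) ≤ b′ m * φ (n ∸ b′ m) + δ m i * (b i * φ n) + δ m j * u
      term m with m ≟ i | m ≟ j
      ... | yes p | yes q = ⊥-elim (i≢j (trans (sym p) q))
      ... | no _ | no _ = (b m ·≤ φ-mono (m+n≤o⇒m≤o∸n (d m) (≤-trans (≤-reflexive (+-comm (d m) (b m))) (b+d≤n m)))) +≤ z≤n +≤ z≤n
      ... | yes refl | no _ = in-i (b i) (φ (d i)) (φ n) x (φ (d j)) l _ (φ-mono (≤-trans (m≤n+m (d i) (b i)) (b+d≤n i)))
              (φ-mono (m+n≤o⇒m≤o∸n (d j) (≤-trans (room (d j) (b i) l x y (b j) x+y≡ fits) (b+d≤n j))))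
        where
        room : ∀ d bi l x y bj → x + y ≡ bj → bi + l ≤ y → d + (bi + l + x) ≤ bj + d
        room d bi l x y _ refl p = lin 0 p (solve (d ∷ bi ∷ l ∷ x ∷ y ∷ []))
        in-i : ∀ b f N x g l M → f ≤ N → g ≤ M → b * f + (x * g + 0) + 0 ≤ (b + l + x) * M + (b * N + 0) + 0
        in-i b f N x g l M p q = lin ((b + l) * M) (b ·≤ p +≤ x ·≤ q) (solve (b ∷ f ∷ N ∷ x ∷ g ∷ l ∷ M ∷ []))
      ... | no _ | yes refl = in-j (b j) x y (φ (d j)) (φ x) (φ (n ∸ y)) x+y≡
              (≤-trans (φ-super (d j) x) (φ-mono (m+n≤o⇒m≤o∸n (d j + x) (≤-trans (≤-reflexive (room (d j) x y (b j) x+y≡)) (b+d≤n j)))))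
        where
        room : ∀ d x y bj → x + y ≡ bj → d + x + y ≡ bj + d
        room d x y _ refl = solve (d ∷ x ∷ y ∷ [])
        in-j : ∀ b x y f g M → x + y ≡ b → f + g ≤ M → b * f + 0 + (y * g + 0) ≤ y * M + 0 + (x * f + 0)
        in-j _ x y f g M refl p = lin 0 (y ·≤ p) (solve (x ∷ y ∷ f ∷ g ∷ M ∷ []))
      sum₃ : ∀ (f g h : Fin k → ℕ) (r s : Fin k) → Σᵛ (λ m → f m + δ m r * g m + δ m s * h m) ≡ Σᵛ f + g r + h s
      sum₃ f g h r s = trans (Σ-+ (λ m → f m + δ m r * g m) (λ m → δ m s * h m))
        (cong₂ _+_ (trans (Σ-+ f (λ m → δ m r * g m)) (cong (Σᵛ f +_) (Σ-δ g r))) (Σ-δ h s))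
      lhs : S + u + y * φ x ≡ Σᵛ (λ m → b m * φ (d m) + δ m i * u + δ m j * (y * φ x))
      lhs = sym (sum₃ (λ m → b m * φ (d m)) (λ _ → u) (λ _ → y * φ x) i j)
      rhs : Σᵛ (λ m → b′ m * φ (n ∸ b′ m) + δ m i * (b i * φ n) + δ m j * u) ≡ Σᵛ (λ m → b′ m * φ (n ∸ b′ m)) + b i * φ n + u
      rhs = sum₃ (λ m → b′ m * φ (n ∸ b′ m)) (λ _ → b i * φ n) (λ _ → u) i j

halve : ∀ b → ∃[ x ] ∃[ y ] (x + y ≡ b × x ≤ y × y ≤ suc x)
halve zero = 0 , 0 , refl , z≤n , z≤n
halve (suc b) = let x , y , e , p , q = halve b in
  y , suc x , trans (+-suc y x) (cong suc (trans (+-comm y x) e)) , q , s≤s p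

average : ∀ {k} (f : Fin (suc k) → ℕ) w → suc k * w ≤ Σᵛ f → ∃ λ i → w ≤ f i
average {k} f w p with any? (λ i → w ≤? f i)
... | yes r = r
... | no ¬r = ⊥-elim (<⇒≱ (Σ-mono-< {f = f} {λ _ → w} (λ i → <⇒≤ (lt i)) zero (lt zero)) (≤-trans (≤-reflexive (Σ-const {suc k} w)) p))
  where
  lt : ∀ i → f i < w
  lt i = ≰⇒> (λ le → ¬r (i , le))

majority-half : ∀ k n b l → n ≤ k * b + l → 2 * l ≤ n → n ≤ 2 * k * b
majority-half k n b l p q = lin 0 (2 ·≤ p +≤ q) (solve (k ∷ n ∷ b ∷ l ∷ []))

2k≤Γ : ∀ k L → 2 * k ≤ 16 * k * suc L
2k≤Γ k L = lin (14 * k + 16 * k * L) (≤-refl {0}) (solve (k ∷ L ∷ []))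

half-large : ∀ k n y x → n ≤ 2 * k * (x + y) → y ≤ suc x → 4 * k ≤ n → n ≤ 8 * k * x
half-large k n y x p q r = lin 0 (2 ·≤ p +≤ (4 * k) ·≤ q +≤ r) (solve (k ∷ n ∷ y ∷ x ∷ []))

fits-in-half : ∀ k L b e n y → 16 * k * suc L * b ≤ n → 16 * k * suc L * e ≤ n → n ≤ 4 * k * y → 8 * k * (b + e) ≤ 8 * k * y
fits-in-half k L b e n y p q r = *-cancelˡ-≤ 2 (lin (16 * k * L * b + 16 * k * L * e)
  (p +≤ q +≤ 2 ·≤ r +≤ z≤n {8 * k * y}) (solve (k ∷ L ∷ b ∷ e ∷ n ∷ y ∷ [])))

shift-sum : ∀ Δ k d b l n → b + l ≡ n → Δ * k * (d + b) + k * n ≤ k * (Δ * (d + n) + n)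
shift-sum Δ k d b l _ refl = lin (Δ * k * l) (≤-refl {0}) (solve (Δ ∷ k ∷ d ∷ b ∷ l ∷ []))

gap-average : ∀ Δ k b d w n → b + d + w ≡ n → Δ * k * (d + b) + n < Δ * k * n → n < Δ * k * w
gap-average Δ k b d w n e p = lin {Δ * k * (d + b) + suc n} {Δ * k * (b + d + w)} 0
  (≤-trans (≤-reflexive (+-suc (Δ * k * (d + b)) n)) (≤-trans p (≤-reflexive (cong (Δ * k *_) (sym e))))) (solve (Δ ∷ k ∷ b ∷ d ∷ w ∷ n ∷ []))

k≤2k : ∀ Δ k → Δ * k ≤ 2 * Δ * k
k≤2k Δ k = lin (Δ * k) (≤-refl {0}) (solve (Δ ∷ k ∷ []))

remainder-large : ∀ Δ k l u w n → l + u ≡ w → n < Δ * k * w → 2 * Δ * k * l ≤ n → n ≤ 2 * Δ * k * u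
remainder-large Δ k l u _ n refl p q = lin 2 (2 ·≤ p +≤ q) (solve (Δ ∷ k ∷ l ∷ u ∷ n ∷ []))

module Rigidity (Gr : Growth) (k′ : ℕ) where
  open GrowthFacts Gr
  private
    k = suc k′
    sc₁ = scaling (8 * k)
  -- Half of a part of size at least n / (2k) has at least n / (8k) vertices, whence
  -- `scaling (8 * k)`; the factor 16k leaves room for halving and for the error e.
  Γ : ℕ
  Γ = 16 * k * suc (proj₁ sc₁)

  -- How small e has to be against n: `Γ` for `parts-large`, `2 * Δ * k` so that the leftovers fill
  -- at most half of a degree gap, and the last summand for the contradiction in `degrees-heavy`.
  slack : ℕ → ℕ
  slack Δ = Γ + (2 * Δ * k + suc (Γ * proj₁ (scaling (2 * Δ * k))))

  threshold : ℕ → ℕ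
  threshold Δ = proj₁ (proj₂ sc₁) + (proj₁ (proj₂ (scaling (2 * Δ * k))) + (proj₁ positive + (4 * k + 1)))

  module _ (n W : ℕ)
    (optimal : ∀ (b : Fin k → ℕ) → Σᵛ b ≡ n → Σᵛ (λ i → b i * φ (n ∸ b i)) ≤ W)
    (Δ : ℕ) (n-large : threshold Δ ≤ n)
    (b d : Fin k → ℕ) (l e : ℕ) (Σb : Σᵛ b + l ≡ n) (b+d≤n : ∀ i → b i + d i ≤ n)
    (l≤e : l ≤ e) (nearly : W ≤ Σᵛ (λ i → b i * φ (d i)) + e * φ n) (e-small : slack Δ * e ≤ n) where

    open Balance Gr n k W optimal

    private
      N₁ = m+n≤o⇒m≤o (proj₁ (proj₂ sc₁)) n-large
      rest₁ = m+n≤o⇒n≤o (proj₁ (proj₂ sc₁)) n-large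
      N₂ = m+n≤o⇒m≤o (proj₁ (proj₂ (scaling (2 * Δ * k)))) rest₁
      rest₂ = m+n≤o⇒n≤o (proj₁ (proj₂ (scaling (2 * Δ * k)))) rest₁
      N₃ = m+n≤o⇒m≤o (proj₁ positive) rest₂
      rest₃ = m+n≤o⇒n≤o (proj₁ positive) rest₂
      4k≤n : 4 * k ≤ n
      4k≤n = m+n≤o⇒m≤o (4 * k) rest₃
      φn>0 : 1 ≤ φ n
      φn>0 = proj₂ positive n N₃
      φ>0 : ∀ {L x} → φ n ≤ L * φ x → NonZero (φ x)
      φ>0 {L} {x} p with φ x
      ... | zero = ⊥-elim (n≮n 0 (≤-trans φn>0 (≤-trans p (≤-reflexive (*-zeroʳ L)))))
      ... | suc _ = nonZero
      cancel-φ : ∀ {L x y z} → φ n ≤ L * φ x → y * φ x ≤ z * φ n → y ≤ z * L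
      cancel-φ {L} {x} {y} {z} p q = *-cancelʳ-≤ y (z * L) (φ x) {{φ>0 {L} p}}
        (≤-trans q (≤-trans (z ·≤ p) (≤-reflexive (sym (*-assoc z L (φ x))))))
      Γe≤n : Γ * e ≤ n
      Γe≤n = ≤-trans (*-monoˡ-≤ e (m≤m+n Γ _)) e-small

    -- If part i were small, halving a part j of size at least n / (2k) would be profitable: in
    -- `split-gain` both x and y are linear in n, which forces `b i + e` to be linear too.
    parts-large : ∀ i → n ≤ Γ * b i
    parts-large i with n ≤? Γ * b i
    ... | yes p = p
    ... | no ¬p = ⊥-elim (contra k (suc (proj₁ sc₁)) (b i) e n y (≰⇒> ¬p) Γe≤n n≤4ky y≤)
      where
      L = suc (proj₁ sc₁)
      big : ∃ λ j → n ≤ k * b j + l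
      big = average (λ j → k * b j + l) n (≤-reflexive (sym (begin
        Σᵛ (λ j → k * b j + l) ≡⟨ Σ-+ (λ j → k * b j) (λ _ → l) ⟩
        Σᵛ (λ j → k * b j) + Σᵛ {k} (λ _ → l) ≡⟨ cong₂ _+_ (Σ-* k b) (Σ-const {k} l) ⟩
        k * Σᵛ b + k * l ≡⟨ *-distribˡ-+ k (Σᵛ b) l ⟨
        k * (Σᵛ b + l) ≡⟨ cong (k *_) Σb ⟩
        k * n ∎)))
        where open ≡-Reasoning
      j = proj₁ big
      2≤ : ∀ k L → 2 ≤ 16 * suc k * suc L
      2≤ k L = lin (14 + 16 * k + 16 * L + 16 * k * L) (≤-refl {0}) (solve (k ∷ L ∷ []))
      2l≤n : 2 * l ≤ n
      2l≤n = ≤-trans (2 ·≤ l≤e) (≤-trans (*-monoˡ-≤ e {2} {Γ} (2≤ k′ (proj₁ sc₁))) Γe≤n)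
      n≤2kb : n ≤ 2 * k * b j
      n≤2kb = majority-half k n (b j) l (proj₂ big) 2l≤n
      i≢j : i ≢ j
      i≢j refl = ¬p (≤-trans n≤2kb (*-monoˡ-≤ (b j) (2k≤Γ k (proj₁ sc₁))))
      x = proj₁ (halve (b j))
      y = proj₁ (proj₂ (halve (b j)))
      xy = proj₂ (proj₂ (halve (b j)))
      n≤4ky : n ≤ 4 * k * y
      n≤4ky = ≤-trans n≤2kb (≤-trans (2 * k ·≤ ≤-trans (≤-reflexive (sym (proj₁ xy))) (+-monoˡ-≤ y (proj₁ (proj₂ xy))))
        (≤-reflexive (eq k y)))
        where
        eq : ∀ k y → 2 * k * (y + y) ≡ 4 * k * y
        eq k y = solve (k ∷ y ∷ [])
      n≤8kx : n ≤ 8 * k * x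
      n≤8kx = half-large k n y x (≤-trans n≤2kb (2 * k ·≤ ≤-reflexive (sym (proj₁ xy)))) (proj₂ (proj₂ xy)) 4k≤n
      fits : b i + l ≤ y
      fits = *-cancelˡ-≤ (8 * k) (≤-trans (*-monoʳ-≤ (8 * k) (+-monoʳ-≤ (b i) l≤e))
        (fits-in-half k (proj₁ sc₁) (b i) e n y (<⇒≤ (≰⇒> ¬p)) Γe≤n n≤4ky))
      scaled : φ n ≤ L * φ x
      scaled = ≤-trans (proj₂ (proj₂ sc₁) n x N₁ n≤8kx) (m≤n+m _ (φ x))
      y≤ : y ≤ (b i + e) * L
      y≤ = cancel-φ {L} {x} {y} {b i + e} scaled
        (split-gain b d l e Σb b+d≤n l≤e nearly i j i≢j x y (proj₁ xy) fits)
      contra : ∀ k L b e n y → 16 * k * L * b < n → 16 * k * L * e ≤ n → n ≤ 4 * k * y → y ≤ (b + e) * L → ⊥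
      contra k L b e n y p q r s = n≮n (2 * n) lt
        where
        lt : 2 * n < 2 * n
        lt = lin (2 * n) (p +≤ q +≤ 4 ·≤ r +≤ (16 * k) ·≤ s) (solve (k ∷ L ∷ b ∷ e ∷ n ∷ y ∷ []))

    -- The claim is that the degree sum is at least (k - 1) n - n / Δ. Otherwise some `d i` falls
    -- short of `n - b i` by more than n / (Δ k), and `shift-gain` makes `b i` a constant multiple
    -- of e, too small for `parts-large`.
    degrees-heavy : Δ * (k * n) ≤ Δ * (Σᵛ d + n) + n
    degrees-heavy with Δ * (k * n) ≤? Δ * (Σᵛ d + n) + n
    ... | yes p = p
    ... | no ¬p = ⊥-elim (contra (e) (b i) n Γ L (2 * Δ * k) (parts-large i) b≤ e-small (≤-trans (m≤n+m 1 (4 * k)) rest₃))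
      where
      L = proj₁ (scaling (2 * Δ * k))
      g′ f′ : Fin k → ℕ
      g′ i = Δ * k * (d i + b i) + n
      f′ i = Δ * k * n
      Σg<Σf : Σᵛ g′ < Σᵛ f′
      Σg<Σf = begin-strict
        Σᵛ g′ ≡⟨ Σ-+ (λ i → Δ * k * (d i + b i)) (λ _ → n) ⟩
        Σᵛ (λ i → Δ * k * (d i + b i)) + Σᵛ {k} (λ _ → n) ≡⟨ cong₂ _+_ (trans (Σ-* (Δ * k) (λ i → d i + b i)) (cong (Δ * k *_) (Σ-+ d b))) (Σ-const {k} n) ⟩
        Δ * k * (Σᵛ d + Σᵛ b) + k * n ≤⟨ shift-sum Δ k (Σᵛ d) (Σᵛ b) l n Σb ⟩
        k * (Δ * (Σᵛ d + n) + n) <⟨ *-monoʳ-< k (≰⇒> ¬p) ⟩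
        k * (Δ * (k * n)) ≡⟨ cong (k *_) (sym (*-assoc Δ k n)) ⟩
        k * (Δ * k * n) ≡⟨ Σ-const {k} (Δ * k * n) ⟨
        Σᵛ f′ ∎
        where
        open ≤-Reasoning
      found = Σ-<-witness g′ f′ Σg<Σf
      i = proj₁ found
      w = n ∸ (b i + d i)
      w-eq : b i + d i + w ≡ n
      w-eq = m+[n∸m]≡n (b+d≤n i)
      n<Δkw : n < Δ * k * w
      n<Δkw = gap-average Δ k (b i) (d i) w n w-eq (proj₂ found)
      2Δkl≤n : 2 * Δ * k * l ≤ n
      2Δkl≤n = ≤-trans (2 * Δ * k ·≤ l≤e) (≤-trans (*-monoˡ-≤ e (≤-trans (m≤m+n (2 * Δ * k) _) (m≤n+m _ Γ))) e-small)
      l≤w : l ≤ w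
      l≤w with l ≤? w
      ... | yes q = q
      ... | no ¬q = ⊥-elim (n≮n n (≤-trans n<Δkw (≤-trans (Δ * k ·≤ <⇒≤ (≰⇒> ¬q)) (≤-trans (*-monoˡ-≤ l (k≤2k Δ k)) 2Δkl≤n))))
      u = w ∸ l
      u-eq : l + u ≡ w
      u-eq = m+[n∸m]≡n l≤w
      n≤2Δku : n ≤ 2 * Δ * k * u
      n≤2Δku = remainder-large Δ k l u w n u-eq n<Δkw 2Δkl≤n
      b≤ : b i ≤ e * L
      b≤ = cancel-φ {L} {u} {b i} {e} (proj₂ (proj₂ (scaling (2 * Δ * k))) n u N₂ n≤2Δku)
        (shift-gain b d l e Σb b+d≤n l≤e nearly i u (≤-reflexive (trans (eq (d i) (b i) l u) (trans (cong (b i + d i +_) u-eq) w-eq))))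
        where
        eq : ∀ d b l u → d + (b + l) + u ≡ b + d + (l + u)
        eq d b l u = solve (d ∷ b ∷ l ∷ u ∷ [])
      contra : ∀ e b n Γ L M → n ≤ Γ * b → b ≤ e * L → (Γ + (M + suc (Γ * L))) * e ≤ n → 1 ≤ n → ⊥
      contra e b n Γ L M p q r s with e≤0
        where
        e≤0 : e ≤ 0
        e≤0 = lin (Γ * e + M * e) (p +≤ Γ ·≤ q +≤ r) (solve (e ∷ b ∷ n ∷ Γ ∷ L ∷ M ∷ []))
      contra _ b n Γ L M p z≤n r s | z≤n = n≮n 0 (≤-trans s (≤-trans p (≤-reflexive (*-zeroʳ Γ))))

-- Chains of vertices of nearly maximal degree

_∩_ : ∀ {n} → VSet n → VSet n → VSet n
(S ∩ R) x = S x ∧ R x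

_∖_ : ∀ {n} → VSet n → VSet n → VSet n
(S ∖ R) x = S x ∧ not (R x)

module Chains {n : ℕ} (G : Graph n) (E : ℕ) where

  above : VSet n → ℕ → VSet n
  above S D u = S u ∧ ⌊ D ≤? degree G u ⌋

  -- Once S has at most n / E elements every vertex qualifies, so that chains never get stuck.
  top : VSet n → VSet n
  top S v = ⌊ E * # S ≤? n ⌋ ∨ (S v ∧ ⌊ E * # (above S (suc (degree G v))) ≤? n ⌋)

  last-large : ∀ (f : ℕ → ℕ) m → n < f 0 → f m ≤ n → ∃ λ D → n < f D × f (suc D) ≤ n
  last-large f zero p q = ⊥-elim (<⇒≱ p q)
  last-large f (suc m) p q with f m ≤? n
  ... | yes r = last-large f m p r
  ... | no ¬r = m , ≰⇒> ¬r , q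

  -- Take the last threshold D that more than n / E members of S reach: each of these members
  -- qualifies, since too few exceed D.
  top-many : 1 ≤ E → ∀ S → many E (top S) ≡ true
  top-many 1≤E S = go (E * # S ≤? n)
    where
    go : Dec (E * # S ≤ n) → many E (top S) ≡ true
    go (yes small) = many⁺ E (≤-trans (≤-reflexive (sym (#-full {n})))
          (≤-trans (≤-reflexive (sym (+-identityʳ _))) (*-mono-≤ 1≤E (#-mono {n} {full} {top S} (λ x _ → whole x)))))
      where
      whole : ∀ x → top S x ≡ true
      whole x rewrite yes⇒ (E * # S ≤? n) small = refl
    go (no ¬small) =
      let D , large , small = last-large (λ D → E * # (above S D)) (suc n) start end
      in many⁺ E (<⇒≤ (≤-trans large (E ·≤ #-mono {P = above S D} {top S} (step D small))))
      where
      start : n < E * # (above S 0)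
      start = subst (λ z → n < E * z) (Σ-cong (λ u → cong ind (iff-≡ (λ s → ∧-intro s (yes⇒ (0 ≤? degree G u) z≤n)) (λ e → proj₁ (∧-split {S u} e))))) (≰⇒> ¬small)
      empty : ∀ u → above S (suc n) u ≡ false
      empty u = ¬true (λ e → <⇒≱ (suc n ≤? degree G u of proj₂ (∧-split {S u} e)) (#-≤ (adj G u)))
      end : E * # (above S (suc n)) ≤ n
      end = ≤-trans (≤-reflexive (trans (cong (E *_) (Σ-0 (λ u → cong ind (empty u)))) (*-zeroʳ E))) z≤n
      step : ∀ D → E * # (above S (suc D)) ≤ n → ∀ v → above S D v ≡ true → top S v ≡ true
      step D small v e rewrite no⇒ (E * # S ≤? n) ¬small =
        let Sv , Dv = ∧-split {S v} e
        in ∧-intro Sv (yes⇒ (_ ≤? n) (≤-trans (E ·≤ #-mono (λ u e′ →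
             let Su , du = ∧-split {S u} e′
             in ∧-intro Su (yes⇒ (_ ≤? _) (≤-trans (s≤s (D ≤? degree G v of Dv)) (suc (degree G v) ≤? degree G u of du))))) small))

  chain : ∀ {l} → VSet n → Vec (Fin n) l → Bool
  chain S ⟨⟩ = true
  chain S (v ◂ vs) = top S v ∧ chain (S ∩ adj G v) vs

  chain-many : 1 ≤ E → ∀ l S → many* E l (chain {l} S) ≡ true
  chain-many 1≤E zero S = refl
  chain-many 1≤E (suc l) S = many-mono {P = top S} ≤-refl
    (λ v t → many*-mono l ≤-refl (λ vs c → ∧-intro t c) (chain-many 1≤E l (S ∩ adj G v))) (top-many 1≤E S)

  rest : ∀ {l} → VSet n → Vec (Fin n) l → VSet n
  rest S ⟨⟩ = S
  rest S (v ◂ vs) = rest (S ∩ adj G v) vs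

  -- The part sizes of the majorizing complete partite graph.
  dropped : ∀ {l} → VSet n → Vec (Fin n) l → Fin l → ℕ
  dropped S (v ◂ vs) zero = # (S ∖ adj G v)
  dropped S (v ◂ vs) (suc i) = dropped (S ∩ adj G v) vs i

  dropped-sum : ∀ {l} S (vs : Vec (Fin n) l) → Σᵛ (dropped S vs) + # (rest S vs) ≡ # S
  dropped-sum S ⟨⟩ = refl
  dropped-sum S (v ◂ vs) = begin
    Σᵛ (dropped S (v ◂ vs)) + # (rest S (v ◂ vs))
      ≡⟨ cong (_+ # (rest S (v ◂ vs))) (Σ-suc (dropped S (v ◂ vs))) ⟩
    # (S ∖ adj G v) + Σᵛ (dropped (S ∩ adj G v) vs) + # (rest (S ∩ adj G v) vs)
      ≡⟨ +-assoc (# (S ∖ adj G v)) _ _ ⟩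
    # (S ∖ adj G v) + (Σᵛ (dropped (S ∩ adj G v) vs) + # (rest (S ∩ adj G v) vs))
      ≡⟨ cong (# (S ∖ adj G v) +_) (dropped-sum (S ∩ adj G v) vs) ⟩
    # (S ∖ adj G v) + # (S ∩ adj G v)
      ≡⟨ +-comm (# (S ∖ adj G v)) _ ⟩
    # (S ∩ adj G v) + # (S ∖ adj G v)
      ≡⟨ #-split S (adj G v) ⟩
    # S ∎
    where open ≡-Reasoning

  dropped+degree : ∀ {l} S (vs : Vec (Fin n) l) i → dropped S vs i + degree G (lookup vs i) ≤ n
  dropped+degree S (v ◂ vs) zero = ≤-trans (+-monoˡ-≤ (degree G v)
    (#-mono {Q = not ∘ adj G v} (λ u e → proj₂ (∧-split {S u} e)))) (≤-reflexive (trans (+-comm _ (degree G v)) (#-not (adj G v))))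
  dropped+degree S (v ◂ vs) (suc i) = dropped+degree (S ∩ adj G v) vs i

  rest⊆ : ∀ {l} S (vs : Vec (Fin n) l) x → rest S vs x ≡ true → S x ≡ true
  rest⊆ S ⟨⟩ x e = e
  rest⊆ S (v ◂ vs) x e = proj₁ (∧-split (rest⊆ (S ∩ adj G v) vs x e))

  dropped≤ : ∀ {l} S (vs : Vec (Fin n) l) i → dropped S vs i ≤ # S
  dropped≤ S vs i = ≤-trans (≤-trans (term≤Σ (dropped S vs) i) (m≤m+n _ _)) (≤-reflexive (dropped-sum S vs))

  clique : ∀ {l} → VSet n → Vec (Fin n) l → Bool
  clique S ⟨⟩ = true
  clique S (v ◂ vs) = S v ∧ clique (S ∩ adj G v) vs

  clique-⊆ : ∀ {l} {S R : VSet n} (vs : Vec (Fin n) l) → (∀ x → S x ≡ true → R x ≡ true) → clique S vs ≡ true → clique R vs ≡ true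
  clique-⊆ ⟨⟩ h e = e
  clique-⊆ {S = S} (v ◂ vs) h e = let Sv , c = ∧-split {S v} e in
    ∧-intro (h v Sv) (clique-⊆ vs (λ x e′ → let Sx , a = ∧-split {S x} e′ in ∧-intro (h x Sx) a) c)

  clique-snoc : ∀ {l} S (vs : Vec (Fin n) l) x → clique S vs ≡ true → rest S vs x ≡ true → clique S (x ◂ vs) ≡ true
  clique-snoc S ⟨⟩ x c r = ∧-intro r refl
  clique-snoc S (v ◂ vs) x c r =
    let Sv , c′ = ∧-split {S v} c
        Sx , ax = ∧-split {S x} (rest⊆ (S ∩ adj G v) vs x r)
        _ , c″ = ∧-split {S x ∧ adj G v x} (clique-snoc (S ∩ adj G v) vs x c′ r)
    in ∧-intro Sx (∧-intro (∧-intro Sv (trans (adj-sym G x v) ax))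
         (clique-⊆ vs (λ y e → let e₁ , b = ∧-split {S y ∧ adj G v y} e
                                   e₂ , a = ∧-split {S y} e₁
                               in ∧-intro (∧-intro e₂ b) a) c″))

  clique-member : ∀ {l} S (vs : Vec (Fin n) l) → clique S vs ≡ true → ∀ i → S (lookup vs i) ≡ true
  clique-member S (v ◂ vs) c zero = proj₁ (∧-split c)
  clique-member S (v ◂ vs) c (suc i) = proj₁ (∧-split (clique-member (S ∩ adj G v) vs (proj₂ (∧-split {S v} c)) i))

  clique-adj : ∀ {l} S (vs : Vec (Fin n) l) → clique S vs ≡ true → ∀ i j → i ≢ j → adj G (lookup vs i) (lookup vs j) ≡ true
  clique-adj S (v ◂ vs) c zero zero i≢j = ⊥-elim (i≢j refl)
  clique-adj S (v ◂ vs) c zero (suc j) i≢j =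
    proj₂ (∧-split {S (lookup vs j)} (clique-member (S ∩ adj G v) vs (proj₂ (∧-split {S v} c)) j))
  clique-adj S (v ◂ vs) c (suc i) zero i≢j = trans (adj-sym G _ v)
    (proj₂ (∧-split {S (lookup vs i)} (clique-member (S ∩ adj G v) vs (proj₂ (∧-split {S v} c)) i)))
  clique-adj S (v ◂ vs) c (suc i) (suc j) i≢j =
    clique-adj (S ∩ adj G v) vs (proj₂ (∧-split {S v} c)) i j (λ e → i≢j (cong suc e))

  -- The default clause of `top` admits vertices outside S only when S is small. A large final set,
  -- or large classes throughout, exclude this at every step, so each vertex was chosen among the
  -- common neighbours.
  chain⇒clique : ∀ {l} S (vs : Vec (Fin n) l) → chain S vs ≡ true →
    n < E * # (rest S vs) ⊎ (∀ i → n < E * dropped S vs i) → clique S vs ≡ true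
  chain⇒clique S ⟨⟩ c large = refl
  chain⇒clique S (v ◂ vs) c large with ∧-split {top S v} c
  ... | t , c′ with ∨-split {⌊ E * # S ≤? n ⌋} t
  ... | inj₁ small = ⊥-elim (<⇒≱ (big large) (E * # S ≤? n of small))
    where
    big : n < E * # (rest S (v ◂ vs)) ⊎ (∀ i → n < E * dropped S (v ◂ vs) i) → n < E * # S
    big (inj₁ p) = ≤-trans p (E ·≤ #-mono (rest⊆ S (v ◂ vs)))
    big (inj₂ p) = ≤-trans (p zero) (E ·≤ dropped≤ S (v ◂ vs) zero)
  ... | inj₂ r = ∧-intro (proj₁ (∧-split {S v} r)) (chain⇒clique (S ∩ adj G v) vs c′ (next large))
    where
    next : n < E * # (rest S (v ◂ vs)) ⊎ (∀ i → n < E * dropped S (v ◂ vs) i) →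
           n < E * # (rest (S ∩ adj G v) vs) ⊎ (∀ i → n < E * dropped (S ∩ adj G v) vs i)
    next (inj₁ p) = inj₁ p
    next (inj₂ p) = inj₂ (p ∘ suc)

  module _ (φ : ℕ → ℕ) (φ-mono : ∀ {a b} → a ≤ b → φ a ≤ φ b) where

    weight : VSet n → ℕ
    weight S = Σᵛ (λ u → ind (S u) * φ (degree G u))

    weight-≤ : ∀ S → weight S ≤ # S * φ n
    weight-≤ S = ≤-trans (Σ-mono (λ u → ind (S u) ·≤ φ-mono (#-≤ (adj G u)))) (≤-reflexive (Σ-*ʳ (φ n) (ind ∘ S)))

    weight-split : ∀ S R → weight S ≡ weight (S ∖ R) + weight (S ∩ R)
    weight-split S R = sym (trans (sym (Σ-+ (λ u → ind ((S ∖ R) u) * φ (degree G u)) (λ u → ind ((S ∩ R) u) * φ (degree G u))))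
      (Σ-cong (λ u → trans (sym (*-distribʳ-+ (φ (degree G u)) (ind ((S ∖ R) u)) (ind ((S ∩ R) u))))
        (cong (_* φ (degree G u)) (trans (+-comm (ind ((S ∖ R) u)) _) (ind-split (S u) (R u)))))))

    -- Erdős' degree majorization, up to an exceptional set of e vertices.
    majorize : ∀ {l} S (vs : Vec (Fin n) l) → chain S vs ≡ true →
      ∃ λ e → E * e ≤ l * n × weight S ≤ Σᵛ (λ i → dropped S vs i * φ (degree G (lookup vs i))) + (e + # (rest S vs)) * φ n
    majorize S ⟨⟩ c = 0 , ≤-reflexive (*-zeroʳ E) , weight-≤ S
    majorize {suc l} S (v ◂ vs) c with ∧-split {top S v} c
    ... | t , c′ with majorize (S ∩ adj G v) vs c′
    ... | e , e-small , bound = proj₁ one + e ,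
      ≤-trans (≤-reflexive (*-distribˡ-+ E (proj₁ one) e)) (proj₁ (proj₂ one) +≤ e-small) , (begin
        weight S ≡⟨ weight-split S (adj G v) ⟩
        weight (S ∖ adj G v) + weight (S ∩ adj G v) ≤⟨ proj₂ (proj₂ one) +≤ bound ⟩
        hd + proj₁ one * φ n + (tl + (e + r) * φ n) ≡⟨ eq hd (proj₁ one) (φ n) tl e r ⟩
        hd + tl + (proj₁ one + e + r) * φ n ≡⟨ cong (_+ (proj₁ one + e + r) * φ n) (Σ-suc (λ i → dropped S (v ◂ vs) i * φ (degree G (lookup (v ◂ vs) i)))) ⟨
        Σᵛ (λ i → dropped S (v ◂ vs) i * φ (degree G (lookup (v ◂ vs) i))) + (proj₁ one + e + r) * φ n ∎)
      where
      open ≤-Reasoning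
      hd = # (S ∖ adj G v) * φ (degree G v)
      tl = Σᵛ (λ i → dropped (S ∩ adj G v) vs i * φ (degree G (lookup vs i)))
      r = # (rest (S ∩ adj G v) vs)
      eq : ∀ h a f t e r → h + a * f + (t + (e + r) * f) ≡ h + t + (a + e + r) * f
      eq h a f t e r = solve (h ∷ a ∷ f ∷ t ∷ e ∷ r ∷ [])
      -- The exceptional vertices of this step: all of S if S is small, otherwise its members of
      -- larger degree than v. Either way they number at most n / E.
      one : ∃ λ a → E * a ≤ n × weight (S ∖ adj G v) ≤ hd + a * φ n
      one with ∨-split {⌊ E * # S ≤? n ⌋} t
      ... | inj₁ small = # S , (E * # S ≤? n of small) ,
        ≤-trans (≤-trans (weight-≤ (S ∖ adj G v)) (*-monoˡ-≤ (φ n) (#-mono {P = S ∖ adj G v} {S} (λ u e → proj₁ (∧-split e))))) (m≤n+m _ hd)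
      ... | inj₂ q = # X , (E * # X ≤? n of proj₂ (∧-split {S v} q)) , ≤-trans (Σ-mono term)
          (≤-reflexive (trans (Σ-+ (λ u → ind ((S ∖ adj G v) u) * φ (degree G v)) (λ u → ind (X u) * φ n))
            (cong₂ _+_ (Σ-*ʳ (φ (degree G v)) (ind ∘ (S ∖ adj G v))) (Σ-*ʳ (φ n) (ind ∘ X)))))
        where
        X = above S (suc (degree G v))
        term : ∀ u → ind ((S ∖ adj G v) u) * φ (degree G u) ≤ ind ((S ∖ adj G v) u) * φ (degree G v) + ind (X u) * φ n
        term u with suc (degree G v) ≤? degree G u
        ... | no ¬p = ≤-trans (ind ((S ∖ adj G v) u) ·≤ φ-mono (≮⇒≥ ¬p)) (m≤m+n _ _)
        ... | yes p = ≤-trans (*-mono-≤ (ind-mono {(S ∖ adj G v) u} {S u ∧ true} (λ e → ∧-intro (proj₁ (∧-split e)) refl)) (φ-mono (#-≤ (adj G u))))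
                        (m≤n+m _ (ind ((S ∖ adj G v) u) * φ (degree G v)))

-- Blocks of heavy cliques in an extremal graph

Maximal : ∀ {v n} → (ℕ → ℕ) → Graph v → Graph n → Set
Maximal {n = n} φ F G = Free F G × (∀ (H : Graph n) → Free F H → degSum φ H ≤ degSum φ G)

crossFree : ∀ {v n k} (F : Graph v) → ¬ Colorable F k → (q : Fin n → Fin k) (G : Graph n) → Free F (withCore q (λ _ → false) G)
crossFree F χ q G (f , _ , f-edge) = χ (q ∘ f , λ x y e eq →
  true≢false (f-edge x y e) (cong not (yes⇒ (q (f x) ≟ q (f y)) eq)))

cross-optimal : ∀ {v n k} (F : Graph v) → ¬ Colorable F k → ∀ φ (G : Graph n) → Maximal φ F G →
  ∀ (b : Fin k → ℕ) → Σᵛ b ≡ n → Σᵛ (λ i → b i * φ (n ∸ b i)) ≤ degSum φ G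
cross-optimal {n = n} {zero} F χ φ G max b Σb = z≤n
cross-optimal {n = n} {suc k} F χ φ G (free , max) b Σb with realize n (λ _ → false) (λ _ → zero {k}) b Σb
    (λ i → ≤-trans (≤-reflexive (Σ-0 {n} (λ _ → refl))) z≤n)
... | q , _ , sizes = ≤-trans (≤-reflexive (begin
    Σᵛ (λ i → b i * φ (n ∸ b i)) ≡⟨ Σ-cong (λ i → cong (λ s → s * φ (n ∸ s)) (sym (sizes i))) ⟩
    Σᵛ (λ i → partSize q i * φ (n ∸ partSize q i)) ≡⟨ Σ-fibres q (λ i → φ (n ∸ partSize q i)) ⟨
    Σᵛ (λ x → φ (n ∸ partSize q (q x))) ≡⟨ Σ-cong (λ x → cong φ (deg x)) ⟩
    degSum φ (withCore q (λ _ → false) G) ∎))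
  (max (withCore q (λ _ → false) G) (crossFree F χ q G))
  where
  open ≡-Reasoning
  deg : ∀ x → n ∸ partSize q (q x) ≡ degree (withCore q (λ _ → false) G) x
  deg x = trans (cong (_∸ partSize q (q x)) (sym (cross-degree q x))) (m+n∸n≡m _ (partSize q (q x)))

-- `T-gap` says that a block vertex misses at least n / Γ vertices, `T-heavy` that the a-th vertices
-- of the blocks have degree sum at least (k - 1) n - n / Δ.
record HeavyBlocks {n : ℕ} (G : Graph n) (k t Γ Δ : ℕ) : Set where
  field
    T : Fin k → Fin t → Fin n
    T-inj : ∀ i a b → T i a ≡ T i b → a ≡ b
    T-adj : ∀ i j a b → i ≢ j → adj G (T i a) (T j b) ≡ true
    T-gap : ∀ i a → Γ * degree G (T i a) + n ≤ Γ * n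
    T-heavy : ∀ a → Δ * (k * n) ≤ Δ * (Σᵛ (λ i → degree G (T i a)) + n) + n

blocks-adj : ∀ {n t k} (G : Graph n) (zs : Blocks n t k) → (∀ α → Chains.clique G 0 full (transversal zs α) ≡ true) →
  ∀ i j a b → i ≢ j → adj G (lookup (lookup zs i) a) (lookup (lookup zs j) b) ≡ true
blocks-adj G zs c i j a b i≢j = subst₂ (λ x y → adj G x y ≡ true) (at i α-i) (at j α-j)
  (Chains.clique-adj G 0 full (transversal zs α) (c α) i j i≢j)
  where
  α : Fin _ → Fin _
  α m = if ⌊ m ≟ i ⌋ then a else b
  α-i : α i ≡ a
  α-i rewrite yes⇒ (i ≟ i) refl = refl
  α-j : α j ≡ b
  α-j rewrite no⇒ (j ≟ i) (i≢j ∘ sym) = refl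
  at : ∀ m {z} → α m ≡ z → lookup (transversal zs α) m ≡ lookup (lookup zs m) z
  at m e = trans (lookup-transversal zs α m) (cong (lookup (lookup zs m)) e)

module FindBlocks (Gr : Growth) {v : ℕ} (F : Graph v) (k′ : ℕ) (χ : ¬ Colorable F (suc k′)) (colouring : Colorable F (2 + k′)) where
  open GrowthFacts Gr using (φ; φ-mono)
  open Rigidity Gr k′ using (Γ; slack; threshold; parts-large; degrees-heavy) public
  private
    k = suc k′

  blocks-embed : ∀ {n} (G : Graph n) (zs : Blocks n v (suc k)) →
    (∀ i a b → lookup (lookup zs i) a ≡ lookup (lookup zs i) b → a ≡ b) →
    (∀ α → Chains.clique G 0 full (transversal zs α) ≡ true) → F ⊆ᴳ G
  blocks-embed G zs inj c = f , f-inj , λ x y e → blocks-adj G zs c (col x) (col y) x y (proper x y e)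
    where
    col = proj₁ colouring
    proper = proj₂ colouring
    f : Fin v → Fin _
    f x = lookup (lookup zs (col x)) x
    f-inj : ∀ x y → f x ≡ f y → x ≡ y
    f-inj x y e with col x ≟ col y
    ... | yes p = inj (col y) x y (trans (cong (λ i → lookup (lookup zs i) x) (sym p)) e)
    ... | no ¬p = ⊥-elim (true≢false (blocks-adj G zs c (col x) (col y) x y ¬p)
                    (trans (cong (adj G (f x)) (sym e)) (adj-irrefl G (f x))))

  -- Densely many chains either have a large common neighbourhood or are heavy cliques. In the first
  -- case adding a common neighbour gives densely many (k + 1)-cliques, whose blow-up contains F; in
  -- the second case the blow-up is the required block.
  heavy-blocks : ∀ Δ t → ∃[ n₀ ] (∀ n → n₀ ≤ n → (G : Graph n) → Maximal φ F G → HeavyBlocks G k t Γ Δ)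
  heavy-blocks Δ t = n₀ , find
    where
    X = slack Δ
    -- Up to k n / E exceptional vertices come from `majorize` and n / E from the final common
    -- neighbourhood; together these are at most n / X.
    E = suc k * X
    E′ = orᶜ k E
    c₁ = blowupᶜ v (suc k) (commᶜ k E′)
    c₂ = blowupᶜ t k E′
    n₀ = threshold Δ + (suc (c₁ * v) + suc (c₂ * t))
    Γ<X : suc Γ ≤ X
    Γ<X = ≤-trans (≤-reflexive (+-comm 1 Γ)) (+-monoʳ-≤ Γ (≤-trans (s≤s z≤n) (m≤n+m _ (2 * Δ * k))))
    X≤E : X ≤ E
    X≤E = m≤m+n X _

    find : ∀ n → n₀ ≤ n → (G : Graph n) → Maximal φ F G → HeavyBlocks G k t Γ Δ
    find n n-large G max = conclude (many*-∨ E k big heavy (many*-mono k ≤-refl good (chain-many 1≤E k full)))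
      where
      open Chains G E
      1≤E : 1 ≤ E
      1≤E = ≤-trans (s≤s z≤n) (≤-trans Γ<X X≤E)
      n₁ : threshold Δ ≤ n
      n₁ = m+n≤o⇒m≤o (threshold Δ) n-large
      n₂ : suc (c₁ * v) ≤ n
      n₂ = m+n≤o⇒m≤o (suc (c₁ * v)) (m+n≤o⇒n≤o (threshold Δ) n-large)
      n₃ : suc (c₂ * t) ≤ n
      n₃ = m+n≤o⇒n≤o (suc (c₁ * v)) (m+n≤o⇒n≤o (threshold Δ) n-large)
      deg : ∀ {l} → Vec (Fin n) l → Fin l → ℕ
      deg vs i = degree G (lookup vs i)
      Heavy : Vec (Fin n) k → Set
      Heavy vs = (∀ i → Γ * deg vs i + n ≤ Γ * n) × Δ * (k * n) ≤ Δ * (Σᵛ (deg vs) + n) + n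
      heavy? : ∀ vs → Dec (Heavy vs)
      heavy? vs = all? (λ i → _ ≤? _) ×-dec (_ ≤? _)
      big heavy : Vec (Fin n) k → Bool
      big vs = clique full vs ∧ ⌊ n <? E * # (rest full vs) ⌋
      heavy vs = clique full vs ∧ ⌊ heavy? vs ⌋
      right : ∀ {a b} → b ≡ true → a ∨ b ≡ true
      right {true} _ = refl
      right {false} e = e

      good : ∀ vs → chain full vs ≡ true → big vs ∨ heavy vs ≡ true
      good vs c with n <? E * # (rest full vs)
      ... | yes p rewrite chain⇒clique full vs c (inj₁ p) = refl
      ... | no ¬p = right {clique full vs ∧ false} (∧-intro (chain⇒clique full vs c (inj₂ exceeds)) (yes⇒ (heavy? vs) (gap , dh)))
        where
        b d : Fin k → ℕ
        b = dropped full vs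
        d = deg vs
        l e : ℕ
        l = # (rest full vs)
        e = proj₁ (majorize φ φ-mono full vs c) + l
        maj = proj₂ (majorize φ φ-mono full vs c)
        Xe≤n : X * e ≤ n
        Xe≤n = *-cancelˡ-≤ (suc k) (arith E (suc k) X (proj₁ (majorize φ φ-mono full vs c)) l n k refl (proj₁ maj) (≮⇒≥ ¬p))
          where
          arith : ∀ E K X e l n k → E ≡ K * X → E * e ≤ k * n → E * l ≤ n → K * (X * (e + l)) ≤ suc k * n
          arith _ K X e l n k refl p q = lin 0 (p +≤ q) (solve (K ∷ X ∷ e ∷ l ∷ n ∷ k ∷ []))
        W≤ : degSum φ G ≤ Σᵛ (λ i → b i * φ (d i)) + e * φ n
        W≤ = ≤-trans (≤-reflexive (Σ-cong (λ u → sym (+-identityʳ (φ (degree G u)))))) (proj₂ maj)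
        Σb : Σᵛ b + l ≡ n
        Σb = trans (dropped-sum full vs) #-full
        optimal = cross-optimal F χ φ G max
        large : ∀ i → n ≤ Γ * b i
        large = parts-large n (degSum φ G) optimal Δ n₁ b d l e Σb (dropped+degree full vs) (m≤n+m l _) W≤ Xe≤n
        dh = degrees-heavy n (degSum φ G) optimal Δ n₁ b d l e Σb (dropped+degree full vs) (m≤n+m l _) W≤ Xe≤n
        gap : ∀ i → Γ * d i + n ≤ Γ * n
        gap i = ≤-trans (+-monoʳ-≤ (Γ * d i) (large i)) (≤-trans (≤-reflexive (trans (sym (*-distribˡ-+ Γ (d i) (b i))) (cong (Γ *_) (+-comm (d i) (b i)))))
          (Γ ·≤ dropped+degree full vs i))
        exceeds : ∀ i → n < E * b i
        exceeds i = ≤-trans (step n (b i) Γ (≤-trans (s≤s z≤n) n₃) (large i)) (*-monoˡ-≤ (b i) (≤-trans Γ<X X≤E))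
          where
          step : ∀ n b Γ → 1 ≤ n → n ≤ Γ * b → n < suc Γ * b
          step n zero Γ p q = ⊥-elim (n≮n 0 (≤-trans p (≤-trans q (≤-reflexive (*-zeroʳ Γ)))))
          step n (suc b) Γ p q = s≤s (≤-trans q (m≤n+m _ b))

      conclude : many* E′ k big ≡ true ⊎ many* E′ k heavy ≡ true → HeavyBlocks G k t Γ Δ
      conclude (inj₁ m) = ⊥-elim (proj₁ max (blocks-embed G zs inj (λ α → allT-transversal (clique full) zs all α)))
        where
        next : ∀ vs → big vs ≡ true → many E′ (λ x → clique full (x ◂ vs)) ≡ true
        next vs e = let c , r = ∧-split {clique full vs} e in
          many-mono (c≤orᶜ k E) (λ x → clique-snoc full vs x c) (many⁺ E (<⇒≤ (n <? E * # (rest full vs) of r)))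
        found = manyB-distinct c₁ (suc k) (allT (clique full)) n₂
          (blowup v (commᶜ k E′) (suc k) (clique full) (many-comm⁻ E′ k (λ x vs → clique full (x ◂ vs)) (many*-mono k ≤-refl next m)))
        zs = proj₁ found
        all = proj₁ (proj₂ found)
        inj = proj₂ (proj₂ found)
      conclude (inj₂ m) = record
        { T = λ i → lookup (lookup zs i)
        ; T-inj = proj₂ (proj₂ found)
        ; T-adj = blocks-adj G zs (λ α → proj₁ (∧-split (is-heavy α)))
        ; T-gap = λ i a → subst (λ x → Γ * degree G x + n ≤ Γ * n) (lookup-transversal zs (λ _ → a) i) (proj₁ (diag a) i)
        ; T-heavy = λ a → subst (λ s → Δ * (k * n) ≤ Δ * (s + n) + n)
            (Σ-cong (λ i → cong (degree G) (lookup-transversal zs (λ _ → a) i))) (proj₂ (diag a))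
        }
        where
        found = manyB-distinct c₂ k (allT heavy) n₃ (blowup t E′ k heavy m)
        zs = proj₁ found
        is-heavy : ∀ α → heavy (transversal zs α) ≡ true
        is-heavy α = allT-transversal heavy zs (proj₁ (proj₂ found)) α
        diag : ∀ a → Heavy (transversal zs (λ _ → a))
        diag a = heavy? (transversal zs (λ _ → a)) of proj₂ (∧-split {clique full (transversal zs (λ _ → a))} (is-heavy (λ _ → a)))

-- Replacing the neighbourhood of a vertex

module Exchange (Gr : Growth) where
  open GrowthFacts Gr

  -- A vertex keeps c neighbours, loses e and gains μ. If μ exceeded n / M, the net gain w = μ - e
  -- would be linear in n, with `φ w ≤ e * g n` while `n * g n` is at most a constant times `φ w`;
  -- so e would be linear in n.
  exchange-bound : ∀ M → ∃[ E ] ∃[ n₀ ] (∀ n → n₀ ≤ n → ∀ c μ e → φ (c + μ) ≤ φ (c + e) + e * g n → E * e ≤ n → M * μ ≤ n)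
  exchange-bound M with n*g-scaling (2 * M)
  ... | L , n₁ , sc = 2 * M + suc L , n₁ + (proj₁ positive + 1) , bound
    where
    bound : ∀ n → n₁ + (proj₁ positive + 1) ≤ n → ∀ c μ e → φ (c + μ) ≤ φ (c + e) + e * g n →
            (2 * M + suc L) * e ≤ n → M * μ ≤ n
    bound n n-large c μ e swap small with M * μ ≤? n
    ... | yes p = p
    ... | no ¬p = ⊥-elim (absurd e n L n≤eL (≤-trans (*-monoˡ-≤ e (m≤n+m (suc L) (2 * M))) small) 1≤n)
      where
      1≤n : 1 ≤ n
      1≤n = m+n≤o⇒n≤o (proj₁ positive) (m+n≤o⇒n≤o n₁ n-large)
      2Me≤n : 2 * M * e ≤ n
      2Me≤n = ≤-trans (*-monoˡ-≤ e (m≤m+n (2 * M) (suc L))) small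
      e≤μ : e ≤ μ
      e≤μ with e ≤? μ
      ... | yes q = q
      ... | no ¬q = ⊥-elim (¬p (≤-trans (M ·≤ <⇒≤ (≰⇒> ¬q)) (≤-trans (*-monoˡ-≤ e (m≤m+n M (M + 0))) 2Me≤n)))
      w = μ ∸ e
      n≤2Mw : n ≤ 2 * M * w
      n≤2Mw = arith M e w μ n (m+[n∸m]≡n e≤μ) (≰⇒> ¬p) 2Me≤n
        where
        arith : ∀ M e w μ n → e + w ≡ μ → n < M * μ → 2 * M * e ≤ n → n ≤ 2 * M * w
        arith M e w _ n refl p q = lin 2 (2 ·≤ p +≤ q) (solve (M ∷ e ∷ w ∷ n ∷ []))
      φw≤ : φ w ≤ e * g n
      φw≤ = +-cancelˡ-≤ (φ (c + e)) _ _ (≤-trans (φ-super (c + e) w) (≤-trans (≤-reflexive (cong φ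
        (trans (+-assoc c e w) (cong (c +_) (m+[n∸m]≡n e≤μ))))) swap))
      ng≤ : n * g n ≤ L * φ w
      ng≤ = sc n w (m+n≤o⇒m≤o n₁ n-large) n≤2Mw
      φw>0 : NonZero (φ w)
      φw>0 with φ w | ng≤
      ... | suc _ | _ = nonZero
      ... | zero | z = ⊥-elim (n≮n 0 (≤-trans (proj₂ positive n (m+n≤o⇒m≤o (proj₁ positive) (m+n≤o⇒n≤o n₁ n-large)))
                         (≤-trans (φ≤n*g n) (≤-trans z (≤-reflexive (*-zeroʳ L))))))
      n≤eL : n ≤ e * L
      n≤eL = *-cancelʳ-≤ n (e * L) (φ w) {{φw>0}} (begin
        n * φ w ≤⟨ n ·≤ φw≤ ⟩
        n * (e * g n) ≡⟨ eq n e (g n) ⟩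
        e * (n * g n) ≤⟨ e ·≤ ng≤ ⟩
        e * (L * φ w) ≡⟨ *-assoc e L (φ w) ⟨
        e * L * φ w ∎)
        where
        open ≤-Reasoning
        eq : ∀ n e g → n * (e * g) ≡ e * (n * g)
        eq n e g = solve (n ∷ e ∷ g ∷ [])
      absurd : ∀ e n L → n ≤ e * L → suc L * e ≤ n → 1 ≤ n → ⊥
      absurd zero n L p q r = n≮n 0 (≤-trans r p)
      absurd (suc e) n L p q r = n≮n n (≤-trans (s≤s p) (lin e q (solve (e ∷ L ∷ n ∷ []))))

  module _ {n : ℕ} (G : Graph n) (x : Fin n) (R : VSet n) (¬Rx : R x ≡ false) where

    private
      a : Fin n → Fin n → Bool
      a u w = if ⌊ u ≟ x ⌋ then R w else (if ⌊ w ≟ x ⌋ then R u else adj G u w)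

    rewire : Graph n
    rewire = record { adj = a ; adj-sym = s ; adj-irrefl = r }
      where
      s : ∀ u w → a u w ≡ a w u
      s u w with u ≟ x | w ≟ x
      ... | yes refl | yes refl = refl
      ... | yes _ | no _ = refl
      ... | no _ | yes _ = refl
      ... | no _ | no _ = adj-sym G u w
      r : ∀ u → a u u ≡ false
      r u with u ≟ x
      ... | yes refl = ¬Rx
      ... | no _ = adj-irrefl G u

    rewire-x : ∀ w → adj rewire x w ≡ R w
    rewire-x w rewrite yes⇒ (x ≟ x) refl = refl

    rewire-away : ∀ {u w} → u ≢ x → w ≢ x → adj rewire u w ≡ adj G u w
    rewire-away {u} {w} h h′ rewrite no⇒ (u ≟ x) h | no⇒ (w ≟ x) h′ = refl

    kept lost gained : VSet n
    kept u = adj G x u ∧ R u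
    lost u = adj G x u ∧ not (R u)
    gained u = R u ∧ not (adj G x u)

    degree-x : degree G x ≡ # kept + # lost
    degree-x = sym (#-split (adj G x) R)

    degree-x′ : degree rewire x ≡ # kept + # gained
    degree-x′ = trans (Σ-cong (λ w → cong ind (rewire-x w))) (trans (sym (#-split R (adj G x)))
      (cong (_+ # gained) (Σ-cong (λ u → cong ind (comm (R u) (adj G x u))))))
      where
      comm : ∀ b c → b ∧ c ≡ c ∧ b
      comm true true = refl
      comm true false = refl
      comm false true = refl
      comm false false = refl

    degree-away : ∀ u → u ≢ x → degree G u ≤ ind (lost u) + degree rewire u
    degree-away u u≢x = ≤-trans (Σ-mono term)
      (≤-reflexive (trans (Σ-+ (λ w → δ w x * ind (lost u)) (λ w → ind (adj rewire u w)))
        (cong (_+ degree rewire u) (Σ-δ (λ _ → ind (lost u)) x))))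
      where
      term : ∀ w → ind (adj G u w) ≤ δ w x * ind (lost u) + ind (adj rewire u w)
      term w with w ≟ x
      ... | no _ rewrite no⇒ (u ≟ x) u≢x = ≤-refl
      ... | yes refl rewrite no⇒ (u ≟ x) u≢x | adj-sym G u x with adj G x u | R u
      ... | true | true = ≤-refl
      ... | true | false = ≤-refl
      ... | false | _ = z≤n

    -- Every lost neighbour loses a single edge, worth at most `g n`; vertices other than x that
    -- gain an edge only help.
    rewire-cost : degSum φ rewire ≤ degSum φ G → φ (# kept + # gained) ≤ φ (# kept + # lost) + # lost * g n
    rewire-cost better = subst₂ (λ d d′ → φ d′ ≤ φ d + # lost * g n) degree-x degree-x′
      (+-cancelˡ-≤ (degSum φ G) _ _ (≤-trans (≤-reflexive (trans (cong (degSum φ G +_) (sym (Σ-δ (λ _ → φ (degree rewire x)) x)))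
          (sym (Σ-+ (λ u → φ (degree G u)) (λ u → δ u x * φ (degree rewire x))))))
        (≤-trans (Σ-mono term) (≤-trans (≤-reflexive total) (+-monoˡ-≤ _ better)))))
      where
      term : ∀ u → φ (degree G u) + δ u x * φ (degree rewire x) ≤ φ (degree rewire u) + (δ u x * φ (degree G x) + ind (lost u) * g n)
      term u = go (u ≟ x)
        where
        go : Dec (u ≡ x) → φ (degree G u) + δ u x * φ (degree rewire x) ≤ φ (degree rewire u) + (δ u x * φ (degree G x) + ind (lost u) * g n)
        go (yes refl) rewrite δ-refl x = arith (φ (degree G x)) (φ (degree rewire x)) (ind (lost x) * g n)
          where
          arith : ∀ a b c → a + (b + 0) ≤ b + (a + 0 + c)
          arith a b c = lin c (≤-refl {0}) (solve (a ∷ b ∷ c ∷ []))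
        go (no u≢x) rewrite δ-≢ u≢x | +-identityʳ (φ (degree G u)) with lost u | degree-away u u≢x
        ... | false | le = ≤-trans (φ-mono le) (m≤m+n _ _)
        ... | true | le = ≤-trans (φ-mono le) (≤-trans (≤-reflexive (φ-suc (degree rewire u)))
              (+-monoʳ-≤ (φ (degree rewire u)) (≤-trans (g-mono (#-≤ (adj rewire u))) (≤-reflexive (sym (+-identityʳ (g n)))))))
      total : Σᵛ (λ u → φ (degree rewire u) + (δ u x * φ (degree G x) + ind (lost u) * g n)) ≡ degSum φ rewire + (φ (degree G x) + # lost * g n)
      total = trans (Σ-+ (λ u → φ (degree rewire u)) (λ u → δ u x * φ (degree G x) + ind (lost u) * g n))
        (cong (degSum φ rewire +_) (trans (Σ-+ (λ u → δ u x * φ (degree G x)) (λ u → ind (lost u) * g n))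
          (cong₂ _+_ (Σ-δ (λ _ → φ (degree G x)) x) (Σ-*ʳ (g n) (ind ∘ lost)))))

-- From one complete k-partite block to the whole graph

two-terms : ∀ {k} (f : Fin k → ℕ) {i j} → i ≢ j → f i + f j ≤ Σᵛ f
two-terms f {i} {j} i≢j = ≤-trans (≤-reflexive (sym (trans (Σ-+ (λ m → δ m i * f m) (λ m → δ m j * f m)) (cong₂ _+_ (Σ-δ f i) (Σ-δ f j)))))
  (Σ-mono term)
  where
  term : ∀ m → δ m i * f m + δ m j * f m ≤ f m
  term m with m ≟ i | m ≟ j
  ... | yes p | yes q = ⊥-elim (i≢j (trans (sym p) q))
  ... | yes _ | no _ = ≤-reflexive (trans (+-identityʳ _) (+-identityʳ _))
  ... | no _ | yes _ = ≤-reflexive (+-identityʳ _)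
  ... | no _ | no _ = z≤n

record Structured {n : ℕ} (G : Graph n) (k Γ M : ℕ) : Set where
  field
    p : Fin n → Fin k
    cross-miss : ∀ x → M * # (λ y → not ⌊ p x ≟ p y ⌋ ∧ not (adj G x y)) ≤ n
    parts-large : ∀ i → n ≤ Γ * partSize p i

other-defects : ∀ a b t m v → t ≤ a + v → a + b ≤ t + m → b ≤ m + v
other-defects a b t m v p q = lin 0 (p +≤ q) (solve (a ∷ b ∷ t ∷ m ∷ v ∷ []))

defect-column : ∀ Δ k n d c → d + c ≡ k * n → Δ * (k * n) ≤ Δ * (d + n) + n → Δ * c ≤ Δ * n + n
defect-column Δ k n d c e q = lin 0 (≤-trans (≤-reflexive (cong (Δ *_) e)) q) (solve (Δ ∷ n ∷ d ∷ c ∷ []))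

bad-sparse : ∀ N Eb b m v n {s} t → t ≡ N * m → ∀ Δ → Δ ≡ 2 * N * Eb → 2 * v * Eb ≤ m → n * t + b * m ≤ s + n * v →
        Δ * s ≤ t * (Δ * n + n) → 2 * N * m * (Eb * b) ≤ 2 * N * m * n
bad-sparse N Eb b m v n {s} _ refl _ refl a p q = lin 0 ((N * n) ·≤ a +≤ (2 * N * Eb) ·≤ p +≤ q)
  (solve (N ∷ Eb ∷ b ∷ m ∷ v ∷ n ∷ s ∷ []))

block-large : ∀ N m v → 3 * v < N → v ≤ m → 1 ≤ m → v * suc (m + v) < N * m
block-large N m v p q r = lin 0 (m ·≤ p +≤ v ·≤ q +≤ suc v ·≤ r) (solve (N ∷ m ∷ v ∷ []))

class-large : ∀ m v n Γ u b N {s} t → t ≡ N * m → 8 * Γ ≤ N → m + v ≤ 2 * m → 4 * Γ * b ≤ n → t * n ≤ Γ * s →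
        s ≤ u * t + b * t + n * (m + v) → 2 * (N * m) * n ≤ 2 * (N * m) * (2 * Γ * u)
class-large m v n Γ u b N {s} _ refl p q r a c = lin 0 (4 ·≤ a +≤ (4 * Γ) ·≤ c +≤ (4 * Γ * n) ·≤ q +≤ (N * m) ·≤ r +≤ (n * m) ·≤ p)
  (solve (m ∷ v ∷ n ∷ Γ ∷ u ∷ b ∷ N ∷ s ∷ []))

combine-quarters : ∀ E b B n → 2 * E * b ≤ n → 4 * B * E ≤ n → E * (b + 2 * B) ≤ n
combine-quarters E b B n p q = *-cancelˡ-≤ 2 (lin 0 (p +≤ q) (solve (E ∷ b ∷ B ∷ n ∷ [])))

combine-halves : ∀ E b c n → 2 * E * b ≤ n → 2 * E * c ≤ n → E * (b + c) ≤ n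
combine-halves E b c n p q = *-cancelˡ-≤ 2 (lin 0 (p +≤ q) (solve (E ∷ b ∷ c ∷ n ∷ [])))

reservoir-half : ∀ E v m M n → M * m ≤ n → 4 * E * v ≤ M → 4 * E * v ≤ n → 2 * E * (v * suc m) ≤ n
reservoir-half E v m M n p q r = *-cancelˡ-≤ 2 (lin 0 (p +≤ m ·≤ q +≤ r) (solve (E ∷ v ∷ m ∷ M ∷ n ∷ [])))

halves-sum : ∀ M c f b n → c ≤ f + b → 2 * M * f ≤ n → 2 * M * b ≤ n → M * c ≤ n
halves-sum M c f b n p q r = *-cancelˡ-≤ 2 (lin 0 ((2 * M) ·≤ p +≤ q +≤ r) (solve (M ∷ c ∷ f ∷ b ∷ n ∷ [])))

-- The constants are determined in the order `M`, `E₂`, `M₁`, `E₁`, `Eb`, then `N` and `m`, then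
-- `Δ`. Rewiring is used twice: with `M₁` for good vertices, and on that basis with `2 * M` for
-- arbitrary ones. Blocks have `N * m` vertices, where `m` is the tolerated number of defects.
record BlockSetup (Gr : Growth) {v : ℕ} (F : Graph v) (k′ B : ℕ) {n : ℕ} (G : Graph n) (Γ M : ℕ) : Set where
  open GrowthFacts Gr using (φ; g)
  field
    near : ¬ ¬ NearColoring F (suc k′)
    max : Maximal φ F G
    bounded : (H : Graph n) → ¬ ContainsDecomp F (suc k′) H full → edges H ≤ B
    M₁ E₁ E₂ Eb N m Δ : ℕ
    exchange₁ : ∀ c μ e → φ (c + μ) ≤ φ (c + e) + e * g n → E₁ * e ≤ n → M₁ * μ ≤ n
    exchange₂ : ∀ c μ e → φ (c + μ) ≤ φ (c + e) + e * g n → E₂ * e ≤ n → 2 * M * μ ≤ n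
    blocks : HeavyBlocks G (suc k′) (N * m) Γ Δ
    Δ≡ : Δ ≡ 2 * N * Eb
    8Γ≤N : 8 * Γ ≤ N
    3v<N : 3 * v < N
    1≤m : 1 ≤ m
    v≤m : v ≤ m
    2vEb≤m : 2 * v * Eb ≤ m
    4Γ≤Eb : 4 * Γ ≤ Eb
    2E₁≤Eb : 2 * E₁ ≤ Eb
    2E₂≤Eb : 2 * E₂ ≤ Eb
    2M≤Eb : 2 * M ≤ Eb
    1≤M₁ : 1 ≤ M₁
    2M≤M₁ : 2 * M ≤ M₁
    4E₂v≤M₁ : 4 * E₂ * v ≤ M₁
    4BE₁≤n : 4 * B * E₁ ≤ n
    4E₂v≤n : 4 * E₂ * v ≤ n

module Classify {Gr : Growth} {v : ℕ} {F : Graph v} {k′ B : ℕ} {n : ℕ} {G : Graph n} {Γ M : ℕ}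
  (setup : BlockSetup Gr F k′ B G Γ M) where
  open BlockSetup setup
  open GrowthFacts Gr
  open Exchange Gr

  private
    k t : ℕ
    k = suc k′
    t = N * m

  open HeavyBlocks blocks

  ν : Fin n → Fin k → ℕ
  ν x i = # (λ a → not (adj G x (T i a)))

  ω : Fin k → Fin t → ℕ
  ω i a = # (λ x → not (adj G x (T i a)))

  private
    T-complete : ∀ (A : Fin k → VSet t) i j a → i ≢ j → # (λ b → A j b ∧ not (adj G (T i a) (T j b))) ≡ 0
    T-complete A i j a i≢j = Σ-0 (λ b → cong ind (¬true {A j b ∧ not (adj G (T i a) (T j b))} (λ e →
      true≢false (T-adj i j a b i≢j) (not-false (proj₂ (∧-split {A j b} e))))))

  class-exists : ∀ x → ∃ λ i → # (λ a → adj G x (T i a)) ≤ v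
  class-exists x with any? (λ i → # (λ a → adj G x (T i a)) ≤? v)
  ... | yes r = r
  ... | no ¬r = ⊥-elim (near (λ c → proj₁ max (Embeddings.apex-embed F G T A 0 T-inj
          (λ i j a _ i≢j → ≤-reflexive (T-complete A i j a i≢j))
          (λ i → ≤-trans (s≤s (≤-reflexive (*-identityʳ v))) (≰⇒> (λ le → ¬r (i , le))))
          c x (λ _ _ → id))))
    where
    A : Fin k → VSet t
    A i a = adj G x (T i a)

  p₀ : Fin n → Fin k
  p₀ x = proj₁ (class-exists x)

  -- Every vertex misses at least t - v members of its own block, so a good one misses at most m + v
  -- of any other.
  good bad : VSet n
  good x = ⌊ Σᵛ (ν x) ≤? t + m ⌋
  bad x = not (good x)

  private
    ν-own : ∀ x → t ≤ ν x (p₀ x) + v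
    ν-own x = ≤-trans (≤-reflexive (trans (sym (#-not (λ a → adj G x (T (p₀ x) a)))) (+-comm _ (ν x (p₀ x)))))
      (+-monoʳ-≤ (ν x (p₀ x)) (proj₂ (class-exists x)))

    ν-good : ∀ x → good x ≡ true → ∀ j → p₀ x ≢ j → ν x j ≤ m + v
    ν-good x gx j h = other-defects (ν x (p₀ x)) (ν x j) t m v (ν-own x)
      (≤-trans (two-terms (ν x) h) (Σᵛ (ν x) ≤? t + m of gx))

    Σν : Σᵛ (λ x → Σᵛ (ν x)) ≡ Σᵛ (λ a → Σᵛ (λ i → ω i a))
    Σν = trans (Σ-cong (λ x → Σ-swap (λ i a → ind (not (adj G x (T i a))))))
      (trans (Σ-swap (λ x a → Σᵛ (λ i → ind (not (adj G x (T i a))))))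
        (Σ-cong (λ a → Σ-swap (λ x i → ind (not (adj G x (T i a)))))))

    non-neighbours : ∀ i a → degree G (T i a) + ω i a ≡ n
    non-neighbours i a = trans (cong (degree G (T i a) +_) (Σ-cong (λ x → cong (ind ∘ not) (adj-sym G x (T i a))))) (#-not (adj G (T i a)))

    ΔΣν : Δ * Σᵛ (λ x → Σᵛ (ν x)) ≤ t * (Δ * n + n)
    ΔΣν = begin
      Δ * Σᵛ (λ x → Σᵛ (ν x)) ≡⟨ cong (Δ *_) Σν ⟩
      Δ * Σᵛ (λ a → Σᵛ (λ i → ω i a)) ≡⟨ Σ-* Δ (λ a → Σᵛ (λ i → ω i a)) ⟨
      Σᵛ (λ a → Δ * Σᵛ (λ i → ω i a)) ≤⟨ Σ-mono column ⟩
      Σᵛ {t} (λ _ → Δ * n + n) ≡⟨ Σ-const {t} (Δ * n + n) ⟩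
      t * (Δ * n + n) ∎
      where
      open ≤-Reasoning
      column : ∀ a → Δ * Σᵛ (λ i → ω i a) ≤ Δ * n + n
      column a = defect-column Δ k n (Σᵛ (λ i → degree G (T i a))) (Σᵛ (λ i → ω i a))
        (trans (sym (Σ-+ (λ i → degree G (T i a)) (λ i → ω i a))) (trans (Σ-cong (λ i → non-neighbours i a)) (Σ-const {k} n)))
        (T-heavy a)

  -- By `T-heavy` hardly more than t n pairs are missing towards the blocks. Every vertex accounts
  -- for at least t - v of them and a bad one for more than t + m.
  bad-few : Eb * # bad ≤ n
  bad-few = *-cancelˡ-≤ (2 * N * m) {{>-nonZero 2Nm>0}} (bad-sparse N Eb (# bad) m v n t refl Δ Δ≡ 2vEb≤m total ΔΣν)
    where
    2Nm>0 : 1 ≤ 2 * N * m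
    2Nm>0 = *-mono-≤ {1} {2 * N} (≤-trans (≤-trans (s≤s z≤n) 3v<N) (m≤m+n N (N + 0))) 1≤m
    total : n * t + # bad * m ≤ Σᵛ (λ x → Σᵛ (ν x)) + n * v
    total = ≤-trans (≤-reflexive (sym (trans (Σ-+ (λ _ → t) (λ x → ind (bad x) * m)) (cong₂ _+_ (Σ-const {n} t) (Σ-*ʳ m (ind ∘ bad))))))
      (≤-trans (Σ-mono term) (≤-reflexive (trans (Σ-+ (λ x → Σᵛ (ν x)) (λ _ → v)) (cong (Σᵛ (λ x → Σᵛ (ν x)) +_) (Σ-const {n} v)))))
      where
      term : ∀ x → t + ind (bad x) * m ≤ Σᵛ (ν x) + v
      term x with Σᵛ (ν x) ≤? t + m
      ... | yes _ = ≤-trans (≤-reflexive (+-identityʳ t)) (≤-trans (ν-own x) (+-monoˡ-≤ v (term≤Σ (ν x) (p₀ x))))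
      ... | no ¬q = ≤-trans (≤-reflexive (cong (t +_) (+-identityʳ m))) (≤-trans (<⇒≤ (≰⇒> ¬q)) (m≤m+n _ v))

  U : Fin k → VSet n
  U i x = good x ∧ inPart p₀ i x

  private
    T-large : ∀ (i : Fin k) → v * suc (m + v) < # {t} (λ _ → true)
    T-large i = ≤-trans (block-large N m v 3v<N v≤m 1≤m) (≤-reflexive (sym (#-full {t})))

    everything : Fin k → VSet t
    everything _ _ = true

    module ET = Embeddings F G T everything (m + v) T-inj

    T-miss : ∀ i j (a : Fin t) → true ≡ true → i ≢ j → ET.miss (T i a) j ≤ m + v
    T-miss i j a _ i≢j = ≤-trans (≤-reflexive (T-complete everything i j a i≢j)) z≤n

    U-miss : ∀ i x → U i x ≡ true → ∀ j → i ≢ j → ET.miss x j ≤ m + v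
    U-miss i x e j i≢j = ν-good x (proj₁ (∧-split e)) j (λ q → i≢j (trans (sym (p₀ x ≟ i of proj₂ (∧-split {good x} e))) q))

  -- By `T-gap` at least t n / Γ pairs are missing towards block i. Bad vertices and good vertices
  -- of other classes account for at most half, and each vertex of `U i` for at most t.
  U-large : ∀ i → n ≤ 2 * Γ * # (U i)
  U-large i = *-cancelˡ-≤ (2 * (N * m)) {{>-nonZero 2Nm>0}} (class-large m v n Γ (# (U i)) (# bad) N t refl 8Γ≤N
    (≤-trans (+-monoʳ-≤ m v≤m) (≤-reflexive (cong (m +_) (sym (+-identityʳ m)))))
    (≤-trans (*-monoˡ-≤ (# bad) 4Γ≤Eb) bad-few) gaps spread)
    where
    2Nm>0 : 1 ≤ 2 * (N * m)
    2Nm>0 = ≤-trans (*-mono-≤ (≤-trans (s≤s z≤n) 3v<N) 1≤m) (m≤m+n (N * m) _)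
    gaps : t * n ≤ Γ * Σᵛ (λ x → ν x i)
    gaps = begin
      t * n ≡⟨ Σ-const {t} n ⟨
      Σᵛ {t} (λ _ → n) ≤⟨ Σ-mono gap ⟩
      Σᵛ (λ a → Γ * ω i a) ≡⟨ Σ-* Γ (λ a → ω i a) ⟩
      Γ * Σᵛ (λ a → ω i a) ≡⟨ cong (Γ *_) (Σ-swap (λ a x → ind (not (adj G x (T i a))))) ⟩
      Γ * Σᵛ (λ x → ν x i) ∎
      where
      open ≤-Reasoning
      gap : ∀ a → n ≤ Γ * ω i a
      gap a = +-cancelˡ-≤ (Γ * degree G (T i a)) _ _ (≤-trans (T-gap i a) (≤-reflexive
        (trans (cong (Γ *_) (sym (non-neighbours i a))) (*-distribˡ-+ Γ (degree G (T i a)) _))))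
    spread : Σᵛ (λ x → ν x i) ≤ # (U i) * t + # bad * t + n * (m + v)
    spread = ≤-trans (Σ-mono term) (≤-reflexive (trans (Σ-+ (λ x → ind (U i x) * t + ind (bad x) * t) (λ _ → m + v))
      (cong₂ _+_ (trans (Σ-+ (λ x → ind (U i x) * t) (λ x → ind (bad x) * t)) (cong₂ _+_ (Σ-*ʳ t (ind ∘ U i)) (Σ-*ʳ t (ind ∘ bad)))) (Σ-const {n} (m + v)))))
      where
      term : ∀ x → ν x i ≤ ind (U i x) * t + ind (bad x) * t + (m + v)
      term x with bool-case (good x)
      ... | inj₂ b rewrite b = ≤-trans (#-≤ (λ a → not (adj G x (T i a)))) (≤-trans (≤-reflexive (sym (+-identityʳ t))) (m≤m+n _ (m + v)))
      ... | inj₁ gx with p₀ x ≟ i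
      ... | yes e rewrite gx = ≤-trans (#-≤ (λ a → not (adj G x (T i a)))) (≤-trans (≤-trans (≤-reflexive (sym (+-identityʳ t))) (m≤m+n _ 0)) (m≤m+n _ (m + v)))
      ... | no h = ≤-trans (ν-good x gx i h) (m≤n+m (m + v) (ind (good x ∧ false) * t + ind (bad x) * t))

  -- Vertices of `U i` miss few members of the other blocks, so a member of the decomposition family
  -- inside `U i` would extend through the blocks to a copy of F.
  U-edges : ∀ i → edges (inside G (U i)) ≤ B
  U-edges i = bounded (inside G (U i)) λ (col , proper , a , b , a≢b , f , _ , f-inj , f-edge) →
    proj₁ max (ET.decomp-embed T-miss T-large refl col proper a b a≢b f i f-inj (λ x y ux uy e →
      let Ux , e′ = ∧-split {U i (f x)} (f-edge x y ux uy e)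
      in proj₂ (∧-split {U i (f y)} e′) , U-miss i (f x) Ux))

  U-degree : ∀ i x → U i x ≡ true → # (λ y → U i y ∧ adj G x y) ≤ 2 * B
  U-degree i x Ux = begin
    # (λ y → U i y ∧ adj G x y) ≡⟨ Σ-cong (λ y → cong (λ u → ind (u ∧ (U i y ∧ adj G x y))) (sym Ux)) ⟩
    degree (inside G (U i)) x ≤⟨ term≤Σ (degree (inside G (U i))) x ⟩
    Σᵛ (degree (inside G (U i))) ≡⟨ 2*edges (inside G (U i)) ⟨
    2 * edges (inside G (U i)) ≤⟨ 2 ·≤ U-edges i ⟩
    2 * B ∎
    where open ≤-Reasoning

  fresh : Fin n → Fin k → VSet n
  fresh x i y = (good y ∧ not ⌊ p₀ y ≟ i ⌋) ∧ not ⌊ y ≟ x ⌋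

  fresh-x : ∀ x i → fresh x i x ≡ false
  fresh-x x i = ¬true (λ e → true≢false (yes⇒ (x ≟ x) refl) (not-false (proj₂ (∧-split {good x ∧ not ⌊ p₀ x ≟ i ⌋} e))))

  twinned : Fin n → Fin k → Graph n
  twinned x i = rewire G x (fresh x i) (fresh-x x i)

  -- The new neighbourhood of x is that of a twin of the i-th block.
  rewire-free : ∀ x i → Free F (twinned x i)
  rewire-free x i (f , f-inj , f-edge) with any? (λ z → f z ≟ x)
  ... | no none = proj₁ max (f , f-inj , λ y w e →
    trans (sym (rewire-away G x (fresh x i) (fresh-x x i) (λ q → none (y , q)) (λ q → none (w , q)))) (f-edge y w e))
  ... | yes (z , fz) = proj₁ max (Greedy.greedy F G c T everything (m + v) T-inj T-miss T-large {λ y → not ⌊ y ≟ z ⌋} {f} (record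
    { inj = λ y w _ _ → f-inj y w
    ; edge = λ y w py pw e → trans (sym (rewire-away G x (fresh x i) (fresh-x x i) (away y py) (away w pw))) (f-edge y w e)
    ; bound = bound
    ; cross = λ y w py pw e _ → true≢false e (subst₂ (λ s u → adj F s u ≡ false) (sym (is-z y py)) (sym (is-z w pw)) (adj-irrefl F z))
    }))
    where
    c : Fin v → Fin k
    c y = if ⌊ y ≟ z ⌋ then i else p₀ (f y)
    c-z : c z ≡ i
    c-z rewrite yes⇒ (z ≟ z) refl = refl
    is-z : ∀ y → not ⌊ y ≟ z ⌋ ≡ false → y ≡ z
    is-z y e with y ≟ z
    ... | yes p = p
    away : ∀ y → not ⌊ y ≟ z ⌋ ≡ true → f y ≢ x
    away y py q = false⇒ (y ≟ z) (not-false py) (f-inj y z (trans q (sym fz)))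
    bound : ∀ y w → not ⌊ y ≟ z ⌋ ≡ true → not ⌊ w ≟ z ⌋ ≡ false → adj F y w ≡ true → ET.miss (f y) (c w) ≤ m + v
    bound y w py pw e with is-z w pw
    ... | refl rewrite c-z =
      let gy , ¬i = ∧-split {good (f y)} (proj₁ (∧-split (trans (sym (rewire-x G x (fresh x i) (fresh-x x i) (f y)))
            (trans (adj-sym (twinned x i) x (f y)) (subst (λ u → adj (twinned x i) (f y) u ≡ true) fz (f-edge y z e))))))
      in ν-good (f y) gy i (false⇒ (p₀ (f y) ≟ i) (not-false ¬i))

  private
    keep lose far close : Fin n → Fin k → VSet n
    keep x i = kept G x (fresh x i) (fresh-x x i)
    lose x i = lost G x (fresh x i) (fresh-x x i)
    far x i = gained G x (fresh x i) (fresh-x x i)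
    close x i y = U i y ∧ adj G x y

    cost : ∀ x i → φ (# (keep x i) + # (far x i)) ≤
                   φ (# (keep x i) + # (lose x i)) + # (lose x i) * g n
    cost x i = rewire-cost G x (fresh x i) (fresh-x x i) (proj₂ max (twinned x i) (rewire-free x i))

    lost-few : ∀ x i → # (lose x i) ≤ # bad + # (close x i)
    lost-few x i = ≤-trans (Σ-mono term) (≤-reflexive (Σ-+ (ind ∘ bad) (ind ∘ close x i)))
      where
      term : ∀ u → ind (lose x i u) ≤ ind (bad u) + ind (close x i u)
      term u with u ≟ x
      ... | yes refl rewrite adj-irrefl G x = z≤n
      ... | no _ with good u | ⌊ p₀ u ≟ i ⌋ | adj G x u
      ... | false | _ | a = ≤-trans (ind≤1 _) (m≤m+n 1 _)
      ... | true | true | true = ≤-refl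
      ... | true | true | false = z≤n
      ... | true | false | true = z≤n
      ... | true | false | false = z≤n

  -- Rewiring x as a twin of its own class loses only bad vertices and at most `2 * B` neighbours
  -- inside the class, so maximality bounds what would be gained.
  far-good : ∀ x → good x ≡ true → M₁ * # (far x (p₀ x)) ≤ n
  far-good x gx = exchange₁ _ _ _ (cost x (p₀ x)) (≤-trans (E₁ ·≤ ≤-trans (lost-few x (p₀ x)) (+-monoʳ-≤ (# bad) (U-degree (p₀ x) x (∧-intro gx (yes⇒ (p₀ x ≟ p₀ x) refl)))))
    (combine-quarters E₁ (# bad) B n (≤-trans (*-monoˡ-≤ (# bad) 2E₁≤Eb) bad-few) 4BE₁≤n))

  far-close : ∀ x i → 2 * E₂ * # (close x i) ≤ n → 2 * M * # (far x i) ≤ n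
  far-close x i small = exchange₂ _ _ _ (cost x i) (≤-trans (E₂ ·≤ lost-few x i)
    (combine-halves E₂ (# bad) (# (close x i)) n (≤-trans (*-monoˡ-≤ (# bad) 2E₂≤Eb) bad-few) small))

  -- Otherwise the neighbourhoods of x in the classes `U i` are large reservoirs, nearly completely
  -- joined to each other by `far-good`, and F embeds with x as the apex.
  close-few : ∀ x → ∃ λ i → 2 * E₂ * # (close x i) ≤ n
  close-few x with any? (λ i → 2 * E₂ * # (close x i) ≤? n)
  ... | yes r = r
  ... | no ¬r = ⊥-elim (near (λ c → proj₁ max (Embeddings.apex-embed F G (λ _ → id) (close x) m′ (λ _ _ _ → id) misses sizes c x
                  (λ j y e → proj₂ (∧-split {U j y} e)))))
    where
    instance
      M₁≢0 : NonZero M₁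
      M₁≢0 = >-nonZero 1≤M₁
    m′ : ℕ
    m′ = n / M₁
    sizes : ∀ i → v * suc m′ < # (close x i)
    sizes i = *-cancelˡ-< (2 * E₂) _ _ (≤-trans (s≤s (reservoir-half E₂ v m′ M₁ n (≤-trans (≤-reflexive (*-comm M₁ m′)) (m/n*n≤m n M₁)) 4E₂v≤M₁ 4E₂v≤n)) (≰⇒> (λ le → ¬r (i , le))))
    misses : ∀ i j y → close x i y ≡ true → i ≢ j → # (λ a → close x j a ∧ not (adj G y a)) ≤ m′
    misses i j y e i≢j = ≤-trans (#-mono step) (≤-quotient M₁ (far-good y gy))
      where
      gy = proj₁ (∧-split {good y} (proj₁ (∧-split {U i y} e)))
      py : p₀ y ≡ i
      py = p₀ y ≟ i of proj₂ (∧-split {good y} (proj₁ (∧-split {U i y} e)))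
      step : ∀ a → close x j a ∧ not (adj G y a) ≡ true → far y (p₀ y) a ≡ true
      step a e′ =
        let c , ¬ya = ∧-split {close x j a} e′
            ga , pa = ∧-split {good a} (proj₁ (∧-split {U j a} c))
            pa≢ = λ q → i≢j (trans (trans (sym py) (sym q)) (p₀ a ≟ j of pa))
        in ∧-intro (∧-intro (∧-intro ga (not-true (no⇒ (p₀ a ≟ p₀ y) pa≢)))
             (not-true (no⇒ (a ≟ y) (λ q → pa≢ (cong p₀ q))))) ¬ya

  home : ∀ x → ∃ λ i → 2 * M * # (far x i) ≤ n × (good x ≡ true → p₀ x ≡ i)
  home x with bool-case (good x)
  ... | inj₁ gx = p₀ x , ≤-trans (*-monoˡ-≤ _ 2M≤M₁) (far-good x gx) , λ _ → refl
  ... | inj₂ bx = proj₁ (close-few x) , far-close x _ (proj₂ (close-few x)) , λ gx → ⊥-elim (true≢false gx bx)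

  structured : Structured G k (2 * Γ) M
  structured = record { p = p ; cross-miss = cross-miss ; parts-large = λ i →
      ≤-trans (U-large i) (2 * Γ ·≤ #-mono {P = U i} {inPart p i} (λ y e →
        let gy , py = ∧-split {good y} e in yes⇒ (p y ≟ i) (trans (sym (proj₂ (proj₂ (home y)) gy)) (p₀ y ≟ i of py)))) }
    where
    p : Fin n → Fin k
    p x = proj₁ (home x)
    cross-miss : ∀ x → M * # (λ y → not ⌊ p x ≟ p y ⌋ ∧ not (adj G x y)) ≤ n
    cross-miss x = halves-sum M _ (# (far x (p x))) (# bad) n (≤-trans (Σ-mono term) (≤-reflexive (Σ-+ (ind ∘ far x (p x)) (ind ∘ bad))))
      (proj₁ (proj₂ (home x))) (≤-trans (*-monoˡ-≤ (# bad) 2M≤Eb) bad-few)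
      where
      term : ∀ y → ind (not ⌊ p x ≟ p y ⌋ ∧ not (adj G x y)) ≤ ind (far x (p x) y) + ind (bad y)
      term y = go (bool-case (good y))
        where
        go : good y ≡ true ⊎ good y ≡ false → ind (not ⌊ p x ≟ p y ⌋ ∧ not (adj G x y)) ≤ ind (far x (p x) y) + ind (bad y)
        go (inj₂ b) = ≤-trans (ind≤1 (not ⌊ p x ≟ p y ⌋ ∧ not (adj G x y))) (≤-trans (≤-reflexive (sym (cong (ind ∘ not) b))) (m≤n+m (ind (bad y)) _))
        go (inj₁ gy) = ≤-trans (ind-mono {not ⌊ p x ≟ p y ⌋ ∧ not (adj G x y)} {far x (p x) y} (λ e →
          let ne , na = ∧-split {not ⌊ p x ≟ p y ⌋} e
              px≢py = false⇒ (p x ≟ p y) (not-false ne)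
              py≡ = proj₂ (proj₂ (home y)) gy
          in ∧-intro (∧-intro (∧-intro gy (not-true (no⇒ (p₀ y ≟ p x) (λ q → px≢py (trans (sym q) py≡)))))
               (not-true (no⇒ (y ≟ x) (λ q → px≢py (cong p (sym q)))))) na)) (m≤m+n _ _)

-- Exhaustive search

-- Predicates must respect the relation because functions on `Fin n` are enumerated only up to
-- pointwise equality. The search is needed to exhibit an F-free graph with ex(n,F) edges.
Searchable : (A : Set) → (A → A → Set) → Set₁
Searchable A _≈_ = (P : A → Set) → (∀ a b → a ≈ b → P a → P b) → (∀ a → Dec (P a)) → Dec (∃ P)

search-Bool : Searchable Bool _≡_
search-Bool P _ P? with P? true | P? false
... | yes p | _ = yes (true , p)
... | no _ | yes p = yes (false , p)
... | no ¬p | no ¬q = no λ { (true , p) → ¬p p ; (false , q) → ¬q q }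

search-Fin : ∀ {n} → Searchable (Fin n) _≡_
search-Fin P _ P? = any? P?

search-fun : ∀ {A : Set} {_≈_ : A → A → Set} → (∀ a → a ≈ a) → Searchable A _≈_ →
             ∀ m → Searchable (Fin m → A) (λ f g → ∀ i → f i ≈ g i)
search-fun {A} ≈-refl s zero P resp P? = map′ (λ p → none , p) (λ (f , p) → resp f none (λ ()) p) (P? none)
  where
  none : Fin 0 → A
  none ()
search-fun {A} {_≈_} ≈-refl s (suc m) P resp P? = map′ (λ (a , f , p) → cons a f , p)
  (λ (f , p) → f zero , f ∘ suc , resp f (cons (f zero) (f ∘ suc)) (λ { zero → ≈-refl _ ; (suc i) → ≈-refl _ }) p)
  (s (λ a → ∃ λ f → P (cons a f))
    (λ a b a≈b (f , p) → f , resp (cons a f) (cons b f) (λ { zero → a≈b ; (suc i) → ≈-refl _ }) p)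
    (λ a → search-fun ≈-refl s m (λ f → P (cons a f))
      (λ f h f≈h → resp (cons a f) (cons a h) (λ { zero → ≈-refl _ ; (suc i) → f≈h i }))
      (λ f → P? (cons a f))))
  where
  cons : A → (Fin m → A) → Fin (suc m) → A
  cons a f zero = a
  cons a f (suc i) = f i

_⊆ᴳ?_ : ∀ {m n} (F : Graph m) (G : Graph n) → Dec (F ⊆ᴳ G)
_⊆ᴳ?_ {m} F G = search-fun {_≈_ = _≡_} (λ _ → refl) search-Fin m _
  (λ f h e (inj , edge) →
    (λ x y q → inj x y (trans (e x) (trans q (sym (e y))))) ,
    (λ x y a → subst₂ (λ s t → adj G s t ≡ true) (e x) (e y) (edge x y a)))
  (λ f → all? (λ x → all? (λ y → (f x ≟ f y) →-dec (x ≟ y))) ×-dec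
         all? (λ x → all? (λ y → (adj F x y ≟ᵇ true) →-dec (adj G (f x) (f y) ≟ᵇ true))))

free-larger? : ∀ {v} (F : Graph v) n e → Dec (∃ λ (H : Graph n) → Free F H × e ≤ edges H)
free-larger? F n e = map′ (λ (a , s , r , q) → graph a s r , q) (λ (H , q) → adj H , adj-sym H , adj-irrefl H , q)
  (search-fun {_≈_ = λ f g → ∀ i → f i ≡ g i} (λ _ _ → refl) (search-fun (λ _ → refl) search-Bool n) n P resp P?)
  where
  Sym Irr : (Fin n → Fin n → Bool) → Set
  Sym a = ∀ i j → a i j ≡ a j i
  Irr a = ∀ i → a i i ≡ false
  graph : ∀ a → Sym a → Irr a → Graph n
  graph a s r = record { adj = a ; adj-sym = s ; adj-irrefl = r }
  P : (Fin n → Fin n → Bool) → Set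
  P a = Σ (Sym a) λ s → Σ (Irr a) λ r → Free F (graph a s r) × e ≤ edges (graph a s r)
  resp : ∀ a b → (∀ i j → a i j ≡ b i j) → P a → P b
  resp a b h (s , r , free , le) = s′ , r′ ,
    (λ (f , inj , edge) → free (f , inj , λ x y q → trans (h (f x) (f y)) (edge x y q))) ,
    ≤-trans le (≤-reflexive (Σ-cong (λ i → Σ-cong (λ j → cong (λ z → ind ((toℕ i <ᵇ toℕ j) ∧ z)) (h i j)))))
    where
    s′ : Sym b
    s′ i j = trans (sym (h i j)) (trans (s i j) (h j i))
    r′ : Irr b
    r′ i = trans (sym (h i i)) (r i)
  P? : ∀ a → Dec (P a)
  P? a with all? (λ i → all? (λ j → a i j ≟ᵇ a j i)) | all? (λ i → a i i ≟ᵇ false)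
  ... | no ¬s | _ = no (λ (s , _) → ¬s s)
  ... | yes _ | no ¬r = no (λ (_ , r , _) → ¬r r)
  ... | yes s | yes r = map′ (λ q → s , r , q) (λ (_ , _ , q) → q) (¬? (F ⊆ᴳ? graph a s r) ×-dec (e ≤? edges (graph a s r)))

edges≤n² : ∀ {n} (G : Graph n) → edges G ≤ n * n
edges≤n² {n} G = ≤-trans (m≤m+n (edges G) (edges G + 0)) (≤-trans (≤-reflexive (2*edges G))
  (≤-trans (Σ-mono (λ x → #-≤ (adj G x))) (≤-reflexive (Σ-const {n} n))))

edge-maximizer : ∀ {v n} (F : Graph v) (G : Graph n) → Free F G → ∃ λ (H : Graph n) → MaximizesAmongFree F edges H
edge-maximizer {n = n} F G free = climb (n * n) G free (m≤n+m (n * n) (edges G))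
  where
  climb : ∀ d (H : Graph n) → Free F H → n * n ≤ edges H + d → ∃ λ (H : Graph n) → MaximizesAmongFree F edges H
  climb zero H fr p = H , fr , λ H′ _ → ≤-trans (edges≤n² H′) (≤-trans p (≤-reflexive (+-identityʳ _)))
  climb (suc d) H fr p with free-larger? F n (suc (edges H))
  ... | no ¬q = H , fr , λ H′ fr′ → ≮⇒≥ (λ lt → ¬q (H′ , fr′ , lt))
  ... | yes (H′ , fr′ , lt) = climb d H′ fr′ (≤-trans p (≤-trans (≤-reflexive (+-suc (edges H) d)) (+-monoˡ-≤ d lt)))

-- The part of a copy of F inside Q is kept, and the rest is embedded afresh.
transfer : ∀ {v n k} (F : Graph v) (G₁ G₂ : Graph n) (p₁ p₂ : Fin n → Fin k) (Q : VSet n) m →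
  (∀ x y → adj G₁ x y ≡ true → Q x ∧ Q y ≡ false → p₁ x ≢ p₁ y) →
  (∀ x → Q x ≡ true → p₂ x ≡ p₁ x) →
  (∀ x y → Q x ≡ true → Q y ≡ true → adj G₁ x y ≡ true → adj G₂ x y ≡ true) →
  (∀ y j → p₂ y ≢ j → # (λ a → inPart p₂ j a ∧ not (adj G₂ y a)) ≤ m) →
  (∀ i → v * suc m < partSize p₂ i) → F ⊆ᴳ G₁ → F ⊆ᴳ G₂
transfer F G₁ G₂ p₁ p₂ Q m out same keep miss large (f , f-inj , f-edge) =
  Greedy.greedy F G₂ (p₁ ∘ f) (λ _ → id) (inPart p₂) m (λ _ _ _ → id)
    (λ i j a e i≢j → miss a j (λ q → i≢j (trans (sym (p₂ a ≟ i of e)) q))) large {Q ∘ f} {f} (record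
    { inj = λ x y _ _ → f-inj x y
    ; edge = λ x y Qx Qy e → keep (f x) (f y) Qx Qy (f-edge x y e)
    ; bound = λ x y Qx ¬Qy e → miss (f x) (p₁ (f y)) (λ q → out (f x) (f y) (f-edge x y e) (right {Q (f x)} ¬Qy) (trans (sym (same (f x) Qx)) q))
    ; cross = λ x y ¬Qx _ e → out (f x) (f y) (f-edge x y e) (cong (_∧ Q (f y)) ¬Qx)
    })
  where
  right : ∀ {a b} → b ≡ false → a ∧ b ≡ false
  right {true} e = e
  right {false} _ = refl

-- Comparison with the extremal structures

argmax : ∀ {k} (f : Fin (suc k) → ℕ) → ∃ λ i → ∀ j → f j ≤ f i
argmax {zero} f = zero , λ { zero → ≤-refl }
argmax {suc k} f with argmax (f ∘ suc)
... | i , h with ≤-total (f zero) (f (suc i))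
... | inj₁ p = suc i , λ { zero → p ; (suc j) → h j }
... | inj₂ p = zero , λ { zero → ≤-refl ; (suc j) → ≤-trans (h j) p }

count-below : ∀ S a → a ≤ S → # {S} (λ s → toℕ s <ᵇ a) ≡ a
count-below zero zero _ = refl
count-below (suc S) zero _ = Σ-0 {suc S} (λ _ → refl)
count-below (suc S) (suc a) (s≤s p) = trans (Σ-suc {S} (λ s → ind (toℕ s <ᵇ suc a))) (cong suc (count-below S a p))

cross-pairs : ∀ {n k} (q : Fin n → Fin k) → pairs (λ x y → not ⌊ q x ≟ q y ⌋) + Σᵛ (λ i → partSize q i * partSize q i) ≡ n * n
cross-pairs {n} q = begin
  pairs cross + Σᵛ (λ i → partSize q i * partSize q i) ≡⟨ cong (pairs cross +_) (Σ-fibres q (partSize q)) ⟨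
  pairs cross + Σᵛ (λ x → partSize q (q x)) ≡⟨ Σ-+ (λ x → # (cross x)) (λ x → partSize q (q x)) ⟨
  Σᵛ (λ x → # (cross x) + partSize q (q x)) ≡⟨ Σ-cong (cross-degree q) ⟩
  Σᵛ {n} (λ _ → n) ≡⟨ Σ-const {n} n ⟩
  n * n ∎
  where
  open ≡-Reasoning
  cross : Fin n → Fin n → Bool
  cross x y = not ⌊ q x ≟ q y ⌋

surjective⇒injective : ∀ {k} (σ : Fin k → Fin k) → (∀ a → ∃ λ i → σ i ≡ a) → ∀ i j → σ i ≡ σ j → i ≡ j
surjective⇒injective {k} σ onto i j e = trans (sym (proj₂ (τ-onto i))) (trans (cong τ (trans (sym (σ-τ⁻¹ i)) (trans e (σ-τ⁻¹ j)))) (proj₂ (τ-onto j)))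
  where
  τ : Fin k → Fin k
  τ a = proj₁ (onto a)
  σ∘τ : ∀ a → σ (τ a) ≡ a
  σ∘τ a = proj₂ (onto a)
  τ-inj : ∀ {a b} → τ a ≡ τ b → a ≡ b
  τ-inj {a} {b} q = trans (sym (σ∘τ a)) (trans (cong σ q) (σ∘τ b))
  τ-onto : ∀ i → ∃ λ a → τ a ≡ i
  τ-onto i with any? (λ a → τ a ≟ i)
  ... | yes r = r
  ... | no ¬r = ⊥-elim (n≮n k (injective⇒≤ {f = f} f-inj))
    where
    f : Fin (suc k) → Fin k
    f zero = i
    f (suc a) = τ a
    f-inj : ∀ {a b} → f a ≡ f b → a ≡ b
    f-inj {zero} {zero} _ = refl
    f-inj {zero} {suc b} q = ⊥-elim (¬r (b , sym q))
    f-inj {suc a} {zero} q = ⊥-elim (¬r (a , q))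
    f-inj {suc a} {suc b} q = cong suc (τ-inj q)
  σ-τ⁻¹ : ∀ i → σ i ≡ proj₁ (τ-onto i)
  σ-τ⁻¹ i = trans (cong σ (sym (proj₂ (τ-onto i)))) (σ∘τ _)

balanced-large : ∀ {n} k′ w (q : Fin n → Fin (suc k′)) → suc k′ * (2 + w) < n →
  (∀ i j → partSize q i ≤ suc (partSize q j)) → ∀ i → w < partSize q i
balanced-large {n} k′ w q n-large bal i = *-cancelˡ-< (suc k′) _ _ (arith k′ w (partSize q i) n n-large
  (≤-trans (≤-reflexive (sym (Σ-partSize q))) (≤-trans (Σ-mono (λ j → bal j i)) (≤-reflexive (Σ-const {suc k′} (suc (partSize q i)))))))
  where
  arith : ∀ k′ w s n → suc k′ * (2 + w) < n → n ≤ suc k′ * suc s → suc k′ * w < suc k′ * s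
  arith k′ w s n a c = lin (suc k′) (a +≤ c) (solve (k′ ∷ w ∷ s ∷ n ∷ []))

-- With s for "same part" and a for "adjacent": edges plus missing cross pairs equal cross pairs
-- plus inner edges. Degrees and edge numbers are both computed from this identity.
swap₂ : ∀ s a → ind a + ind (not s ∧ not a) ≡ ind (not s) + ind (s ∧ a)
swap₂ true true = refl
swap₂ true false = refl
swap₂ false true = refl
swap₂ false false = refl

-- `K` bounds the ordered adjacent pairs inside parts, hence the size of the core and every change
-- of a degree. `curvature` makes the total linearization error smaller than the weight of any
-- single pair.
record Comparison (Gr : Growth) {v : ℕ} (F : Graph v) (k′ B : ℕ) {n : ℕ} (G : Graph n) : Set where
  open GrowthFacts Gr using (φ; g; h)
  field
    max : Maximal φ F G
    bounded : (H : Graph n) → ¬ ContainsDecomp F (suc k′) H full → edges H ≤ B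
    turan : (H : Graph n) → MaximizesAmongFree F edges H → TuranPlusD F (suc k′) H
    G₀ : Graph n
    max₀ : MaximizesAmongFree F edges G₀
    p₀ : Fin n → Fin (suc k′)
    bal₀ : ∀ a b → partSize p₀ a ≤ suc (partSize p₀ b)
    a₀ : Fin (suc k′)
    PD₀ : PartitePlusD F (suc k′) G₀ p₀ a₀
    p : Fin n → Fin (suc k′)
    m K : ℕ
    miss : ∀ y j → p y ≢ j → # (λ a → inPart p j a ∧ not (adj G y a)) ≤ m
    large : ∀ i → v * suc m < partSize p i
    K≡ : K ≡ suc k′ * (2 * B)
    K<part : ∀ i → K < partSize p i
    n-large : suc k′ * (2 + (K + v)) < n
    g-degree : ∀ x → 1 ≤ g (degree G x)
    K≤D : ∀ i → K ≤ n ∸ partSize p i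
    curvature : ∀ i → K * (2 * K * h (n + K)) < g (n ∸ partSize p i ∸ K)

module Final {Gr : Growth} {v : ℕ} {F : Graph v} {k′ B : ℕ} {n : ℕ} {G : Graph n} (comparison : Comparison Gr F k′ B G) where
  open Comparison comparison
  open GrowthFacts Gr

  private
    k : ℕ
    k = suc k′

  ins mis : Fin n → Fin n → Bool
  ins x y = ⌊ p x ≟ p y ⌋ ∧ adj G x y
  mis x y = not ⌊ p x ≟ p y ⌋ ∧ not (adj G x y)

  private
    module EG = Embeddings {v} {n} {k} {n} F G (λ _ → id) (inPart p) m (λ _ _ _ → id)

    EG-miss : ∀ i j a → inPart p i a ≡ true → i ≢ j → EG.miss a j ≤ m
    EG-miss i j a e i≢j = miss a j (λ q → i≢j (trans (sym (p a ≟ i of e)) q))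

  part-edges : ∀ i → edges (inside G (inPart p i)) ≤ B
  part-edges i = bounded (inside G (inPart p i)) λ (col , proper , a , b , a≢b , f , _ , f-inj , f-edge) →
    proj₁ max (EG.decomp-embed EG-miss large refl col proper a b a≢b f i f-inj (λ x y ux uy e →
      let Px , e′ = ∧-split {inPart p i (f x)} (f-edge x y ux uy e)
      in proj₂ (∧-split {inPart p i (f y)} e′) , λ j i≢j → EG-miss i j (f x) Px i≢j))

  part-decomp-free : ∀ i → ¬ ContainsDecomp F k G (inPart p i)
  part-decomp-free i (col , proper , a , b , a≢b , f , f-in , f-inj , f-edge) =
    proj₁ max (EG.decomp-embed EG-miss large refl col proper a b a≢b f i f-inj (λ x y ux uy e →
      f-edge x y ux uy e , λ j i≢j → EG-miss i j (f x) (f-in x ux) i≢j))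

  ins-total : pairs ins ≤ K
  ins-total = begin
    pairs ins ≤⟨ Σ-mono (λ x → Σ-mono (λ y → term x y)) ⟩
    Σᵛ (λ x → Σᵛ (λ y → Σᵛ (λ i → ind (part i x y)))) ≡⟨ Σ-cong (λ x → Σ-swap (λ y i → ind (part i x y))) ⟩
    Σᵛ (λ x → Σᵛ (λ i → # (part i x))) ≡⟨ Σ-swap (λ x i → # (part i x)) ⟩
    Σᵛ (λ i → pairs (part i)) ≡⟨ Σ-cong (λ i → sym (2*edges (inside G (inPart p i)))) ⟩
    Σᵛ (λ i → 2 * edges (inside G (inPart p i))) ≤⟨ Σ-mono (λ i → 2 ·≤ part-edges i) ⟩
    Σᵛ {k} (λ _ → 2 * B) ≡⟨ Σ-const {k} (2 * B) ⟩
    k * (2 * B) ≡⟨ K≡ ⟨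
    K ∎
    where
    open ≤-Reasoning
    part : Fin k → Fin n → Fin n → Bool
    part i = adj (inside G (inPart p i))
    term : ∀ x y → ind (ins x y) ≤ Σᵛ (λ i → ind (part i x y))
    term x y = ≤-trans (ind-mono {ins x y} {part (p x) x y} (λ e → let s , a = ∧-split {⌊ p x ≟ p y ⌋} e
      in ∧-intro (yes⇒ (p x ≟ p x) refl) (∧-intro (yes⇒ (p y ≟ p x) (sym (p x ≟ p y of s))) a))) (term≤Σ (λ i → ind (part i x y)) (p x))

  Q : VSet n
  Q x = ⌊ 1 ≤? # (ins x) ⌋

  #Q≤K : # Q ≤ K
  #Q≤K = ≤-trans (Σ-mono term) ins-total
    where
    term : ∀ x → ind (Q x) ≤ # (ins x)
    term x with 1 ≤? # (ins x)
    ... | yes q = q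
    ... | no _ = z≤n

  ins-sym : ∀ x y → ins x y ≡ true → ins y x ≡ true
  ins-sym x y e = let s , a = ∧-split {⌊ p x ≟ p y ⌋} e in
    ∧-intro (yes⇒ (p y ≟ p x) (sym (p x ≟ p y of s))) (trans (adj-sym G y x) a)

  ins⇒Qˡ : ∀ x y → ins x y ≡ true → Q x ≡ true
  ins⇒Qˡ x y e = yes⇒ (1 ≤? # (ins x)) (≤-trans (≤-reflexive (sym (cong ind e))) (term≤Σ (ind ∘ ins x) y))

  ins⇒Q : ∀ x y → ins x y ≡ true → Q x ∧ Q y ≡ true
  ins⇒Q x y e = ∧-intro (ins⇒Qˡ x y e) (ins⇒Qˡ y x (ins-sym x y e))

  withCore-in : ∀ (q : Fin n → Fin k) (R : VSet n) (H : Graph n) x y → R x ∧ R y ≡ true → adj (withCore q R H) x y ≡ adj H x y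
  withCore-in q R H x y e rewrite e = refl

  withCore-out : ∀ (q : Fin n → Fin k) (R : VSet n) (H : Graph n) x y → R x ∧ R y ≡ false → adj (withCore q R H) x y ≡ not ⌊ q x ≟ q y ⌋
  withCore-out q R H x y e rewrite e = refl

  core-free : ∀ (q : Fin n → Fin k) (R : VSet n) → (∀ x → R x ≡ true → p x ≡ q x) → Free F (withCore q R G)
  core-free q R same = proj₁ max ∘ transfer F (withCore q R G) G q p R m
    (λ x y e out → false⇒ (q x ≟ q y) (not-false (trans (sym (withCore-out q R G x y out)) e))) same
    (λ x y Rx Ry e → trans (sym (withCore-in q R G x y (∧-intro Rx Ry))) e) miss large

  -- The graph `withCore p Q G` contains G, is F-free and has every cross pair that is not inside Q.
  -- A missing pair outside Q would make it strictly better, as `g` is positive at the degrees of G.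
  mis⇒Q : ∀ x y → mis x y ≡ true → Q x ∧ Q y ≡ true
  mis⇒Q x y e with bool-case (Q x ∧ Q y)
  ... | inj₁ t = t
  ... | inj₂ out = ⊥-elim (<⇒≱ (Σ-mono-< {f = λ u → φ (degree G u)} {λ u → φ (degree H u)} (λ u → φ-mono (deg≤ u)) x φ<)
                      (proj₂ max H (core-free p Q (λ _ _ → refl))))
    where
    H = withCore p Q G
    sub : ∀ u w → adj G u w ≡ true → adj H u w ≡ true
    sub u w a with bool-case (Q u ∧ Q w)
    ... | inj₁ t = trans (withCore-in p Q G u w t) a
    ... | inj₂ f = trans (withCore-out p Q G u w f) (not-true (¬true (λ s → true≢false (ins⇒Q u w (∧-intro s a)) f)))
    deg≤ : ∀ u → degree G u ≤ degree H u
    deg≤ u = #-mono (sub u)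
    deg< : degree G x < degree H x
    deg< = Σ-mono-< (λ w → ind-mono (sub x w)) y (subst₂ (λ s t → ind s < ind t)
      (sym (not-false (proj₂ (∧-split {not ⌊ p x ≟ p y ⌋} e)))) (sym (trans (withCore-out p Q G x y out) (proj₁ (∧-split e)))) (s≤s z≤n))
    φ< : φ (degree G x) < φ (degree H x)
    φ< = ≤-trans (≤-trans (≤-reflexive (+-comm 1 _)) (+-monoʳ-≤ (φ (degree G x)) (g-degree x)))
      (≤-trans (≤-reflexive (sym (φ-suc (degree G x)))) (φ-mono deg<))

  b : ℕ
  b = edgesIn G₀ (inPart p₀ a₀)

  private
    cross₀ = proj₁ PD₀
    indep₀ = proj₁ (proj₂ PD₀)

  biex₀ : IsBiex F k n b
  biex₀ = proj₂ (proj₂ (proj₂ PD₀))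

  b≤B : b ≤ B
  b≤B = let H , dfree , e = proj₁ biex₀ in ≤-trans (≤-reflexive (sym e)) (bounded H dfree)

  K+v<p₀ : ∀ i → K + v < partSize p₀ i
  K+v<p₀ = balanced-large k′ (K + v) p₀ n-large bal₀

  2B≤K : 2 * B ≤ K
  2B≤K = ≤-trans (m≤m+n (2 * B) (k′ * (2 * B))) (≤-reflexive (sym K≡))

  X : ℕ
  X = pairs (λ x y → not ⌊ p₀ x ≟ p₀ y ⌋)

  core₀ : Fin n → Fin n → Bool
  core₀ x y = inPart p₀ a₀ x ∧ (inPart p₀ a₀ y ∧ adj G₀ x y)

  2edges₀ : 2 * edges G₀ ≡ X + 2 * b
  2edges₀ = begin
    2 * edges G₀ ≡⟨ 2*edges G₀ ⟩
    pairs (adj G₀) ≡⟨ Σ-cong (λ x → trans (Σ-cong (λ y → term x y)) (Σ-+ (λ y → ind (not ⌊ p₀ x ≟ p₀ y ⌋)) (λ y → ind (core₀ x y)))) ⟩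
    Σᵛ (λ x → # (λ y → not ⌊ p₀ x ≟ p₀ y ⌋) + # (core₀ x)) ≡⟨ Σ-+ (λ x → # (λ y → not ⌊ p₀ x ≟ p₀ y ⌋)) (λ x → # (core₀ x)) ⟩
    X + pairs core₀ ≡⟨ cong (X +_) (2*edgesIn G₀ (inPart p₀ a₀)) ⟨
    X + 2 * b ∎
    where
    open ≡-Reasoning
    term : ∀ x y → ind (adj G₀ x y) ≡ ind (not ⌊ p₀ x ≟ p₀ y ⌋) + ind (core₀ x y)
    term x y with p₀ x ≟ p₀ y
    ... | no ne = trans (cong ind (cross₀ x y ne)) (cong suc (sym (cong ind (¬true {core₀ x y} (λ e →
      let ax , e′ = ∧-split {inPart p₀ a₀ x} e
      in ne (trans (p₀ x ≟ a₀ of ax) (sym (p₀ y ≟ a₀ of proj₁ (∧-split e′)))))))))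
    ... | yes eq with p₀ x ≟ a₀
    ... | no ne = cong ind (indep₀ x y eq ne)
    ... | yes ax rewrite yes⇒ (p₀ y ≟ a₀) (trans (sym eq) ax) = refl

  opaque
    -- The bridge to the hypothesis on ex(n,F): core vertices keep their classes and the others are
    -- redistributed until the sizes are those of a Turán partition. There is room because the core
    -- is bounded.
    relabel : ∃ λ (q : Fin n → Fin k) → (∀ x → Q x ≡ true → q x ≡ p x) × (∀ i → partSize q i ≡ partSize p₀ i)
    relabel = realize n Q p (partSize p₀) (Σ-partSize p₀) (λ i → ≤-trans (#-mono {Q = Q} (λ x e → proj₁ (∧-split e)))
      (≤-trans #Q≤K (≤-trans (m≤m+n K v) (<⇒≤ (K+v<p₀ i)))))

  p₁ : Fin n → Fin k
  p₁ = proj₁ relabel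

  p₁≡p : ∀ x → Q x ≡ true → p₁ x ≡ p x
  p₁≡p = proj₁ (proj₂ relabel)

  X≡ : pairs (λ x y → not ⌊ p₁ x ≟ p₁ y ⌋) ≡ X
  X≡ = +-cancelʳ-≡ (Σᵛ (λ i → partSize p₀ i * partSize p₀ i)) _ _ (trans (trans
    (cong (pairs (λ x y → not ⌊ p₁ x ≟ p₁ y ⌋) +_) (Σ-cong (λ i → cong (λ s → s * s) (sym (proj₂ (proj₂ relabel) i))))) (cross-pairs p₁)) (sym (cross-pairs p₀)))

  -- Core vertices outside the parts of J become ordinary vertices of the Turán partition, so that
  -- `compare` isolates the contribution of J. Pairs are ordered, hence `2 * b`.
  module Sub (J : Fin k → Bool) where
    QJ : VSet n
    QJ x = Q x ∧ J (p x)

    GJ : Graph n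
    GJ = withCore p₁ QJ G

    both insJ misJ : Fin n → Fin n → Bool
    both x y = J (p x) ∧ J (p y)
    insJ x y = both x y ∧ ins x y
    misJ x y = both x y ∧ mis x y

    GJ-free : Free F GJ
    GJ-free = core-free p₁ QJ (λ x e → sym (p₁≡p x (proj₁ (∧-split e))))

    QJ-both : ∀ x y → Q x ∧ Q y ≡ true → both x y ≡ true → QJ x ∧ QJ y ≡ true
    QJ-both x y q j = let Qx , Qy = ∧-split {Q x} q
                          Jx , Jy = ∧-split {J (p x)} j
                      in ∧-intro (∧-intro Qx Jx) (∧-intro Qy Jy)

    2edgesJ : 2 * edges GJ + pairs misJ ≡ X + pairs insJ
    2edgesJ = begin
      2 * edges GJ + pairs misJ ≡⟨ cong (_+ pairs misJ) (2*edges GJ) ⟩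
      pairs (adj GJ) + pairs misJ ≡⟨ pairs-+ (adj GJ) misJ ⟨
      Σᵛ (λ x → Σᵛ (λ y → ind (adj GJ x y) + ind (misJ x y))) ≡⟨ Σ-cong (λ x → Σ-cong (λ y → term x y)) ⟩
      Σᵛ (λ x → Σᵛ (λ y → ind (not ⌊ p₁ x ≟ p₁ y ⌋) + ind (insJ x y))) ≡⟨ pairs-+ (λ x y → not ⌊ p₁ x ≟ p₁ y ⌋) insJ ⟩
      pairs (λ x y → not ⌊ p₁ x ≟ p₁ y ⌋) + pairs insJ ≡⟨ cong (_+ pairs insJ) X≡ ⟩
      X + pairs insJ ∎
      where
      open ≡-Reasoning
      pairs-+ : ∀ (R S : Fin n → Fin n → Bool) → Σᵛ (λ x → Σᵛ (λ y → ind (R x y) + ind (S x y))) ≡ pairs R + pairs S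
      pairs-+ R S = trans (Σ-cong (λ x → Σ-+ (ind ∘ R x) (ind ∘ S x))) (Σ-+ (λ x → # (R x)) (λ x → # (S x)))
      term : ∀ x y → ind (adj GJ x y) + ind (misJ x y) ≡ ind (not ⌊ p₁ x ≟ p₁ y ⌋) + ind (insJ x y)
      term x y with bool-case (QJ x ∧ QJ y)
      ... | inj₂ out = cong₂ _+_ (cong ind (withCore-out p₁ QJ G x y out)) (cong ind (trans
              (¬true {misJ x y} (λ e → let j , e′ = ∧-split {both x y} e in true≢false (QJ-both x y (mis⇒Q x y e′) j) out))
              (sym (¬true {insJ x y} (λ e → let j , e′ = ∧-split {both x y} e in true≢false (QJ-both x y (ins⇒Q x y e′) j) out)))))
      ... | inj₁ t = trans
          (cong₂ _+_ (cong ind (withCore-in p₁ QJ G x y t)) (cong (λ z → ind (z ∧ mis x y)) j))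
          (trans (swap₂ ⌊ p x ≟ p y ⌋ (adj G x y))
            (sym (cong₂ _+_ (cong₂ (λ c d → ind (not ⌊ c ≟ d ⌋)) (p₁≡p x (proj₁ qx)) (p₁≡p y (proj₁ qy))) (cong (λ z → ind (z ∧ ins x y)) j))))
        where
        qx = ∧-split {Q x} (proj₁ (∧-split {QJ x} t))
        qy = ∧-split {Q y} (proj₂ (∧-split {QJ x} t))
        j : both x y ≡ true
        j = ∧-intro (proj₂ qx) (proj₂ qy)

    compare : pairs insJ ≤ 2 * b + pairs misJ
    compare = +-cancelˡ-≤ X _ _ (≤-trans (≤-reflexive (sym 2edgesJ)) (≤-trans (+-monoˡ-≤ (pairs misJ)
      (≤-trans (2 ·≤ proj₂ max₀ GJ GJ-free) (≤-reflexive 2edges₀))) (≤-reflexive (+-assoc X (2 * b) (pairs misJ)))))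

  D : Fin k → ℕ
  D i = n ∸ partSize p i

  -- The slope of `φ` at the lower end of the window from D i - K to D i + K, which contains all
  -- degrees in part i. At the upper end the slope is larger by at most `η`.
  f : Fin k → ℕ
  f i = g (D i ∸ K)

  η threshold : ℕ
  η = 2 * K * h (n + K)
  threshold = suc (K * η)

  i* : Fin k
  i* = proj₁ (argmax D)

  S : ℕ
  S = g (D i*)

  f≤S : ∀ i → f i ≤ S
  f≤S i = g-mono (≤-trans (m∸n≤m (D i) K) (proj₂ (argmax D) i))

  #mis≤K : ∀ x → # (mis x) ≤ K
  #mis≤K x = ≤-trans (#-mono (λ y e → proj₂ (∧-split {Q x} (mis⇒Q x y e)))) #Q≤K

  degree-balance : ∀ x → degree G x + # (mis x) ≡ D (p x) + # (ins x)
  degree-balance x = trans (sym (Σ-+ (ind ∘ adj G x) (ind ∘ mis x))) (trans (Σ-cong (λ y → swap₂ ⌊ p x ≟ p y ⌋ (adj G x y)))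
    (trans (Σ-+ (λ y → ind (not ⌊ p x ≟ p y ⌋)) (ind ∘ ins x)) (cong (_+ # (ins x)) (outside x))))
    where
    outside : ∀ x → # (λ y → not ⌊ p x ≟ p y ⌋) ≡ D (p x)
    outside x = trans (sym (m+n∸n≡m _ (partSize p (p x)))) (cong (_∸ partSize p (p x)) (cross-degree p x))

  -- Linearization for a = d + w - u: a missing pair costs at least the lowest slope of the window,
  -- and an inner edge gains at most the lowest slope plus `η`.
  shift : ∀ a u d w → a + u ≡ d + w → u ≤ K → w ≤ K → K ≤ d → d ≤ n → φ a + u * g (d ∸ K) ≤ φ d + w * (g (d ∸ K) + η)
  shift a u d w e u≤K w≤K K≤d d≤n with ≤-total u w
  ... | inj₁ u≤w = begin
    φ a + u * g (d ∸ K) ≤⟨ +-monoˡ-≤ (u * g (d ∸ K)) (≤-trans (≤-reflexive (cong φ a≡)) (φ-loss d z)) ⟩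
    φ d + z * g (d + z) + u * g (d ∸ K) ≤⟨ +-mono-≤ (+-monoʳ-≤ (φ d) (z ·≤ ≤-trans (g-mono (+-monoʳ-≤ d (≤-trans (m∸n≤m w u) w≤K))) g⁺)) (u ·≤ m≤m+n (g (d ∸ K)) η) ⟩
    φ d + z * (g (d ∸ K) + η) + u * (g (d ∸ K) + η) ≡⟨ trans (+-assoc (φ d) _ _) (cong (φ d +_) (trans (sym (*-distribʳ-+ (g (d ∸ K) + η) z u)) (cong (_* (g (d ∸ K) + η)) (m∸n+n≡m u≤w)))) ⟩
    φ d + w * (g (d ∸ K) + η) ∎
    where
    open ≤-Reasoning
    z = w ∸ u
    g⁺ : g (d + K) ≤ g (d ∸ K) + η
    g⁺ = ≤-trans (≤-reflexive (cong g d+K)) (≤-trans (G′.loss (d ∸ K) (2 * K)) (+-monoʳ-≤ (g (d ∸ K)) (2 * K ·≤ h-mono (≤-trans (≤-reflexive (sym d+K)) (+-monoˡ-≤ K d≤n)))))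
      where
      d+K : d + K ≡ d ∸ K + 2 * K
      d+K = trans (cong (_+ K) (sym (m∸n+n≡m K≤d))) (trans (+-assoc (d ∸ K) K K) (cong (λ y → d ∸ K + (K + y)) (sym (+-identityʳ K))))
    a≡ : a ≡ d + z
    a≡ = +-cancelʳ-≡ u _ _ (trans e (trans (cong (d +_) (sym (m∸n+n≡m u≤w))) (sym (+-assoc d z u))))
  ... | inj₂ w≤u = begin
    φ a + u * g (d ∸ K) ≡⟨ cong (λ y → φ a + y * g (d ∸ K)) (sym (m∸n+n≡m w≤u)) ⟩
    φ a + (z + w) * g (d ∸ K) ≡⟨ trans (cong (φ a +_) (*-distribʳ-+ (g (d ∸ K)) z w)) (sym (+-assoc (φ a) _ _)) ⟩
    φ a + z * g (d ∸ K) + w * g (d ∸ K) ≤⟨ +-mono-≤ (≤-trans (+-monoʳ-≤ (φ a) (z ·≤ g-mono low)) (≤-trans (φ-gain a z) (≤-reflexive (cong φ a+z)))) (w ·≤ m≤m+n (g (d ∸ K)) η) ⟩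
    φ d + w * (g (d ∸ K) + η) ∎
    where
    open ≤-Reasoning
    z = u ∸ w
    a+z : a + z ≡ d
    a+z = +-cancelʳ-≡ w _ _ (trans (+-assoc a z w) (trans (cong (a +_) (m∸n+n≡m w≤u)) e))
    low : d ∸ K ≤ a
    low = ≤-trans (∸-monoʳ-≤ d (≤-trans (m∸n≤m u w) u≤K)) (≤-reflexive (trans (cong (_∸ z) (sym a+z)) (m+n∸n≡m a z)))

  base insWeight misWeight : ℕ
  base = Σᵛ (λ x → φ (D (p x)))
  insWeight = Σᵛ (λ x → # (ins x) * f (p x))
  misWeight = Σᵛ (λ x → # (mis x) * f (p x))

  upper : degSum φ G + misWeight ≤ base + (insWeight + K * η)
  upper = begin
    degSum φ G + misWeight
      ≡⟨ Σ-+ (λ x → φ (degree G x)) (λ x → # (mis x) * f (p x)) ⟨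
    Σᵛ (λ x → φ (degree G x) + # (mis x) * f (p x))
      ≤⟨ Σ-mono (λ x → shift (degree G x) (# (mis x)) (D (p x)) (# (ins x)) (degree-balance x) (#mis≤K x)
           (≤-trans (term≤Σ (λ z → # (ins z)) x) ins-total) (K≤D (p x)) (m∸n≤m n (partSize p (p x)))) ⟩
    Σᵛ (λ x → φ (D (p x)) + # (ins x) * (f (p x) + η))
      ≡⟨ Σ-cong (λ x → cong (φ (D (p x)) +_) (*-distribˡ-+ (# (ins x)) (f (p x)) η)) ⟩
    Σᵛ (λ x → φ (D (p x)) + (# (ins x) * f (p x) + # (ins x) * η))
      ≡⟨ trans (Σ-+ (λ x → φ (D (p x))) (λ x → # (ins x) * f (p x) + # (ins x) * η))
           (cong (base +_) (trans (Σ-+ (λ x → # (ins x) * f (p x)) (λ x → # (ins x) * η)) (cong (insWeight +_) (Σ-*ʳ η (λ x → # (ins x)))))) ⟩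
    base + (insWeight + pairs ins * η)
      ≤⟨ +-monoʳ-≤ base (+-monoʳ-≤ insWeight (*-monoˡ-≤ η ins-total)) ⟩
    base + (insWeight + K * η) ∎
    where open ≤-Reasoning

  -- Layer-cake decomposition of the weights f over the sets of parts of weight > s.
  module _ (strict : suc (pairs ins) ≤ 2 * b + pairs mis) (threshold≤S : threshold ≤ S) where

    private
      J : Fin S → Fin k → Bool
      J s i = toℕ s <ᵇ f i
      module L (s : Fin S) = Sub (J s)

      layer : ∀ s → pairs (L.insJ s) + ind (toℕ s <ᵇ threshold) ≤ 2 * b + pairs (L.misJ s)
      layer s with bool-case (toℕ s <ᵇ threshold)
      ... | inj₂ above = ≤-trans (≤-reflexive (trans (cong (λ z → pairs (L.insJ s) + ind z) above) (+-identityʳ (pairs (L.insJ s))))) (L.compare s)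
      -- Below `threshold` every part belongs to the layer because all weights exceed `K * η`. So
      -- the strict inequality for the set of all parts applies and saves one unit per layer.
      ... | inj₁ below = ≤-trans (≤-reflexive (trans (trans (cong (λ z → pairs (L.insJ s) + ind z) below) (+-comm _ 1)) (cong suc (pairs-cong (λ x y → cong (_∧ ins x y) (full-layer x y))))))
              (≤-trans strict (≤-reflexive (cong (2 * b +_) (sym (pairs-cong (λ x y → cong (_∧ mis x y) (full-layer x y)))))))
        where
        s< : toℕ s < threshold
        s< with toℕ s <? threshold
        ... | yes q = q
        ... | no ¬q = ⊥-elim (true≢false below (<ᵇ-false (≮⇒≥ ¬q)))
        full-layer : ∀ x y → L.both s x y ≡ true
        full-layer x y = ∧-intro (<ᵇ-true (≤-trans s< (curvature (p x)))) (<ᵇ-true (≤-trans s< (curvature (p y))))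

      exchange-sums : ∀ (R : Fin S → Fin n → Fin n → Bool) → Σᵛ (λ s → pairs (R s)) ≡ Σᵛ (λ x → Σᵛ (λ y → Σᵛ (λ s → ind (R s x y))))
      exchange-sums R = trans (Σ-swap (λ s x → # (R s x))) (Σ-cong (λ x → Σ-swap (λ s y → ind (R s x y))))

      collect : ∀ (R : Fin n → Fin n → Bool) → Σᵛ (λ x → # (R x) * f (p x)) ≡ Σᵛ (λ x → Σᵛ (λ y → ind (R x y) * f (p x)))
      collect R = Σ-cong (λ x → sym (Σ-*ʳ (f (p x)) (ind ∘ R x)))

      ins-layers : insWeight ≤ Σᵛ (λ s → pairs (L.insJ s))
      ins-layers = ≤-trans (≤-reflexive (collect ins)) (≤-trans (Σ-mono (λ x → Σ-mono (λ y → term x y))) (≤-reflexive (sym (exchange-sums L.insJ))))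
        where
        term : ∀ x y → ind (ins x y) * f (p x) ≤ Σᵛ (λ s → ind (L.insJ s x y))
        term x y with bool-case (ins x y)
        ... | inj₂ e = ≤-trans (≤-reflexive (cong (λ z → ind z * f (p x)) e)) z≤n
        ... | inj₁ e = ≤-trans (≤-reflexive (trans (cong (_* f (p x)) (cong ind e)) (trans (+-identityʳ (f (p x))) (sym (count-below S (f (p x)) (f≤S (p x)))))))
                (Σ-mono (λ s → ind-mono {J s (p x)} {L.insJ s x y} (λ j → ∧-intro (∧-intro j (subst (λ i → J s i ≡ true) (p x ≟ p y of proj₁ (∧-split e)) j)) e)))

      mis-layers : Σᵛ (λ s → pairs (L.misJ s)) ≤ misWeight
      mis-layers = ≤-trans (≤-reflexive (exchange-sums L.misJ)) (≤-trans (Σ-mono (λ x → Σ-mono (λ y → term x y))) (≤-reflexive (sym (collect mis))))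
        where
        term : ∀ x y → Σᵛ (λ s → ind (L.misJ s x y)) ≤ ind (mis x y) * f (p x)
        term x y with bool-case (mis x y)
        ... | inj₂ e = ≤-trans (≤-reflexive (Σ-0 {S} (λ s → cong ind (¬true {L.misJ s x y} (λ t → true≢false (proj₂ (∧-split {L.both s x y} t)) e))))) z≤n
        ... | inj₁ e = ≤-trans (Σ-mono (λ s → ind-mono {L.misJ s x y} {J s (p x)} (λ j → proj₁ (∧-split {J s (p x)} (proj₁ (∧-split j))))))
                (≤-reflexive (trans (count-below S (f (p x)) (f≤S (p x))) (sym (trans (cong (_* f (p x)) (cong ind e)) (+-identityʳ (f (p x)))))))

    cake : insWeight + threshold ≤ S * (2 * b) + misWeight
    cake = begin
      insWeight + threshold ≤⟨ +-mono-≤ ins-layers (≤-reflexive (sym (count-below S threshold threshold≤S))) ⟩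
      Σᵛ (λ s → pairs (L.insJ s)) + # {S} (λ s → toℕ s <ᵇ threshold) ≡⟨ Σ-+ (λ s → pairs (L.insJ s)) (λ s → ind (toℕ s <ᵇ threshold)) ⟨
      Σᵛ (λ s → pairs (L.insJ s) + ind (toℕ s <ᵇ threshold)) ≤⟨ Σ-mono layer ⟩
      Σᵛ (λ s → 2 * b + pairs (L.misJ s)) ≡⟨ Σ-+ (λ _ → 2 * b) (λ s → pairs (L.misJ s)) ⟩
      Σᵛ {S} (λ _ → 2 * b) + Σᵛ (λ s → pairs (L.misJ s)) ≤⟨ +-mono-≤ (≤-reflexive (Σ-const {S} (2 * b))) mis-layers ⟩
      S * (2 * b) + misWeight ∎
      where open ≤-Reasoning

  Q₀ : VSet n
  Q₀ x = inPart p₀ a₀ x ∧ ⌊ 1 ≤? # (core₀ x) ⌋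

  core₀-total : pairs core₀ ≡ 2 * b
  core₀-total = sym (2*edgesIn G₀ (inPart p₀ a₀))

  #Q₀≤K : # Q₀ ≤ K
  #Q₀≤K = ≤-trans (Σ-mono term) (≤-trans (≤-reflexive core₀-total) (≤-trans (2 ·≤ b≤B) 2B≤K))
    where
    term : ∀ x → ind (Q₀ x) ≤ # (core₀ x)
    term x with bool-case (Q₀ x)
    ... | inj₁ t = ≤-trans (≤-reflexive (cong ind t)) (1 ≤? # (core₀ x) of proj₂ (∧-split {inPart p₀ a₀ x} t))
    ... | inj₂ e = ≤-trans (≤-reflexive (cong ind e)) z≤n

  core₀⇒Q₀ : ∀ x y → core₀ x y ≡ true → (Q₀ x ∧ Q₀ y) ∧ adj G₀ x y ≡ true
  core₀⇒Q₀ x y e =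
    let ax , e′ = ∧-split {inPart p₀ a₀ x} e
        ay , xy = ∧-split {inPart p₀ a₀ y} e′
        e″ = ∧-intro ay (∧-intro ax (trans (adj-sym G₀ y x) xy))
    in ∧-intro (∧-intro (∧-intro ax (nonzero x y e)) (∧-intro ay (nonzero y x e″))) xy
    where
    nonzero : ∀ u w → core₀ u w ≡ true → ⌊ 1 ≤? # (core₀ u) ⌋ ≡ true
    nonzero u w t = yes⇒ (1 ≤? # (core₀ u)) (≤-trans (≤-reflexive (sym (cong ind t))) (term≤Σ (ind ∘ core₀ u) w))

  opaque
    relabel* : ∃ λ (q : Fin n → Fin k) → (∀ x → Q₀ x ≡ true → q x ≡ i*) × (∀ i → partSize q i ≡ partSize p i)
    relabel* = realize n Q₀ (λ _ → i*) (partSize p) (Σ-partSize p) (λ i →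
      ≤-trans (#-mono {Q = Q₀} (λ x e → proj₁ (∧-split e))) (≤-trans #Q₀≤K (<⇒≤ (K<part i))))

  p* : Fin n → Fin k
  p* = proj₁ relabel*

  p*≡ : ∀ x → Q₀ x ≡ true → p* x ≡ i*
  p*≡ = proj₁ (proj₂ relabel*)

  -- The competitor: the part sizes of G, with the core of G₀ placed in a smallest part.
  G* : Graph n
  G* = withCore p* Q₀ G₀

  G*-free : Free F G*
  G*-free = proj₁ max₀ ∘ transfer F G* G₀ (swapF i* a₀ ∘ p*) p₀ Q₀ 0
    (λ x y e out eq → false⇒ (p* x ≟ p* y) (not-false (trans (sym (withCore-out p* Q₀ G₀ x y out)) e)) (swapF-injective i* a₀ eq))
    -- The transposition of `i*` and `a₀` matches the part that carries the core with its
    -- counterpart in `G₀`.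
    (λ x e → trans (p₀ x ≟ a₀ of proj₁ (∧-split e)) (sym (trans (cong (swapF i* a₀) (p*≡ x e)) (swapF-left i* a₀))))
    (λ x y Qx Qy e → trans (sym (withCore-in p* Q₀ G₀ x y (∧-intro Qx Qy))) e)
    (λ y j ne → ≤-reflexive (Σ-0 (λ a → cong ind (¬true {inPart p₀ j a ∧ not (adj G₀ y a)} (λ e →
      let ja , na = ∧-split {inPart p₀ j a} e
      in true≢false (cross₀ y a (λ q → ne (trans q (p₀ a ≟ j of ja)))) (not-false na))))))
    (λ i → ≤-trans (s≤s (≤-trans (≤-reflexive (*-identityʳ v)) (m≤n+m v K))) (K+v<p₀ i))

  -- In a smallest part each end of a transplanted edge gains at least `S`, the slope at the largest
  -- cross degree, by convexity.
  lower : base + S * (2 * b) ≤ degSum φ G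
  lower = ≤-trans (begin
      base + S * (2 * b)
        ≡⟨ cong₂ _+_ same-sizes (trans (*-comm S (2 * b)) (cong (_* S) (sym core₀-total))) ⟩
      base* + pairs core₀ * S
        ≤⟨ +-monoʳ-≤ base* (*-monoˡ-≤ S (pairs-mono core₀⇒Q₀)) ⟩
      base* + pairs inner * S
        ≡⟨ cong (base* +_) (Σ-*ʳ S (λ x → # (inner x))) ⟨
      base* + Σᵛ (λ x → # (inner x) * S)
        ≡⟨ Σ-+ (λ x → φ (D (p* x))) (λ x → # (inner x) * S) ⟨
      Σᵛ (λ x → φ (D (p* x)) + # (inner x) * S)
        ≤⟨ Σ-mono term ⟩
      degSum φ G* ∎)
    (proj₂ max G* G*-free)
    where
    open ≤-Reasoning
    base* : ℕ
    base* = Σᵛ (λ x → φ (D (p* x)))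
    inner : Fin n → Fin n → Bool
    inner x y = (Q₀ x ∧ Q₀ y) ∧ adj G₀ x y
    same-sizes : base ≡ base*
    same-sizes = trans (Σ-fibres p (φ ∘ D)) (trans (Σ-cong (λ i → cong (_* φ (D i)) (sym (proj₂ (proj₂ relabel*) i)))) (sym (Σ-fibres p* (φ ∘ D))))
    split : ∀ x y → ind (not ⌊ p* x ≟ p* y ⌋) + ind (inner x y) ≡ ind (adj G* x y)
    split x y with bool-case (Q₀ x ∧ Q₀ y)
    ... | inj₁ t = trans (cong₂ _+_ (cong (ind ∘ not) (yes⇒ (p* x ≟ p* y) (trans (p*≡ x (proj₁ (∧-split t))) (sym (p*≡ y (proj₂ (∧-split {Q₀ x} t)))))))
                    (cong (λ z → ind (z ∧ adj G₀ x y)) t)) (cong ind (sym (withCore-in p* Q₀ G₀ x y t)))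
    ... | inj₂ f = trans (cong (λ z → ind (not ⌊ p* x ≟ p* y ⌋) + ind (z ∧ adj G₀ x y)) f) (trans (+-identityʳ _) (cong ind (sym (withCore-out p* Q₀ G₀ x y f))))
    deg* : ∀ x → D (p* x) + # (inner x) ≡ degree G* x
    deg* x = trans (cong (_+ # (inner x)) (trans (cong (n ∸_) (sym (proj₂ (proj₂ relabel*) (p* x))))
        (trans (cong (_∸ partSize p* (p* x)) (sym (cross-degree p* x))) (m+n∸n≡m _ (partSize p* (p* x))))))
      (trans (sym (Σ-+ (λ y → ind (not ⌊ p* x ≟ p* y ⌋)) (ind ∘ inner x))) (Σ-cong (split x)))
    term : ∀ x → φ (D (p* x)) + # (inner x) * S ≤ φ (degree G* x)
    term x with bool-case (Q₀ x)
    ... | inj₁ t = ≤-trans (≤-reflexive (cong (λ i → φ (D (p* x)) + # (inner x) * g (D i)) (sym (p*≡ x t))))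
                    (≤-trans (φ-gain (D (p* x)) (# (inner x))) (≤-reflexive (cong φ (deg* x))))
    ... | inj₂ f = ≤-trans (≤-reflexive (trans (cong (λ z → φ (D (p* x)) + z * S) (Σ-0 (λ y → cong (λ z → ind ((z ∧ Q₀ y) ∧ adj G₀ x y)) f))) (+-identityʳ _)))
                    (φ-mono (≤-trans (m≤m+n _ (# (inner x))) (≤-reflexive (deg* x))))

  -- Otherwise `cake` yields a surplus of `threshold`, one more than the error `K * η` in `upper`,
  -- and the value of G would fall below that of the competitor in `lower`.
  tight : 2 * b + pairs mis ≤ pairs ins
  tight with 2 * b + pairs mis ≤? pairs ins
  ... | yes q = q
  ... | no ¬q = ⊥-elim (contra insWeight threshold (S * (2 * b)) misWeight (degSum φ G) base (K * η) refl
      (cake (≰⇒> ¬q) (≤-trans (curvature i*) (f≤S i*))) upper lower)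
    where
    contra : ∀ A w s c W P e → w ≡ suc e → A + w ≤ s + c → W + c ≤ P + (A + e) → P + s ≤ W → ⊥
    contra A _ s c W P e refl x y z = n≮n 0 (lin 0 (x +≤ y +≤ z) (solve (A ∷ s ∷ c ∷ W ∷ P ∷ e ∷ [])))

  private
    module Whole = Sub (λ _ → true)

  -- By `tight`, the whole configuration placed on Turán sizes has at least as many edges as `G₀`,
  -- so the hypothesis describes it.
  whole-max : MaximizesAmongFree F edges Whole.GJ
  whole-max = Whole.GJ-free , λ H free → ≤-trans (proj₂ max₀ H free) (*-cancelˡ-≤ 2 (+-cancelʳ-≤ (pairs mis) _ _
    (≤-trans (≤-reflexive (trans (cong (_+ pairs mis) 2edges₀) (+-assoc X (2 * b) (pairs mis))))
      (≤-trans (+-monoʳ-≤ X tight) (≤-reflexive (sym Whole.2edgesJ))))))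

  module Conclude (p₃ : Fin n → Fin k) (bal₃ : ∀ i j → partSize p₃ i ≤ suc (partSize p₃ j))
    (a₃ : Fin k) (PD₃ : PartitePlusD F k Whole.GJ p₃ a₃) where

    private
      cross₃ = proj₁ PD₃
      indep₃ = proj₁ (proj₂ PD₃)

    opaque
      outsider : ∀ i → ∃ λ z → p₁ z ≡ i × Q z ≡ false
      outsider i = let z , lt = Σ-<-witness (ind ∘ Q) (ind ∘ inPart p₁ i)
                         (≤-trans (s≤s (≤-trans #Q≤K (m≤m+n K v))) (≤-trans (K+v<p₀ i) (≤-reflexive (sym (proj₂ (proj₂ relabel) i)))))
                       e , f = pick (Q z) (inPart p₁ i z) lt
                   in z , (p₁ z ≟ i of f) , e
        where
        pick : ∀ q r → ind q < ind r → q ≡ false × r ≡ true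
        pick false true _ = refl , refl
        pick true true (s≤s ())

    σ : Fin k → Fin k
    σ i = p₃ (proj₁ (outsider i))
    -- A vertex x is not adjacent to the outsider of its class, whereas distinct classes of `p₃` are
    -- completely joined. Thus `p₃` coarsens `p₁`, and since no class of `p₃` is empty, `σ` is a
    -- bijection.
    coarser : ∀ x → p₃ x ≡ σ (p₁ x)
    coarser x with p₃ x ≟ σ (p₁ x)
    ... | yes q = q
    ... | no ne = ⊥-elim (true≢false (cross₃ x z ne) (trans (withCore-out p₁ Whole.QJ G x z out) (cong not (yes⇒ (p₁ x ≟ p₁ z) (sym (proj₁ (proj₂ (outsider (p₁ x)))))))))
      where
      z = proj₁ (outsider (p₁ x))
      out : Whole.QJ x ∧ Whole.QJ z ≡ false
      out = ¬true (λ t → true≢false (proj₁ (∧-split (proj₂ (∧-split {Whole.QJ x} t)))) (proj₂ (proj₂ (outsider (p₁ x)))))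
    opaque
      σ-onto : ∀ c → ∃ λ i → σ i ≡ c
      σ-onto c = let x , e = #-witness (inPart p₃ c) (≤-trans (s≤s z≤n) (balanced-large k′ (K + v) p₃ n-large bal₃ c))
                 in p₁ x , trans (sym (coarser x)) (p₃ x ≟ c of e)

    σ-inj : ∀ i j → σ i ≡ σ j → i ≡ j
    σ-inj = surjective⇒injective σ σ-onto
    GJ-core : ∀ x y → Q x ∧ Q y ≡ true → adj Whole.GJ x y ≡ adj G x y
    GJ-core x y q = withCore-in p₁ Whole.QJ G x y (Whole.QJ-both x y q refl)
    cross : ∀ x y → p x ≢ p y → adj G x y ≡ true
    cross x y ne with bool-case (adj G x y)
    ... | inj₁ t = t
    ... | inj₂ f = trans (sym (GJ-core x y q)) (cross₃ x y (λ e → ne (trans (sym (p₁≡p x (proj₁ (∧-split q))))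
                    (trans (σ-inj _ _ (trans (sym (coarser x)) (trans e (coarser y)))) (p₁≡p y (proj₂ (∧-split {Q x} q)))))))
      where
      q : Q x ∧ Q y ≡ true
      q = mis⇒Q x y (∧-intro (not-true (no⇒ (p x ≟ p y) ne)) (not-true f))
    a : Fin k
    a = proj₁ (σ-onto a₃)
    indep : ∀ x y → p x ≡ p y → p x ≢ a → adj G x y ≡ false
    indep x y e ne = ¬true (λ t →
      let q = ins⇒Q x y (∧-intro (yes⇒ (p x ≟ p y) e) t)
          p₁x = p₁≡p x (proj₁ (∧-split q))
          p₁y = p₁≡p y (proj₂ (∧-split {Q x} q))
      in true≢false (trans (GJ-core x y q) t) (indep₃ x y
           (trans (coarser x) (trans (cong σ (trans p₁x (trans e (sym p₁y)))) (sym (coarser y))))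
           (λ x₃ → ne (trans (sym p₁x) (σ-inj _ _ (trans (sym (coarser x)) (trans x₃ (sym (proj₂ (σ-onto a₃))))))))))
    pairs-mis : pairs mis ≡ 0
    pairs-mis = Σ-0 (λ x → Σ-0 (λ y → cong ind (¬true {mis x y} (λ e → let ne , na = ∧-split {not ⌊ p x ≟ p y ⌋} e
      in true≢false (cross x y (false⇒ (p x ≟ p y) (not-false ne))) (not-false na)))))
    -- All inner edges lie in part a and no cross pair is missing, so `tight` and `compare` for the
    -- set of all parts bound their number from both sides.
    edges-a : edgesIn G (inPart p a) ≡ b
    edges-a = *-cancelˡ-≡ _ _ 2 (trans (trans (2*edgesIn G (inPart p a)) (pairs-cong (λ x y → iff-≡ (to x y) (from x y))))
      (≤-antisym (≤-trans (Whole.compare) (≤-reflexive (trans (cong (2 * b +_) pairs-mis) (+-identityʳ _))))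
        (≤-trans (m≤m+n (2 * b) (pairs mis)) tight)))
      where
      to : ∀ x y → inPart p a x ∧ (inPart p a y ∧ adj G x y) ≡ true → ins x y ≡ true
      to x y e = let ax , e′ = ∧-split {inPart p a x} e
                     ay , xy = ∧-split {inPart p a y} e′
                 in ∧-intro (yes⇒ (p x ≟ p y) (trans (p x ≟ a of ax) (sym (p y ≟ a of ay)))) xy
      from : ∀ x y → ins x y ≡ true → inPart p a x ∧ (inPart p a y ∧ adj G x y) ≡ true
      from x y e with ∧-split {⌊ p x ≟ p y ⌋} e | p x ≟ a
      ... | s , xy | yes ax = ∧-intro {true} refl (∧-intro (yes⇒ (p y ≟ a) (trans (sym (p x ≟ p y of s)) ax)) xy)
      ... | s , xy | no ne = ⊥-elim (true≢false xy (indep x y (p x ≟ p y of s) ne))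

    complete-partite : CompletePartitePlusD F k G
    complete-partite = p , (λ i → let x , e = #-witness (inPart p i) (≤-trans (s≤s z≤n) (K<part i)) in x , (p x ≟ i of e))
      , a , cross , indep , part-decomp-free a , subst (IsBiex F k n) (sym edges-a) biex₀

  conclusion : CompletePartitePlusD F k G
  conclusion = let p₃ , bal₃ , a₃ , PD₃ = turan Whole.GJ whole-max in Conclude.complete-partite p₃ bal₃ a₃ PD₃

-- Choice of constants and assembly

opaque
  choose-M₁ : ∀ M e → ∃ λ M₁ → 1 ≤ M₁ × 2 * M ≤ M₁ × e ≤ M₁
  choose-M₁ M e = suc (2 * M + e) , s≤s z≤n , ≤-trans (m≤m+n (2 * M) e) (n≤1+n _) , ≤-trans (m≤n+m e (2 * M)) (n≤1+n _)

  choose-Eb : ∀ a b c d → ∃ λ E → a ≤ E × b ≤ E × c ≤ E × d ≤ E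
  choose-Eb a b c d = a + (b + (c + d)) , m≤m+n a _ , ≤-trans (m≤m+n b _) (m≤n+m _ a)
    , ≤-trans (m≤m+n c d) (≤-trans (m≤n+m _ b) (m≤n+m _ a)) , ≤-trans (m≤n+m d c) (≤-trans (m≤n+m _ b) (m≤n+m _ a))

  choose-N : ∀ a b → ∃ λ N → a ≤ N × b < N
  choose-N a b = a + suc b , m≤m+n a _ , m≤n+m (suc b) a

  choose-m : ∀ a b → ∃ λ m → 1 ≤ m × a ≤ m × b ≤ m
  choose-m a b = suc (a + b) , s≤s z≤n , ≤-trans (m≤m+n a b) (n≤1+n _) , ≤-trans (m≤n+m b a) (n≤1+n _)

module Extremal (Gr : Growth) {v : ℕ} (F : Graph v) (k″ : ℕ)
  (χ : ¬ Colorable F (2 + k″)) (colouring : Colorable F (3 + k″))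
  (B nB : ℕ) (bounded : ∀ n → nB ≤ n → (H : Graph n) → ¬ ContainsDecomp F (2 + k″) H full → edges H ≤ B)
  (nT : ℕ) (turan : ∀ n → nT ≤ n → (H : Graph n) → MaximizesAmongFree F edges H → TuranPlusD F (2 + k″) H) where
  open GrowthFacts Gr
  open Exchange Gr
  open FindBlocks Gr F (suc k″) χ colouring using (heavy-blocks) renaming (Γ to Γ₁)

  private
    k′ k : ℕ
    k′ = suc k″
    k = suc k′

  opaque
    dense-blocks : ∃ λ Γ → ∀ Δ t → ∃[ n₀ ] (∀ n → n₀ ≤ n → (G : Graph n) → Maximal φ F G → HeavyBlocks G k t Γ Δ)
    dense-blocks = Γ₁ , heavy-blocks

  Γ : ℕ
  Γ = proj₁ dense-blocks

  structured : ∀ M → ∃[ n₀ ] (∀ n → n₀ ≤ n → (G : Graph n) → Maximal φ F G → Structured G k (2 * Γ) M)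
  structured M with exchange-bound (2 * M)
  ... | E₂ , n₂ , ex₂ with choose-M₁ M (4 * E₂ * v)
  ... | M₁ , 1≤M₁ , 2M≤M₁ , 4E₂v≤M₁ with exchange-bound M₁
  ... | E₁ , n₁ , ex₁ with choose-Eb (4 * Γ) (2 * E₁) (2 * E₂) (2 * M)
  ... | Eb , 4Γ≤Eb , 2E₁≤Eb , 2E₂≤Eb , 2M≤Eb with choose-N (8 * Γ) (3 * v) | choose-m v (2 * v * Eb)
  ... | N , 8Γ≤N , 3v<N | m , 1≤m , v≤m , 2vEb≤m with proj₂ dense-blocks (2 * N * Eb) (N * m)
  ... | n₃ , blocks = n₁ + (n₂ + (n₃ + (nB + (4 * B * E₁ + 4 * E₂ * v)))) , λ n le G max →
    let le₁ , r₁ = +-≤-split n₁ le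
        le₂ , r₂ = +-≤-split n₂ r₁
        le₃ , r₃ = +-≤-split n₃ r₂
        le₄ , r₄ = +-≤-split nB r₃
        le₅ , le₆ = +-≤-split (4 * B * E₁) r₄
    in Classify.structured {Gr = Gr} {F = F} {B = B} record
         { near = bounded⇒near F k′ B nB χ bounded ; max = max ; bounded = bounded n le₄
         ; M₁ = M₁ ; E₁ = E₁ ; E₂ = E₂ ; Eb = Eb ; N = N ; m = m ; Δ = 2 * N * Eb
         ; exchange₁ = ex₁ n le₁ ; exchange₂ = ex₂ n le₂ ; blocks = blocks n le₃ G max
         ; Δ≡ = refl ; 8Γ≤N = 8Γ≤N ; 3v<N = 3v<N ; 1≤m = 1≤m ; v≤m = v≤m ; 2vEb≤m = 2vEb≤m
         ; 4Γ≤Eb = 4Γ≤Eb ; 2E₁≤Eb = 2E₁≤Eb ; 2E₂≤Eb = 2E₂≤Eb ; 2M≤Eb = 2M≤Eb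
         ; 1≤M₁ = 1≤M₁ ; 2M≤M₁ = 2M≤M₁ ; 4E₂v≤M₁ = 4E₂v≤M₁ ; 4BE₁≤n = le₅ ; 4E₂v≤n = le₆
         }

  module _ {n : ℕ} (G : Graph n) (max : Maximal φ F G) {M Γ₂ K : ℕ} {{_ : NonZero M}} (St : Structured G k Γ₂ M)
    (2Γ₂≤M : 2 * Γ₂ ≤ M) (2Γ₂v≤M : 2 * Γ₂ * v ≤ M) (2Γ₂v<n : 2 * Γ₂ * v < n) (Γ₂K<n : Γ₂ * K < n) where
    open Structured St

    cross-degree≤ : ∀ x → n ∸ partSize p (p x) ≤ degree G x + # (λ y → not ⌊ p x ≟ p y ⌋ ∧ not (adj G x y))
    cross-degree≤ x = begin
      n ∸ partSize p (p x) ≡⟨ cong (_∸ partSize p (p x)) (sym (cross-degree p x)) ⟩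
      # other + partSize p (p x) ∸ partSize p (p x) ≡⟨ m+n∸n≡m (# other) (partSize p (p x)) ⟩
      # other ≤⟨ Σ-mono term ⟩
      Σᵛ (λ y → ind (adj G x y) + ind (other y ∧ not (adj G x y))) ≡⟨ Σ-+ (ind ∘ adj G x) (λ y → ind (other y ∧ not (adj G x y))) ⟩
      degree G x + # (λ y → other y ∧ not (adj G x y)) ∎
      where
      open ≤-Reasoning
      other : VSet n
      other y = not ⌊ p x ≟ p y ⌋
      term : ∀ y → ind (other y) ≤ ind (adj G x y) + ind (other y ∧ not (adj G x y))
      term y with other y | adj G x y
      ... | false | _ = z≤n
      ... | true | true = s≤s z≤n
      ... | true | false = s≤s z≤n

    -- As k ≥ 2, the complement of a part contains another part. This makes all degrees linear in n,
    -- where slopes are positive and curvature is negligible.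
    complement-large : ∀ i → n ≤ Γ₂ * (n ∸ partSize p i)
    complement-large i = ≤-trans (parts-large j) (Γ₂ ·≤ m+n≤o⇒m≤o∸n (partSize p j)
      (≤-trans (two-terms (partSize p) {j} {i} j≢i) (≤-reflexive (Σ-partSize p))))
      where
      another : ∀ i → ∃ λ (j : Fin k) → j ≢ i
      another zero = suc zero , λ ()
      another (suc i) = zero , λ ()
      j = proj₁ (another i)
      j≢i = proj₂ (another i)

    degree-large : ∀ x → n ≤ 2 * Γ₂ * degree G x
    degree-large x = arith n Γ₂ M _ (degree G x) _ (complement-large (p x)) (cross-degree≤ x) 2Γ₂≤M (cross-miss x)
      where
      arith : ∀ n Γ M D d m → n ≤ Γ * D → D ≤ d + m → 2 * Γ ≤ M → M * m ≤ n → n ≤ 2 * Γ * d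
      arith n Γ M D d m a c e f = lin 0 (2 ·≤ a +≤ (2 * Γ) ·≤ c +≤ m ·≤ e +≤ f) (solve (n ∷ Γ ∷ M ∷ D ∷ d ∷ m ∷ []))

    miss-≤ : ∀ y j → p y ≢ j → # (λ a → inPart p j a ∧ not (adj G y a)) ≤ n / M
    miss-≤ y j ne = ≤-trans (#-mono (λ a e → let ja , na = ∧-split {inPart p j a} e
      in ∧-intro (not-true (no⇒ (p y ≟ p a) (λ q → ne (trans q (p a ≟ j of ja))))) na)) (≤-quotient M (cross-miss y))

    reservoir : ∀ i → v * suc (n / M) < partSize p i
    reservoir i = *-cancelˡ-< Γ₂ _ _ (≤-trans (arith Γ₂ v (n / M) M n (≤-trans (≤-reflexive (*-comm M (n / M))) (m/n*n≤m n M)) 2Γ₂v≤M 2Γ₂v<n) (parts-large i))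
      where
      arith : ∀ Γ v m M n → M * m ≤ n → 2 * Γ * v ≤ M → 2 * Γ * v < n → Γ * (v * suc m) < n
      arith Γ v m M n a c e = *-cancelˡ-< 2 (Γ * (v * suc m)) n (lin 0 (a +≤ m ·≤ c +≤ e) (solve (Γ ∷ v ∷ m ∷ M ∷ n ∷ [])))

    K<-from : ∀ s → n ≤ Γ₂ * s → K < s
    K<-from s q = *-cancelˡ-< Γ₂ _ _ (≤-trans Γ₂K<n q)

    near-extremal : nB ≤ n → nT ≤ n → K ≡ k * (2 * B) → k * (2 + (K + v)) < n →
      (∀ d → n ≤ 2 * Γ₂ * d → 1 ≤ g d) →
      (∀ d → n ≤ Γ₂ * d → K * (2 * K * h (n + K)) < g (d ∸ K)) → CompletePartitePlusD F k G
    near-extremal nB≤n nT≤n K≡ n-large g-positive curvature =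
      let G₀ , max₀ = edge-maximizer F G (proj₁ max)
          p₀ , bal₀ , a₀ , PD₀ = turan n nT≤n G₀ max₀
      in Final.conclusion {Gr = Gr} {F = F} {k′ = k′} {B = B} {G = G} record
           { max = max ; bounded = bounded n nB≤n ; turan = turan n nT≤n
           ; G₀ = G₀ ; max₀ = max₀ ; p₀ = p₀ ; bal₀ = bal₀ ; a₀ = a₀ ; PD₀ = PD₀
           ; p = p ; m = n / M ; K = K ; miss = miss-≤ ; large = reservoir ; K≡ = K≡
           ; K<part = λ i → K<-from (partSize p i) (parts-large i) ; n-large = n-large
           ; g-degree = λ x → g-positive (degree G x) (degree-large x)
           ; K≤D = λ i → <⇒≤ (K<-from (n ∸ partSize p i) (complement-large i))
           ; curvature = λ i → curvature (n ∸ partSize p i) (complement-large i)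
           }

  opaque
    core-size : ∃ λ K → K ≡ k * (2 * B)
    core-size = k * (2 * B) , refl

  Eventually : (ℕ → Set) → Set
  Eventually P = ∃[ n₀ ] (∀ n → n₀ ≤ n → P n)

  combine : ∀ K Γ₂ M → K ≡ k * (2 * B) → 1 ≤ M × 2 * Γ₂ ≤ M × 2 * Γ₂ * v ≤ M →
    Eventually (λ n → (G : Graph n) → Maximal φ F G → Structured G k Γ₂ M) →
    Eventually (λ n → ∀ d → n ≤ 2 * Γ₂ * d → 1 ≤ g d) →
    Eventually (λ n → ∀ d → n ≤ Γ₂ * d → K * (2 * K * h (n + K)) < g (d ∸ K)) →
    Eventually (λ n → (G : Graph n) → Maximal φ F G → CompletePartitePlusD F k G)
  combine K Γ₂ M K≡ (1≤M , 2Γ₂≤M , 2Γ₂v≤M) (n₁ , st) (n₂ , pos) (n₃ , curv) =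
    n₁ + (n₂ + (n₃ + (nB + (nT + (suc (2 * Γ₂ * v) + (suc (Γ₂ * K) + suc (k * (2 + (K + v))))))))) , λ n le G max →
    let le₁ , r₁ = +-≤-split n₁ le
        le₂ , r₂ = +-≤-split n₂ r₁
        le₃ , r₃ = +-≤-split n₃ r₂
        le₄ , r₄ = +-≤-split nB r₃
        le₅ , r₅ = +-≤-split nT r₄
        le₆ , r₆ = +-≤-split (suc (2 * Γ₂ * v)) r₅
        le₇ , le₈ = +-≤-split (suc (Γ₂ * K)) r₆
    in near-extremal G max {{>-nonZero 1≤M}} (st n le₁ G max) 2Γ₂≤M 2Γ₂v≤M le₆ le₇
         le₄ le₅ K≡ le₈ (pos n le₂) (curv n le₃)

  g-eventually-positive : ∀ Γ₂ → Eventually (λ n → ∀ d → n ≤ 2 * Γ₂ * d → 1 ≤ g d)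
  g-eventually-positive Γ₂ = let n₀ , pos = curvature-negligible (2 * Γ₂) 0 0 in n₀ , λ n le d q → proj₁ (pos n d le q)

  curvature-eventually : ∀ Γ₂ K → Eventually (λ n → ∀ d → n ≤ Γ₂ * d → K * (2 * K * h (n + K)) < g (d ∸ K))
  curvature-eventually Γ₂ K = let n₀ , curv = curvature-negligible Γ₂ K K in n₀ , λ n le d q → proj₂ (curv n d le q)

  extremal : Eventually (λ n → (G : Graph n) → Maximal φ F G → CompletePartitePlusD F k G)
  extremal = combine (proj₁ core-size) (2 * Γ) (proj₁ (choose-M₁ (2 * Γ) (2 * (2 * Γ) * v))) (proj₂ core-size)
    (proj₂ (choose-M₁ (2 * Γ) (2 * (2 * Γ) * v))) (structured _) (g-eventually-positive (2 * Γ)) (curvature-eventually (2 * Γ) (proj₁ core-size))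

theorem1p9 : ∀ {v} (F : Graph v) (k : ℕ) → IsChromaticNumber F (suc k) → 2 ≤ k →
    (r : ℕ) → 1 ≤ r →
    (∃[ C ] ∃[ n₀ ] (∀ n → n₀ ≤ n → (H : Graph n) → ¬ ContainsDecomp F k H full → edges H ≤ C)) →
    (∃[ n₀ ] (∀ n → n₀ ≤ n → (G : Graph n) → MaximizesAmongFree F edges G → TuranPlusD F k G)) →
    ∃[ n₀ ] (∀ n → n₀ ≤ n → (G : Graph n) →
    (MaximizesAmongFree F (Nstar r) G → CompletePartitePlusD F k G) ×
    (MaximizesAmongFree F (eR r) G → CompletePartitePlusD F k G))
theorem1p9 F (suc (suc k″)) (colouring , least) (s≤s (s≤s _)) r 1≤r (B , nB , bounded) (nT , turan) = result r 1≤r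
  where
  χ : ¬ Colorable F (2 + k″)
  χ c = n≮n _ (least (2 + k″) c)
  extremal : (Gr : Growth) → ∃[ n₀ ] (∀ n → n₀ ≤ n → (G : Graph n) → Maximal (GrowthFacts.φ Gr) F G → CompletePartitePlusD F (2 + k″) G)
  extremal Gr = Extremal.extremal Gr F k″ χ colouring B nB bounded nT turan
  2edges : ∀ {n} (G : Graph n) → 2 * edges G ≡ degSum (_^ 1) G
  2edges G = trans (2*edges G) (Σ-cong (λ x → sym (*-identityʳ (degree G x))))
  result : ∀ r → 1 ≤ r → ∃[ n₀ ] (∀ n → n₀ ≤ n → (G : Graph n) →
    (MaximizesAmongFree F (Nstar r) G → CompletePartitePlusD F (2 + k″) G) ×
    (MaximizesAmongFree F (eR r) G → CompletePartitePlusD F (2 + k″) G))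
  -- The star with one leaf counts edges, which is half of the degree sum, so both objectives have
  -- the same maximizers.
  result (suc zero) 1≤r =
    let n₀ , ext = extremal (power-growth 1 1≤r)
    in n₀ , λ n le G →
      (λ (free , max) → ext n le G (free , λ H fr → subst₂ _≤_ (2edges H) (2edges G) (2 ·≤ max H fr))) , ext n le G
  result (suc (suc r)) 1≤r =
    let n₁ , ext₁ = extremal (binomial-growth r)
        n₂ , ext₂ = extremal (power-growth (suc (suc r)) 1≤r)
    in n₁ + n₂ , λ n le G → ext₁ n (proj₁ (+-≤-split n₁ le)) G , ext₂ n (proj₂ (+-≤-split n₁ le)) G
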